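{- Let $n\ge 3$ and $c\ge s\ge 3$ be integers, let $\alpha=\lfloor (n-1)/(c-1)\rfloor$ and $p=n-1-\alpha(c-1)$ (so $0\le p\le c-2$). Let $G$ be a connected graph on $n$ vertices with circumference $c(G)\le c$, and suppose that $N_s(G)=h_s(n,c)$, where $h_s(n,c)=\alpha\binom{c}{s}+\binom{p+1}{s}$. Then: (i) if $s\le p+1$, $G$ is isomorphic to $H_{n,c}$; (ii) otherwise (i.e. if $s\ge p+2$), $L(G,c)$ is a connected graph composed of $\alpha$ blocks each of which is $K_c$, while the remaining blocks are complete graphs.
   Context: All graphs are finite and simple; equality of graphs means isomorphism. $N_s(G)$ denotes the number of $s$-cliques (complete subgraphs on $s$ vertices) of $G$. The circumference $c(G)$ is the length of a longest cycle of $G$. $H_{n,c}$ is the connected graph consisting of $\alpha$ blocks each of which is $K_c$ and one further block which is $K_{p+1}$ (when $p=0$ every block is $K_c$); the number of $s$-cliques of $H_{n,c}$ is $h_s(n,c)$. For a connected graph $G$ with $c(G)\le c$, $L(G,c)$ denotes an edge-maximal graph with respect to $G$ and $c$: a graph on the vertex set $V(G)$ containing $G$ as a spanning subgraph, with $c(L(G,c))\le c$, such that for every non-edge $e$ of $L(G,c)$ we have $c(L(G,c)+e)>c$. -}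

module Defs where

open import Data.Nat using (ℕ; zero; suc; _+_; _*_; _∸_; _≤_; _<_; NonZero; _/_)
import Data.Nat as ℕ
open import Data.Nat.Combinatorics using (_C_)

open import Data.Bool using (Bool; true; false; _∨_; _∧_)
import Data.Bool as Bool
open import Data.Fin using (Fin; zero; suc; inject₁; fromℕ; _≟_)
open import Data.Fin.Subset using (Subset; inside; outside; _∈_; _⊆_; ∣_∣; ⊤; _-_)
open import Data.Fin.Subset.Properties using (_∈?_)
open import Data.Fin.Properties using (decFinSubset)
open import Data.List using (List; []; _∷_; _++_; map; length; filter)
open import Data.Vec using (Vec; []; _∷_)
open import Data.Product using (Σ; ∃; _×_; _,_)
open import Data.Sum using (_⊎_)
open import Function.Definitions using (Injective)
open import Relation.Binary.PropositionalEquality using (_≡_; _≢_)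
open import Relation.Nullary using (¬_; Dec; ¬?; _×-dec_; _→-dec_; does)

Adj : ℕ → Set
Adj n = Fin n → Fin n → Bool

record Graph (n : ℕ) : Set where
  field
    adj    : Adj n
    sym    : ∀ u v → adj u v ≡ adj v u
    irrefl : ∀ v → adj v v ≡ false
open Graph public

IsComplete : ∀ {n} → Adj n → Subset n → Set
IsComplete A S = ∀ {u} → u ∈ S → ∀ {v} → v ∈ S → u ≢ v → A u v ≡ true

complete? : ∀ {n} (A : Adj n) (S : Subset n) → Dec (IsComplete A S)
complete? A S = decFinSubset (_∈? S) λ {u} _ →
  decFinSubset (_∈? S) λ {v} _ → ¬? (u ≟ v) →-dec (A u v Bool.≟ true)

allSubsets : ∀ n → List (Subset n)
allSubsets zero = [] ∷ []
allSubsets (suc n) = map (outside ∷_) (allSubsets n) ++ map (inside ∷_) (allSubsets n)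

N : ℕ → ∀ {n} → Graph n → ℕ
N s {n} G = length (filter (λ S → (∣ S ∣ ℕ.≟ s) ×-dec complete? (adj G) S) (allSubsets n))

alpha : (n c : ℕ) → 3 ≤ c → ℕ
alpha n c h = _/_ (n ∸ 1) (c ∸ 1) {{ℕ.>-nonZero (lemma h)}}
  where
  lemma : 3 ≤ c → 0 < c ∸ 1
  lemma (ℕ.s≤s (ℕ.s≤s (ℕ.s≤s _))) = ℕ.s≤s ℕ.z≤n

rem : (n c : ℕ) → 3 ≤ c → ℕ
rem n c h = n ∸ 1 ∸ alpha n c h * (c ∸ 1)

hval : (s n c : ℕ) → 3 ≤ c → ℕ
hval s n c h = alpha n c h * (c C s) + (suc (rem n c h) C s)

IsClosedWalk : ∀ {n} → Adj n → (m : ℕ) → (Fin (suc m) → Fin n) → Set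
IsClosedWalk A m f =
  (∀ (i : Fin m) → A (f (inject₁ i)) (f (suc i)) ≡ true) × (A (f (fromℕ m)) (f zero) ≡ true)

IsCycle : ∀ {n} → Adj n → (m : ℕ) → (Fin (suc m) → Fin n) → Set
IsCycle A m f = 3 ≤ suc m × Injective _≡_ _≡_ f × IsClosedWalk A m f

CircumferenceAtMost : ∀ {n} → Adj n → ℕ → Set
CircumferenceAtMost {n} A c = ∀ m (f : Fin (suc m) → Fin n) → IsCycle A m f → suc m ≤ c

addEdge : ∀ {n} → Adj n → Fin n → Fin n → Adj n
addEdge A u v x y = A x y ∨ ((does (x ≟ u) ∧ does (y ≟ v)) ∨ (does (x ≟ v) ∧ does (y ≟ u)))

data PathIn {n} (A : Adj n) (S : Subset n) : Fin n → Fin n → Set where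
  here : ∀ {u} → u ∈ S → PathIn A S u u
  step : ∀ {u w v} → u ∈ S → A u w ≡ true → PathIn A S w v → PathIn A S u v

ConnectedOn : ∀ {n} → Adj n → Subset n → Set
ConnectedOn A S = ∀ {u v} → u ∈ S → v ∈ S → PathIn A S u v

Connected : ∀ {n} → Graph n → Set
Connected G = ConnectedOn (adj G) ⊤

Nonseparable : ∀ {n} → Adj n → Subset n → Set
Nonseparable A S =
  (∃ λ v → v ∈ S) × ConnectedOn A S × (∀ {v} → v ∈ S → ConnectedOn A (S - v))

IsBlock : ∀ {n} → Adj n → Subset n → Set
IsBlock A S = Nonseparable A S × (∀ T → S ⊆ T → Nonseparable A T → T ≡ S)

IsKBlock : ∀ {n} → Adj n → ℕ → Subset n → Set
IsKBlock A k B = IsBlock A B × IsComplete A B × ∣ B ∣ ≡ k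

-- G is (a copy of) H_{n,c}: connected, with exactly α blocks K_c and
-- one further block K_{p+1} (no further block when p = 0).
IsH : ∀ {n} → Graph n → (α p c : ℕ) → Set
IsH {n} G α p c =
  Connected G ×
  Σ (Fin α → Subset n) λ B →
    Injective _≡_ _≡_ B × (∀ i → IsKBlock (adj G) c (B i)) ×
    ( (p ≡ 0 × (∀ D → IsBlock (adj G) D → ∃ λ i → D ≡ B i))
    ⊎ (0 < p × Σ (Subset n) λ D₀ → IsKBlock (adj G) (suc p) D₀ ×
         (∀ D → IsBlock (adj G) D → (∃ λ i → D ≡ B i) ⊎ D ≡ D₀)) )

IsαKcRestComplete : ∀ {n} → Graph n → (α c : ℕ) → Set
IsαKcRestComplete {n} L α c =
  Connected L ×
  Σ (Fin α → Subset n) λ B →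
    Injective _≡_ _≡_ B × (∀ i → IsKBlock (adj L) c (B i)) ×
    (∀ D → IsBlock (adj L) D →
       IsComplete (adj L) D × (∣ D ∣ ≡ c → ∃ λ i → D ≡ B i))

IsEdgeMaximal : ∀ {n} → Graph n → ℕ → Graph n → Set
IsEdgeMaximal {n} G c L =
  (∀ u v → adj G u v ≡ true → adj L u v ≡ true) ×
  CircumferenceAtMost (adj L) c ×
  (∀ u v → u ≢ v → adj L u v ≡ false → ¬ CircumferenceAtMost (addEdge (adj L) u v) c)

{-# OPTIONS --safe #-}

-- Let d = c - 1. A graph of circumference at most c has at most h_s(|S|, c) s-cliques inside any vertex set S, with
-- strict inequality if S is nonseparable and |S| > c; h_s is superadditive in |S| - 1, so cutting G at its cut vertices
-- reduces the count to the blocks, and equality forces every block to have at most c vertices and exactly α of them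
-- to have c.
-- For a nonseparable S with |S| > c one may assume edge-maximality and follows Kopylov. Nonadjacent x, y are then the
-- ends of a path on more than c vertices; if x has j neighbours and y has k neighbours on it and j + k > c, Pósa's
-- lemma yields a cycle longer than c. Hence cores of minimum degree j and k with j + k > c are completely joined.
-- So either d vertices of degree at most c/2 can be removed one after the other, or what remains is a clique on l
-- vertices outside of which all vertices can be removed with degree at most c + 1 - l; both cases leave too few
-- cliques by convexity of binomial coefficients.
module Submission where

open import Defs
open import Data.Nat using (ℕ; suc; _≤_; _<_)
open import Relation.Binary.PropositionalEquality using (_≡_)
open import Data.Product using (_×_)

open import Data.Bool using (Bool; true; false; _∨_; _∧_; if_then_else_)
import Data.Bool as Bool
open import Data.Bool.Properties using (∨-zeroʳ; ¬-not; ∨-comm; ∧-comm)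
import Data.Empty as Empty
open import Data.Fin using (Fin; zero; suc; fromℕ; inject₁; _≟_)
open import Data.Fin.Properties using (any?)
open import Data.Fin.Subset using (Subset; inside; outside; _∈_; _∉_; _⊆_; ∣_∣; ⊤; ⊥; ⁅_⁆; _─_; _-_; _∪_)
open import Data.Fin.Subset.Properties
open import Data.List using (List; []; _∷_; _++_; map; length; filter; reverse; allFin; cartesianProduct; lookup; tabulate)
open import Data.Nat.ListAction using (sum)
open import Data.Nat.ListAction.Properties using (sum-++)
open import Data.List.Properties using (length-++; length-map; map-++; length-reverse; ++-assoc; unfold-reverse; reverse-++; length-tabulate; filter-accept; filter-reject; filter-++; filter-none)
open import Data.List.Membership.Propositional using (find; lose) renaming (_∈_ to _∈ˡ_; _∉_ to _∉ˡ_)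
open import Data.List.Membership.Propositional.Properties
open import Data.List.Relation.Unary.Any using (Any; here; there)
import Data.List.Relation.Unary.Any as Any
open import Data.List.Relation.Unary.Any.Properties using (reverse⁺; reverse⁻; lookup-index)
open import Data.List.Relation.Unary.All using (All; []; _∷_)
import Data.List.Relation.Unary.All as All
import Data.List.Relation.Unary.All.Properties as AllP
open import Data.List.Relation.Unary.AllPairs using ([]; _∷_)
open import Data.List.Relation.Unary.Unique.Propositional using (Unique)
import Data.List.Relation.Unary.Unique.Propositional.Properties as UniqueP
open import Data.Nat hiding (_≟_; ∣_-_∣)
import Data.Nat as ℕ
open import Data.Nat.Combinatorics using (_C_; nCk≡nC[n∸k]; nCk+nC[k+1]≡[n+1]C[k+1]; nCn≡1; k>n⇒nCk≡0)
open import Data.Nat.DivMod using (m≡m%n+[m/n]*n; m%n<n; m<n⇒m%n≡m; [m+kn]%n≡m%n; m*n/n≡m; m<n⇒m/n≡0; +-distrib-/-∣ʳ; m%n≡m∸m/n*n; m/n*n≤m)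
open import Data.Nat.Divisibility using (divides-refl)
open import Data.Nat.Properties hiding (_≟_)
open import Data.Nat.Solver using (module +-*-Solver)
open import Data.Product using (∃; _,_; proj₁; proj₂)
open import Data.Sum using (_⊎_; inj₁; inj₂; [_,_]′)
open import Data.Vec using (_∷_; [])
import Data.Vec as Vec
import Data.Vec.Properties as VecP
open import Function using (_∘_; id; case_of_)
open import Function.Definitions using (Injective)
open import Relation.Binary.PropositionalEquality using (_≢_; refl; cong; cong₂; subst; subst₂; trans) renaming (sym to ≡sym)
open import Relation.Nullary using (¬_; Dec; yes; no; does; contradiction; ¬?; _×-dec_; _⊎-dec_)
open import Relation.Nullary.Decidable using (decidable-stable; dec-true)
open import Relation.Unary using (Decidable)

-- Maximality cannot be imposed on `G` beforehand, since added edges change the blocks. It is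
-- imposed on one set `S` at a time, by contradiction, as the strict inequality to be proved is
-- decidable; the bound for smaller sets is therefore kept for all graphs at once. It is also kept
-- for disconnected sets, because the vertices that survive a removal of low degrees need not be
-- connected. Equality forces every block to attain its bound, after which the two conclusions
-- diverge. If `s ≤ p + 1`, a clique on `p + 1` vertices contains `s`-cliques, and strict
-- superadditivity forbids replacing it by several smaller blocks. If `s ≥ p + 2`, the blocks other
-- than the `K_c` have fewer than `s` vertices and the count is blind to them; they are complete
-- because an edge added inside a block, when all blocks have at most `c` vertices, never creates a
-- cycle longer than `c`. In the numerical lemmas `c = d + 1` and `s = k + 2`, so `k < d` means
-- `s ≤ c`; sizes enter diminished by one, which makes them additive when sets are glued at a
-- vertex.

private variable
  n : ℕ

-- Pigeonhole; clique counts, numbers of non-edges and lengths of cycles are compared through it.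
unique⊆⇒length≤ : {X : Set} {xs ys : List X} → Unique xs →
  (∀ {x} → x ∈ˡ xs → x ∈ˡ ys) → length xs ≤ length ys
unique⊆⇒length≤ {xs = []} _ _ = z≤n
unique⊆⇒length≤ {xs = x ∷ xs} (x∉ ∷ u) f with ∈-∃++ (f (here refl))
... | as , bs , refl = begin
  suc (length xs)             ≤⟨ s≤s (unique⊆⇒length≤ u g) ⟩
  suc (length (as ++ bs))     ≡⟨ cong suc (length-++ as) ⟩
  suc (length as + length bs) ≡⟨ +-suc (length as) (length bs) ⟨
  length as + suc (length bs) ≡⟨ length-++ as ⟨
  length (as ++ x ∷ bs)       ∎
  where
  open ≤-Reasoning
  g : ∀ {y} → y ∈ˡ xs → y ∈ˡ as ++ bs
  g p with ∈-++⁻ as (f (there p))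
  ... | inj₁ q = ∈-++⁺ˡ q
  ... | inj₂ (here refl) = contradiction refl (All.lookup x∉ p)
  ... | inj₂ (there q) = ∈-++⁺ʳ as q

unique-map : {X Y : Set} (f : X → Y) {xs : List X} → Unique xs →
  (∀ {x y} → x ∈ˡ xs → y ∈ˡ xs → f x ≡ f y → x ≡ y) → Unique (map f xs)
unique-map f [] _ = []
unique-map f (x∉ ∷ u) inj =
  AllP.map⁺ (All.tabulate λ p e → All.lookup x∉ p (inj (here refl) (there p) e))
  ∷ unique-map f u λ p q → inj (there p) (there q)

unique-++ : {X : Set} {xs ys : List X} → Unique xs → Unique ys →
  (∀ {x} → x ∈ˡ xs → x ∉ˡ ys) → Unique (xs ++ ys)
unique-++ u v d = UniqueP.++⁺ u v λ (p , q) → d p q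

∉⇒All≢ : {X : Set} {x : X} {xs : List X} → x ∉ˡ xs → All (x ≢_) xs
∉⇒All≢ x∉ = All.tabulate λ { p refl → x∉ p }

unique-++⁻ : {X : Set} (xs : List X) {ys : List X} → Unique (xs ++ ys) →
  Unique xs × Unique ys × (∀ {x} → x ∈ˡ xs → x ∉ˡ ys)
unique-++⁻ [] u = [] , u , λ ()
unique-++⁻ (x ∷ xs) (x∉ ∷ u) with unique-++⁻ xs u
... | ux , uy , d = AllP.++⁻ˡ xs x∉ ∷ ux , uy ,
  λ { (here refl) q → All.lookup (AllP.++⁻ʳ xs x∉) q refl ; (there p) → d p }

unique-reverse : {X : Set} {xs : List X} → Unique xs → Unique (reverse xs)
unique-reverse [] = []
unique-reverse {xs = x ∷ xs} (x∉ ∷ u) =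
  subst Unique (≡sym (unfold-reverse x xs))
    (unique-++ (unique-reverse u) ([] ∷ [])
      λ { p (here refl) → All.lookup x∉ (reverse⁻ p) refl })

-- Counting subsets

∈-allSubsets : (T : Subset n) → T ∈ˡ allSubsets n
∈-allSubsets [] = here refl
∈-allSubsets (outside ∷ T) = ∈-++⁺ˡ (∈-map⁺ (outside ∷_) (∈-allSubsets T))
∈-allSubsets {suc n} (inside ∷ T) =
  ∈-++⁺ʳ (map (outside ∷_) (allSubsets n)) (∈-map⁺ (inside ∷_) (∈-allSubsets T))

unique-allSubsets : ∀ n → Unique (allSubsets n)
unique-allSubsets zero = [] ∷ []
unique-allSubsets (suc n) = unique-++
  (unique-map _ (unique-allSubsets n) λ _ _ → VecP.∷-injectiveʳ)
  (unique-map _ (unique-allSubsets n) λ _ _ → VecP.∷-injectiveʳ)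
  disj
  where
  disj : ∀ {T} → T ∈ˡ map (outside ∷_) (allSubsets n) → T ∉ˡ map (inside ∷_) (allSubsets n)
  disj p q with ∈-map⁻ _ p | ∈-map⁻ _ q
  ... | _ , _ , refl | _ , _ , ()

count : {P : Subset n → Set} → Decidable P → ℕ
count {n} P? = length (filter P? (allSubsets n))

module _ {P : Subset n → Set} (P? : Decidable P) where

  private
    unique-filter : Unique (filter P? (allSubsets n))
    unique-filter = UniqueP.filter⁺ P? (unique-allSubsets n)

    sat : ∀ {T} → T ∈ˡ filter P? (allSubsets n) → P T
    sat p = proj₂ (∈-filter⁻ P? {xs = allSubsets n} p)

  count≤list : (l : List (Subset n)) → (∀ {T} → P T → T ∈ˡ l) → count P? ≤ length l
  count≤list l f = unique⊆⇒length≤ unique-filter (f ∘ sat)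

  count≤count-image : ∀ {m} {Q : Subset m → Set} (Q? : Decidable Q) (f : Subset n → Subset m) →
    (∀ {T} → P T → Q (f T)) → (∀ {T U} → P T → P U → f T ≡ f U → T ≡ U) → count P? ≤ count Q?
  count≤count-image {m} Q? f f∈ inj = subst (_≤ count Q?) (length-map f (filter P? (allSubsets n)))
    (unique⊆⇒length≤ (unique-map f unique-filter λ p q → inj (sat p) (sat q)) g)
    where
    g : ∀ {U} → U ∈ˡ map f (filter P? (allSubsets n)) → U ∈ˡ filter Q? (allSubsets m)
    g p with ∈-map⁻ f p
    ... | T , q , refl = ∈-filter⁺ Q? (∈-allSubsets (f T)) (f∈ (sat q))

  count-mono : {Q : Subset n → Set} (Q? : Decidable Q) → (∀ {T} → P T → Q T) → count P? ≤ count Q?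
  count-mono Q? f = count≤count-image Q? id f λ _ _ e → e

  count-mono-strict : {Q : Subset n → Set} (Q? : Decidable Q) → (∀ {T} → P T → Q T) →
    ∀ {U} → Q U → ¬ P U → count P? < count Q?
  count-mono-strict Q? f {U} QU ¬PU =
    unique⊆⇒length≤ (All.tabulate (λ { p refl → ¬PU (sat p) }) ∷ unique-filter) g
    where
    g : ∀ {T} → T ∈ˡ U ∷ filter P? (allSubsets n) → T ∈ˡ filter Q? (allSubsets n)
    g (here refl) = ∈-filter⁺ Q? (∈-allSubsets U) QU
    g {T} (there p) = ∈-filter⁺ Q? (∈-allSubsets T) (f (sat p))

  count-⊎ : {Q R : Subset n → Set} (Q? : Decidable Q) (R? : Decidable R) →
    (∀ {T} → P T → Q T ⊎ R T) → count P? ≤ count Q? + count R?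
  count-⊎ Q? R? f = subst (count P? ≤_) (length-++ (filter Q? (allSubsets n)))
    (count≤list _ λ {T} PT → case f PT of λ where
      (inj₁ QT) → ∈-++⁺ˡ (∈-filter⁺ Q? (∈-allSubsets T) QT)
      (inj₂ RT) → ∈-++⁺ʳ (filter Q? (allSubsets n)) (∈-filter⁺ R? (∈-allSubsets T) RT))

-- Cardinalities

∣p-x∣ : {p : Subset n} {x : Fin n} → x ∈ p → suc ∣ p - x ∣ ≡ ∣ p ∣
∣p-x∣ {p = inside ∷ p} {zero} Vec.here = cong (suc ∘ ∣_∣) (p─⊥≡p p)
∣p-x∣ {p = inside ∷ p} {suc x} (Vec.there q) = cong suc (∣p-x∣ q)
∣p-x∣ {p = outside ∷ p} {suc x} (Vec.there q) = ∣p-x∣ q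

x∉p-x : (p : Subset n) (x : Fin n) → x ∉ p - x
x∉p-x (_ ∷ p) zero ()
x∉p-x (_ ∷ p) (suc x) (Vec.there q) = x∉p-x p x q

∈p-x⇒≢ : {p : Subset n} {x y : Fin n} → y ∈ p - x → y ≢ x
∈p-x⇒≢ {p = p} {x} q refl = x∉p-x p x q

∈p-x⇒∈p : {p : Subset n} {x y : Fin n} → y ∈ p - x → y ∈ p
∈p-x⇒∈p {p = p} {x} = p─q⊆p p ⁅ x ⁆

p-x≡p : {p : Subset n} {x : Fin n} → x ∉ p → p - x ≡ p
p-x≡p {p = p} x∉ = ⊆-antisym ∈p-x⇒∈p λ {y} q → x∈p∧x≢y⇒x∈p-y q λ { refl → x∉ q }

unique⇒length≤∣∣ : {l : List (Fin n)} {p : Subset n} → Unique l → All (_∈ p) l → length l ≤ ∣ p ∣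
unique⇒length≤∣∣ [] [] = z≤n
unique⇒length≤∣∣ (x∉ ∷ u) (x∈ ∷ ps) = subst (_ ≤_) (∣p-x∣ x∈)
  (s≤s (unique⇒length≤∣∣ u (All.tabulate λ q →
    x∈p∧x≢y⇒x∈p-y (All.lookup ps q) (All.lookup x∉ q ∘ ≡sym))))

∣∣≤length : (l : List (Fin n)) {p : Subset n} → (∀ {x} → x ∈ p → x ∈ˡ l) → ∣ p ∣ ≤ length l
∣∣≤length {n} [] {p} f = ≤-reflexive (trans (cong ∣_∣ (Empty-unique λ (x , q) → case f q of λ ())) (∣⊥∣≡0 n))
∣∣≤length (x ∷ l) {p} f with x ∈? p
... | yes x∈ = subst (_≤ _) (∣p-x∣ x∈) (s≤s (∣∣≤length l {p - x} λ q → case f (∈p-x⇒∈p q) of λ where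
    (here e) → contradiction e (∈p-x⇒≢ q)
    (there r) → r))
... | no x∉ = m≤n⇒m≤1+n (∣∣≤length l {p} λ q → case f q of λ where
    (here refl) → contradiction q x∉
    (there r) → r)

elements : Subset n → List (Fin n)
elements {n} p = filter (_∈? p) (allFin n)

∈-elements : {p : Subset n} {x : Fin n} → x ∈ p → x ∈ˡ elements p
∈-elements {p = p} {x} = ∈-filter⁺ (_∈? p) (∈-allFin x)

∈-elements⁻ : {p : Subset n} {x : Fin n} → x ∈ˡ elements p → x ∈ p
∈-elements⁻ {n} {p} q = proj₂ (∈-filter⁻ (_∈? p) {xs = allFin n} q)

unique-elements : (p : Subset n) → Unique (elements p)
unique-elements {n} p = UniqueP.filter⁺ (_∈? p) (UniqueP.allFin⁺ n)

length-elements : (p : Subset n) → length (elements p) ≡ ∣ p ∣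
length-elements p = ≤-antisym
  (unique⇒length≤∣∣ (unique-elements p) (All.tabulate ∈-elements⁻))
  (∣∣≤length (elements p) ∈-elements)

⊆∧∣∣≥⇒≡ : {p q : Subset n} → p ⊆ q → ∣ q ∣ ≤ ∣ p ∣ → p ≡ q
⊆∧∣∣≥⇒≡ {p = p} {q} f h = ⊆-antisym f λ {x} x∈q →
  decidable-stable (x ∈? p) λ x∉p → <-irrefl refl (<-≤-trans (p⊂q⇒∣p∣<∣q∣ (f , x , x∈q , x∉p)) h)

∣∣+∣∣-disjoint : {p q r : Subset n} → p ⊆ r → q ⊆ r → (∀ {x} → x ∈ p → x ∉ q) → ∣ p ∣ + ∣ q ∣ ≤ ∣ r ∣
∣∣+∣∣-disjoint {p = p} {q} {r} f g d = subst₂ (λ a b → a + b ≤ ∣ r ∣) (length-elements p) (length-elements q)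
  (subst (_≤ ∣ r ∣) (length-++ (elements p))
    (unique⇒length≤∣∣
      (unique-++ (unique-elements p) (unique-elements q) λ a b → d (∈-elements⁻ a) (∈-elements⁻ b))
      (AllP.++⁺ (All.tabulate (f ∘ ∈-elements⁻)) (All.tabulate (g ∘ ∈-elements⁻)))))

∣∣≤∣∣+∣∣ : {p q r : Subset n} → (∀ {x} → x ∈ r → x ∈ p ⊎ x ∈ q) → ∣ r ∣ ≤ ∣ p ∣ + ∣ q ∣
∣∣≤∣∣+∣∣ {p = p} {q} {r} f = subst₂ (λ a b → ∣ r ∣ ≤ a + b) (length-elements p) (length-elements q)
  (subst (∣ r ∣ ≤_) (length-++ (elements p))
    (∣∣≤length _ λ x∈ → [ (λ a → ∈-++⁺ˡ (∈-elements a)) , (λ b → ∈-++⁺ʳ (elements p) (∈-elements b)) ]′ (f x∈)))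

∣∣>0⇒Nonempty : {p : Subset n} → 0 < ∣ p ∣ → ∃ λ x → x ∈ p
∣∣>0⇒Nonempty {n} {p} h with nonempty? p
... | yes e = e
... | no ¬e = contradiction (trans (cong ∣_∣ (Empty-unique ¬e)) (∣⊥∣≡0 n)) (>⇒≢ h)

∈⇒∣∣>0 : {p : Subset n} {x : Fin n} → x ∈ p → 0 < ∣ p ∣
∈⇒∣∣>0 x∈ = subst (0 <_) (∣p-x∣ x∈) z<s

two⇒∣∣>1 : {p : Subset n} {x y : Fin n} → x ∈ p → y ∈ p → x ≢ y → 1 < ∣ p ∣
two⇒∣∣>1 x∈ y∈ ne = unique⇒length≤∣∣ ((ne ∷ []) ∷ [] ∷ []) (x∈ ∷ y∈ ∷ [])

∣∣>1⇒other : {p : Subset n} (x : Fin n) → 1 < ∣ p ∣ → ∃ λ y → y ∈ p × y ≢ x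
∣∣>1⇒other {p = p} x h with x ∈? p
... | yes x∈ with ∣∣>0⇒Nonempty {p = p - x} (s<s⁻¹ (subst (1 <_) (≡sym (∣p-x∣ x∈)) h))
...   | y , q = y , ∈p-x⇒∈p q , ∈p-x⇒≢ q
∣∣>1⇒other {p = p} x h | no x∉ with ∣∣>0⇒Nonempty {p = p} (<-trans z<s h)
... | y , q = y , q , λ { refl → x∉ q }

subsetOf : (Fin n → Bool) → Subset n
subsetOf = Vec.tabulate

∈-subsetOf⁺ : {f : Fin n → Bool} {x : Fin n} → f x ≡ true → x ∈ subsetOf f
∈-subsetOf⁺ {f = f} {x} e = VecP.lookup⇒[]= x _ (trans (VecP.lookup∘tabulate f x) e)

∈-subsetOf⁻ : {f : Fin n → Bool} {x : Fin n} → x ∈ subsetOf f → f x ≡ true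
∈-subsetOf⁻ {f = f} {x} q = trans (≡sym (VecP.lookup∘tabulate f x)) (VecP.[]=⇒lookup q)

-- Binomial bounds for the number of s-element subsets

private
  kSubset? : (k : ℕ) (S : Subset n) → Decidable (λ T → ∣ T ∣ ≡ k × T ⊆ S)
  kSubset? k S T = (∣ T ∣ ℕ.≟ k) ×-dec (T ⊆? S)

∣p∣≡0⇒p≡⊥ : {p : Subset n} → ∣ p ∣ ≡ 0 → p ≡ ⊥
∣p∣≡0⇒p≡⊥ e = Empty-unique λ (x , q) → >⇒≢ (∈⇒∣∣>0 q) e

count-kSubset : (k : ℕ) (S : Subset n) → count (kSubset? k S) ≤ ∣ S ∣ C k
count-kSubset zero S = count≤list (kSubset? 0 S) (⊥ ∷ []) λ (e , _) → here (∣p∣≡0⇒p≡⊥ e)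
count-kSubset (suc k) [] = count≤list (kSubset? (suc k) []) [] λ { {[]} (() , _) }
count-kSubset {suc n} (suc k) (outside ∷ S) = ≤-trans
  (count≤count-image (kSubset? (suc k) (outside ∷ S)) (kSubset? (suc k) S) Vec.tail
    (λ { {inside ∷ T} (_ , f) → case f Vec.here of λ ()
       ; {outside ∷ T} (e , f) → e , drop-∷-⊆ f })
    λ { {inside ∷ T} (_ , f) _ _ → case f Vec.here of λ ()
      ; {outside ∷ T} {inside ∷ U} _ (_ , f) _ → case f Vec.here of λ ()
      ; {outside ∷ T} {outside ∷ U} _ _ e → cong (outside ∷_) e })
  (count-kSubset (suc k) S)
count-kSubset {suc n} (suc k) (inside ∷ S) = begin
  count (kSubset? (suc k) (inside ∷ S))             ≤⟨ count-⊎ _ in? out? split ⟩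
  count in? + count out?                            ≤⟨ +-mono-≤
    (count≤count-image in? (kSubset? k S) Vec.tail
      (λ { {inside ∷ T} (_ , e , f) → suc-injective e , drop-∷-⊆ f
         ; {outside ∷ T} (() , _) })
      λ { {inside ∷ T} {inside ∷ U} _ _ e → cong (inside ∷_) e
        ; {inside ∷ T} {outside ∷ U} _ (() , _) _
        ; {outside ∷ T} (() , _) _ _ })
    (count≤count-image out? (kSubset? (suc k) S) Vec.tail
      (λ { {outside ∷ T} (_ , e , f) → e , drop-∷-⊆ f
         ; {inside ∷ T} (() , _) })
      λ { {outside ∷ T} {outside ∷ U} _ _ e → cong (outside ∷_) e
        ; {outside ∷ T} {inside ∷ U} _ (() , _) _
        ; {inside ∷ T} (() , _) _ _ }) ⟩
  count (kSubset? k S) + count (kSubset? (suc k) S) ≤⟨ +-mono-≤ (count-kSubset k S) (count-kSubset (suc k) S) ⟩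
  ∣ S ∣ C k + ∣ S ∣ C suc k                         ≡⟨ nCk+nC[k+1]≡[n+1]C[k+1] ∣ S ∣ k ⟩
  suc ∣ S ∣ C suc k                                 ∎
  where
  open ≤-Reasoning
  in? : Decidable (λ T → Vec.head T ≡ inside × ∣ T ∣ ≡ suc k × T ⊆ inside ∷ S)
  in? T = (Vec.head T Bool.≟ inside) ×-dec kSubset? (suc k) (inside ∷ S) T
  out? : Decidable (λ T → Vec.head T ≡ outside × ∣ T ∣ ≡ suc k × T ⊆ inside ∷ S)
  out? T = (Vec.head T Bool.≟ outside) ×-dec kSubset? (suc k) (inside ∷ S) T
  split : ∀ {T} → ∣ T ∣ ≡ suc k × T ⊆ inside ∷ S →
    (Vec.head T ≡ inside × ∣ T ∣ ≡ suc k × T ⊆ inside ∷ S) ⊎ (Vec.head T ≡ outside × ∣ T ∣ ≡ suc k × T ⊆ inside ∷ S)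
  split {inside ∷ T} p = inj₁ (refl , p)
  split {outside ∷ T} p = inj₂ (refl , p)

between : {p q : Subset n} (k : ℕ) → p ⊆ q → ∣ p ∣ ≤ k → k ≤ ∣ q ∣ →
  ∃ λ r → p ⊆ r × r ⊆ q × ∣ r ∣ ≡ k
between {p = p} {q} k f h₁ h₂ with ∣ q ∣ ℕ.≟ k
... | yes e = q , f , id , e
... | no ne = go (∣ q ∣ ∸ k) q f (≡sym (m∸n+n≡m h₂))
  where
  go : ∀ m q → p ⊆ q → ∣ q ∣ ≡ m + k → ∃ λ r → p ⊆ r × r ⊆ q × ∣ r ∣ ≡ k
  go zero q f e = q , f , id , e
  go (suc m) q f e with any? (λ x → (x ∈? q) ×-dec ¬? (x ∈? p))
  ... | no ¬x = contradiction
    (≤-trans (p⊆q⇒∣p∣≤∣q∣ λ {x} x∈q → decidable-stable (x ∈? p) λ x∉p → ¬x (x , x∈q , x∉p)) h₁)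
    (<⇒≱ (subst (k <_) (≡sym e) (s≤s (m≤n+m k m))))
  ... | yes (x , x∈q , x∉p) with go m (q - x)
        (λ {y} y∈p → x∈p∧x≢y⇒x∈p-y (f y∈p) λ { refl → x∉p y∈p })
        (suc-injective (trans (∣p-x∣ x∈q) e))
  ...   | r , a , b , c = r , a , ∈p-x⇒∈p ∘ b , c

-- Cliques inside a vertex set

clique? : (A : Adj n) (s : ℕ) (S : Subset n) → Decidable (λ T → (∣ T ∣ ≡ s × IsComplete A T) × T ⊆ S)
clique? A s S T = ((∣ T ∣ ℕ.≟ s) ×-dec complete? A T) ×-dec (T ⊆? S)

cliques : Adj n → ℕ → Subset n → ℕ
cliques A s S = count (clique? A s S)

nbr : Adj n → Subset n → Fin n → Subset n
nbr A S v = subsetOf λ w → does (w ∈? S) ∧ A v w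

does⁻ : {P : Set} (d : Dec P) → does d ≡ true → P
does⁻ (yes p) _ = p

∧⁻ : ∀ {a b} → a ∧ b ≡ true → a ≡ true × b ≡ true
∧⁻ {true} e = refl , e

∈-nbr⁻ : (A : Adj n) (S : Subset n) {v w : Fin n} → w ∈ nbr A S v → w ∈ S × A v w ≡ true
∈-nbr⁻ A S {v} {w} q with ∧⁻ (∈-subsetOf⁻ q)
... | a , b = does⁻ (w ∈? S) a , b

∈-nbr⁺ : (A : Adj n) (S : Subset n) {v w : Fin n} → w ∈ S → A v w ≡ true → w ∈ nbr A S v
∈-nbr⁺ A S {w = w} q e = ∈-subsetOf⁺ (cong₂ _∧_ (dec-true (w ∈? S) q) e)

N≤cliques : (s : ℕ) (G : Graph n) → N s G ≤ cliques (adj G) s ⊤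
N≤cliques s G = count-mono (λ S → (∣ S ∣ ℕ.≟ s) ×-dec complete? (adj G) S) (clique? (adj G) s ⊤) λ p → p , ⊆⊤

cliques-⊆ : {A B : Adj n} → (∀ u v → A u v ≡ true → B u v ≡ true) → (s : ℕ) (S : Subset n) →
  cliques A s S ≤ cliques B s S
cliques-⊆ {A = A} {B} f s S = count-mono (clique? A s S) (clique? B s S)
  λ ((e , k) , g) → (e , λ a b ne → f _ _ (k a b ne)) , g

cliques≤binomial : (A : Adj n) (s : ℕ) (S : Subset n) → cliques A s S ≤ ∣ S ∣ C s
cliques≤binomial A s S = ≤-trans
  (count-mono (clique? A s S) (kSubset? s S) λ ((e , _) , f) → e , f)
  (count-kSubset s S)

-- A nonadjacent pair, enlarged by `between` to an `s`-set inside `S`, would be an `s`-set that is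
-- not a clique, and the count would fall strictly below the binomial. The pair fits because
-- `2 ≤ s`.
cliques≡binomial⇒complete : (A : Adj n) (s : ℕ) (S : Subset n) → 2 ≤ s → s ≤ ∣ S ∣ →
  cliques A s S ≡ ∣ S ∣ C s → IsComplete A S
cliques≡binomial⇒complete {n} A s S 2≤s s≤S e {u} u∈ {v} v∈ u≢v =
  decidable-stable (A u v Bool.≟ true) λ ¬uv →
  let p = ⁅ u ⁆ ∪ ⁅ v ⁆
      p⊆S : p ⊆ S
      p⊆S q = case x∈p∪q⁻ ⁅ u ⁆ ⁅ v ⁆ q of λ where
        (inj₁ a) → subst (_∈ S) (≡sym (x∈⁅y⁆⇒x≡y u a)) u∈
        (inj₂ b) → subst (_∈ S) (≡sym (x∈⁅y⁆⇒x≡y v b)) v∈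
      ∣p∣≤2 = ∣∣≤length (u ∷ v ∷ []) {p} λ q → case x∈p∪q⁻ ⁅ u ⁆ ⁅ v ⁆ q of λ where
        (inj₁ a) → here (x∈⁅y⁆⇒x≡y u a)
        (inj₂ b) → there (here (x∈⁅y⁆⇒x≡y v b))
      T , p⊆T , T⊆S , ∣T∣ = between s p⊆S (≤-trans ∣p∣≤2 2≤s) s≤S
  in <-irrefl e (<-≤-trans
       (count-mono-strict (clique? A s S) (kSubset? s S) (λ ((e , _) , f) → e , f) {T} (∣T∣ , T⊆S)
         λ ((_ , k) , _) → ¬uv (k (p⊆T (x∈p∪q⁺ (inj₁ (x∈⁅x⁆ u)))) (p⊆T (x∈p∪q⁺ {p = ⁅ u ⁆} (inj₂ (x∈⁅x⁆ v)))) u≢v))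
       (count-kSubset s S))

cliques-cover : (A : Adj n) (s : ℕ) (S S₁ S₂ : Subset n) →
  (∀ {T} → ∣ T ∣ ≡ s → IsComplete A T → T ⊆ S → T ⊆ S₁ ⊎ T ⊆ S₂) →
  cliques A s S ≤ cliques A s S₁ + cliques A s S₂
cliques-cover A s S S₁ S₂ f = count-⊎ (clique? A s S) (clique? A s S₁) (clique? A s S₂) split
  where
  split : ∀ {T} → (∣ T ∣ ≡ s × IsComplete A T) × T ⊆ S →
    ((∣ T ∣ ≡ s × IsComplete A T) × T ⊆ S₁) ⊎ ((∣ T ∣ ≡ s × IsComplete A T) × T ⊆ S₂)
  split ((e , k) , g) with f e k g
  ... | inj₁ h = inj₁ ((e , k) , h)
  ... | inj₂ h = inj₂ ((e , k) , h)

-- Dropping `v` maps the cliques through `v` injectively to `t`-sets of neighbours of `v`.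
cliques-delete : (A : Adj n) (t : ℕ) (S : Subset n) {v : Fin n} →
  cliques A (suc t) S ≤ cliques A (suc t) (S - v) + ∣ nbr A S v ∣ C t
cliques-delete A t S {v} = begin
  cliques A (suc t) S                                            ≤⟨ count-⊎ _ (clique? A (suc t) (S - v)) with-v? split ⟩
  cliques A (suc t) (S - v) + count with-v?                      ≤⟨ +-monoʳ-≤ (cliques A (suc t) (S - v))
    (count≤count-image with-v? (kSubset? t (nbr A S v)) (_- v)
      (λ (v∈ , (e , k) , f) → suc-injective (trans (∣p-x∣ v∈) e) ,
        λ q → ∈-nbr⁺ A S (f (∈p-x⇒∈p q)) (k v∈ (∈p-x⇒∈p q) (∈p-x⇒≢ q ∘ ≡sym)))
      λ (v∈T , _) (v∈U , _) e → ⊆-antisym (mono v∈U e) (mono v∈T (≡sym e))) ⟩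
  cliques A (suc t) (S - v) + count (kSubset? t (nbr A S v))     ≤⟨ +-monoʳ-≤ (cliques A (suc t) (S - v)) (count-kSubset t (nbr A S v)) ⟩
  cliques A (suc t) (S - v) + ∣ nbr A S v ∣ C t                  ∎
  where
  open ≤-Reasoning
  with-v? : Decidable (λ T → v ∈ T × (∣ T ∣ ≡ suc t × IsComplete A T) × T ⊆ S)
  with-v? T = (v ∈? T) ×-dec clique? A (suc t) S T
  split : ∀ {T} → (∣ T ∣ ≡ suc t × IsComplete A T) × T ⊆ S →
    ((∣ T ∣ ≡ suc t × IsComplete A T) × T ⊆ S - v) ⊎ (v ∈ T × (∣ T ∣ ≡ suc t × IsComplete A T) × T ⊆ S)
  split {T} (k , f) with v ∈? T
  ... | yes v∈ = inj₂ (v∈ , k , f)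
  ... | no v∉ = inj₁ (k , λ q → x∈p∧x≢y⇒x∈p-y (f q) λ { refl → v∉ q })
  mono : ∀ {T U} → v ∈ U → T - v ≡ U - v → T ⊆ U
  mono {T} {U} v∈U e {x} x∈T with x ≟ v
  ... | yes refl = v∈U
  ... | no ne = ∈p-x⇒∈p (subst (x ∈_) e (x∈p∧x≢y⇒x∈p-y x∈T ne))

-- Binomial inequalities

pascal : ∀ m k → suc m C suc k ≡ m C k + m C suc k
pascal m k = ≡sym (nCk+nC[k+1]≡[n+1]C[k+1] m k)

C>0 : ∀ {k m} → k ≤ m → 0 < m C k
C>0 {zero} {m} _ = ≤-reflexive (≡sym (trans (nCk≡nC[n∸k] {0} {m} z≤n) (nCn≡1 m)))
C>0 {suc k} {suc m} (s≤s h) = ≤-trans (C>0 h) (subst (m C k ≤_) (≡sym (pascal m k)) (m≤m+n _ _))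

C-mono : ∀ k {m m'} → m ≤ m' → m C suc k ≤ m' C suc k
C-mono k {m' = zero} z≤n = ≤-refl
C-mono k {m} {suc m'} h with m≤n⇒m<n∨m≡n h
... | inj₂ refl = ≤-refl
... | inj₁ (s≤s h') = ≤-trans (C-mono k h') (subst (m' C suc k ≤_) (≡sym (pascal m' k)) (m≤n+m _ _))

C-strict : ∀ k {m m'} → m < m' → k < m' → m C suc k < m' C suc k
C-strict k {m} {suc m'} (s≤s h) (s≤s h') = subst (m C suc k <_) (≡sym (pascal m' k))
  (≤-<-trans (C-mono k h) (m<n+m (m' C suc k) (C>0 h')))

-- F t x = C(x+1, t+1) is the sum of C(j, t) over 1 ≤ j ≤ x.
F : ℕ → ℕ → ℕ
F t x = suc x C suc t

F-suc : ∀ t x → F t (suc x) ≡ suc x C t + F t x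
F-suc t x = pascal (suc x) t

F0 : ∀ t → F (suc t) 0 ≡ 0
F0 t = k>n⇒nCk≡0 {1} {suc (suc t)} (s≤s (s≤s z≤n))

-- By `F-suc` the increments of `F` are binomials, which grow with the argument, so `u` further
-- steps gain at least as much from `y` as from `z`.
F-convex : ∀ k {z y} u → z ≤ y → F (suc k) (z + u) + F (suc k) y ≤ F (suc k) (y + u) + F (suc k) z
F-convex k {z} {y} zero h rewrite +-identityʳ z | +-identityʳ y = ≤-reflexive (+-comm (F (suc k) z) _)
F-convex k {z} {y} (suc u) h
  rewrite +-suc z u | +-suc y u | F-suc (suc k) (z + u) | F-suc (suc k) (y + u)
  | +-assoc (suc (z + u) C suc k) (F (suc k) (z + u)) (F (suc k) y)
  | +-assoc (suc (y + u) C suc k) (F (suc k) (y + u)) (F (suc k) z)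
  = +-mono-≤ (C-mono k (s≤s (+-monoˡ-≤ u h))) (F-convex k u h)

-- It suffices that the topmost increments differ; `k < y + u` makes the larger of these two
-- binomials positive.
F-convex-strict : ∀ k {z y u} → z < y → 0 < u → k < y + u →
  F (suc k) (z + u) + F (suc k) y < F (suc k) (y + u) + F (suc k) z
F-convex-strict k {z} {y} {suc u} h _ h'
  rewrite +-suc z u | +-suc y u | F-suc (suc k) (z + u) | F-suc (suc k) (y + u)
  | +-assoc (suc (z + u) C suc k) (F (suc k) (z + u)) (F (suc k) y)
  | +-assoc (suc (y + u) C suc k) (F (suc k) (y + u)) (F (suc k) z)
  = +-mono-<-≤ (C-strict k (s≤s (+-monoˡ-< u h)) h') (F-convex k u (<⇒≤ h))

-- Convexity from `z = 0`, where `F` vanishes. In graphs: cliques on `x + 1` and `y + 1` vertices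
-- glued at a vertex against one clique on all `x + y + 1` vertices.
F-superadditive : ∀ k x y → F (suc k) x + F (suc k) y ≤ F (suc k) (x + y)
F-superadditive k x y = subst (F (suc k) x + F (suc k) y ≤_)
  (trans (cong (F (suc k) (y + x) +_) (F0 k)) (trans (+-identityʳ _) (cong (F (suc k)) (+-comm y x))))
  (F-convex k {0} {y} x z≤n)

-- The condition `k < x + y` says that the joint clique has at least `s = k + 2` vertices.
F-superadditive-strict : ∀ k {x y} → 0 < x → 0 < y → k < x + y →
  F (suc k) x + F (suc k) y < F (suc k) (x + y)
F-superadditive-strict k {x} {y} hx hy h = subst (F (suc k) x + F (suc k) y <_)
  (trans (cong (F (suc k) (y + x) +_) (F0 k)) (trans (+-identityʳ _) (cong (F (suc k)) (+-comm y x))))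
  (F-convex-strict k {0} {y} hy hx (subst (k <_) (+-comm x y) h))

-- The second clique is filled up to `d` by moving `u = d - y` from the first, of which
-- `z = x + y - d` remains; `x < d` gives `z < y`, so strict convexity applies.
F-overflow : ∀ k {x y d} → x < d → y < d → d ≤ x + y → k < d →
  F (suc k) x + F (suc k) y < F (suc k) d + F (suc k) (x + y ∸ d)
F-overflow k {x} {y} {d} hx hy h hk = subst₂ (λ a b → F (suc k) a + F (suc k) y < F (suc k) b + F (suc k) z)
  z+u≡x y+u≡d
  (F-convex-strict k {z} {y} {u} z<y (m<n⇒0<n∸m hy) (subst (k <_) (≡sym y+u≡d) hk))
  where
  z = x + y ∸ d
  u = d ∸ y
  y+u≡d : y + u ≡ d
  y+u≡d = m+[n∸m]≡n (<⇒≤ hy)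
  z+d≡x+y : z + d ≡ x + y
  z+d≡x+y = m∸n+n≡m h
  z+u≡x : z + u ≡ x
  z+u≡x = +-cancelʳ-≡ y (z + u) x (trans (+-assoc z u y) (trans (cong (z +_) (m∸n+n≡m (<⇒≤ hy))) z+d≡x+y))
  z<y : z < y
  z<y = +-cancelʳ-< d z y (subst (_< y + d) (≡sym z+d≡x+y) (subst (x + y <_) (+-comm d y) (+-monoˡ-< y hx)))

-- Numerical estimates for removing vertices of degree at most `b`

module _ (q d b : ℕ) (2b≤ : b + b ≤ suc d) where

  private
    k : ℕ
    k = suc q

    -- With `s = k + 2`, this bounds the number of `s`-cliques that disappear with a vertex of
    -- degree `j`.
    β : ℕ → ℕ
    β j = j C suc k

  -- With `u = b - (i + 1)`, the arguments `i + 1` and `b + u` lie symmetrically about `b`, so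
  -- convexity applies to them, and `b + u ≤ d - i` follows from `2b ≤ d + 1`.
  pair : ∀ {i} → suc i ≤ b → β b + β b ≤ β (d ∸ i) + β (suc i)
  pair {i} h = ≤-trans
    (subst (λ w → β w + β w ≤ β (suc (i + u + u)) + β (suc i)) e
       (F-convex q {i} {i + u} u (m≤m+n i u)))
    (+-monoˡ-≤ _ (C-mono k le))
    where
    u = b ∸ suc i
    e : suc (i + u) ≡ b
    e = m+[n∸m]≡n h
    le : suc (i + u + u) ≤ d ∸ i
    le = m+n≤o⇒m≤o∸n (suc (i + u + u)) (s≤s⁻¹ (≤-trans (≤-reflexive (trans (lem i u) (cong₂ _+_ e e))) 2b≤))
      where
      open +-*-Solver
      lem : ∀ i u → suc (suc (i + u + u) + i) ≡ suc (i + u) + suc (i + u)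
      lem = solve 2 (λ i u → con 1 :+ (con 1 :+ (i :+ u :+ u) :+ i) := (con 1 :+ (i :+ u)) :+ (con 1 :+ (i :+ u))) refl

  pair-strict : 2 ≤ b → suc k ≤ d → β b + β b < β d + β 1
  pair-strict 2≤b hd with suc q ℕ.≤? (b ∸ 1) + (b ∸ 1)
  ... | yes h = <-≤-trans
    (subst (λ w → β w + β w < β (suc ((b ∸ 1) + (b ∸ 1))) + β 1) e (F-convex-strict q {0} {b ∸ 1} {b ∸ 1} (s≤s⁻¹ 1<) (s≤s⁻¹ 1<) h))
    (+-monoˡ-≤ (β 1) (C-mono k (s≤s⁻¹ (≤-trans (≤-reflexive e2) 2b≤))))
    where
    e : suc (b ∸ 1) ≡ b
    e = m+[n∸m]≡n (<⇒≤ 2≤b)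
    1< : 1 < suc (b ∸ 1)
    1< = subst (1 <_) (≡sym e) 2≤b
    e2 : suc (suc ((b ∸ 1) + (b ∸ 1))) ≡ b + b
    e2 = trans (cong suc (≡sym (+-suc (b ∸ 1) (b ∸ 1)))) (cong₂ _+_ e e)
  ... | no h = subst (_< β d + β 1) (≡sym (cong₂ _+_ β0 β0)) (<-≤-trans (C>0 hd) (m≤m+n (β d) (β 1)))
    where
    b≤q : b ≤ q
    b≤q = ≤-trans (≤-trans (≤-reflexive (≡sym (m+[n∸m]≡n (<⇒≤ 2≤b))))
      (+-monoˡ-≤ (b ∸ 1) (∸-monoˡ-≤ 1 2≤b))) (s≤s⁻¹ (≰⇒> h))
    β0 : β b ≡ 0
    β0 = k>n⇒nCk≡0 (s≤s (m≤n⇒m≤1+n b≤q))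

  private
    step-down : ∀ {m} → m < d → F (suc k) (d ∸ m) ≡ β (d ∸ m) + F (suc k) (d ∸ suc m)
    step-down {m} h = trans (cong (F (suc k)) e) (trans (F-suc (suc k) (d ∸ suc m)) (cong (λ w → β w + F (suc k) (d ∸ suc m)) (≡sym e)))
      where
      e : d ∸ m ≡ suc (d ∸ suc m)
      e = +-∸-assoc 1 h

    -- On the left, a clique on `d - m + 1` vertices and `m + x` removed vertices; on the right, two
    -- glued cliques with the same total of `d + x + 1` vertices. The goal is the row `m = b - 1`.
    -- It is reached from the diagonal `m = x`: increasing `x` is safe once `b ≤ x + 1`, increasing
    -- `m` as long as `b ≤ d - m`, since the binomial exchanged for `β b` is then no smaller.
    Claim : ℕ → ℕ → Set
    Claim m x = F (suc k) (d ∸ m) + (m + x) * β b < F (suc k) d + F (suc k) x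

    b≤d : 2 ≤ b → b ≤ d
    b≤d 2≤b = s≤s⁻¹ (≤-trans (+-monoˡ-≤ b (<⇒≤ 2≤b)) 2b≤)

    -- Moving one place along the diagonal sets `β (d - m) + β (m + 1)` against `β b + β b`, which
    -- is `pair`. At `m = 0` both sides of the claim agree, so strictness has to come from the very
    -- first move, by `pair-strict`.
    diagonal : 2 ≤ b → suc k ≤ d → ∀ m → suc m < b → Claim (suc m) (suc m)
    diagonal 2≤b hd zero h = subst (_< F (suc k) d + F (suc k) 1) (eq (F (suc k) (d ∸ 1)) (β b))
      (subst (λ w → (β b + β b) + F (suc k) (d ∸ 1) < w + F (suc k) 1) (≡sym (step-down (≤-trans (s≤s z≤n) (≤-trans 2≤b (b≤d 2≤b)))))
        (subst ((β b + β b) + F (suc k) (d ∸ 1) <_)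
          (trans (lem (β d) (β 1) (F (suc k) (d ∸ 1))) (cong (β d + F (suc k) (d ∸ 1) +_) F1))
          (+-monoˡ-< (F (suc k) (d ∸ 1)) (pair-strict 2≤b hd))))
      where
      open +-*-Solver
      eq : ∀ x y → (y + y) + x ≡ x + 2 * y
      eq = solve 2 (λ x y → (y :+ y) :+ x := x :+ con 2 :* y) refl
      lem : ∀ x y z → (x + y) + z ≡ x + z + y
      lem = solve 3 (λ x y z → (x :+ y) :+ z := x :+ z :+ y) refl
      F1 : β 1 ≡ F (suc k) 1
      F1 = ≡sym (trans (F-suc (suc k) 0) (trans (cong (β 1 +_) (F0 k)) (+-identityʳ _)))
    diagonal 2≤b hd (suc m) h = +-cancelˡ-< (β (d ∸ suc m)) _ _ (begin-strict
      β (d ∸ suc m) + (f₂ + (2+m + 2+m) * β b)               ≡⟨ lem₁ (β (d ∸ suc m)) f₂ (1+m) (β b) ⟩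
      (β b + β b) + (β (d ∸ suc m) + f₂ + (1+m + 1+m) * β b) ≡⟨ cong (λ w → (β b + β b) + (w + (1+m + 1+m) * β b)) (step-down m<d) ⟨
      (β b + β b) + (F (suc k) (d ∸ 1+m) + (1+m + 1+m) * β b) <⟨ +-mono-≤-< (pair (<⇒≤ h)) (diagonal 2≤b hd m (<-trans (n<1+n _) h)) ⟩
      (β (d ∸ 1+m) + β (2+m)) + (F (suc k) d + F (suc k) 1+m) ≡⟨ lem₂ (β (d ∸ 1+m)) (β (2+m)) (F (suc k) d) (F (suc k) 1+m) ⟩
      β (d ∸ 1+m) + (F (suc k) d + (β (2+m) + F (suc k) 1+m)) ≡⟨ cong (λ w → β (d ∸ 1+m) + (F (suc k) d + w)) (F-suc (suc k) 1+m) ⟨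
      β (d ∸ 1+m) + (F (suc k) d + F (suc k) (2+m))           ∎)
      where
      open ≤-Reasoning
      1+m = suc m
      2+m = suc (suc m)
      f₂ = F (suc k) (d ∸ 2+m)
      m<d : 1+m < d
      m<d = <-≤-trans (<-trans (n<1+n _) h) (b≤d 2≤b)
      open +-*-Solver
      lem₁ : ∀ a f m c → a + (f + (suc m + suc m) * c) ≡ (c + c) + (a + f + (m + m) * c)
      lem₁ = solve 4 (λ a f m c → a :+ (f :+ (con 1 :+ m :+ (con 1 :+ m)) :* c) := (c :+ c) :+ (a :+ f :+ (m :+ m) :* c)) refl
      lem₂ : ∀ a b c e → (a + b) + (c + e) ≡ a + (c + (b + e))
      lem₂ = solve 4 (λ a b c e → (a :+ b) :+ (c :+ e) := a :+ (c :+ (b :+ e))) refl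

    more-x : ∀ {m x} → b ≤ suc x → Claim m x → Claim m (suc x)
    more-x {m} {x} h c = subst₂ _<_ (lem (β b) (F (suc k) (d ∸ m)) m x)
      (trans (lem₂ (β (suc x)) (F (suc k) d) (F (suc k) x)) (cong (F (suc k) d +_) (≡sym (F-suc (suc k) x))))
      (+-mono-≤-< (C-mono k h) c)
      where
      open +-*-Solver
      lem : ∀ c f m x → c + (f + (m + x) * c) ≡ f + (m + suc x) * c
      lem = solve 4 (λ c f m x → c :+ (f :+ (m :+ x) :* c) := f :+ (m :+ (con 1 :+ x)) :* c) refl
      lem₂ : ∀ a b c → a + (b + c) ≡ b + (a + c)
      lem₂ = solve 3 (λ a b c → a :+ (b :+ c) := b :+ (a :+ c)) refl

    more-m : ∀ {m x} → m < d → b ≤ d ∸ m → Claim m x → Claim (suc m) x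
    more-m {m} {x} m<d h c = +-cancelˡ-< (β (d ∸ m)) _ _ (begin-strict
      β (d ∸ m) + (F (suc k) (d ∸ suc m) + (suc m + x) * β b)   ≡⟨ lem (β (d ∸ m)) (F (suc k) (d ∸ suc m)) m x (β b) ⟩
      β b + (β (d ∸ m) + F (suc k) (d ∸ suc m) + (m + x) * β b) ≡⟨ cong (λ w → β b + (w + (m + x) * β b)) (step-down m<d) ⟨
      β b + (F (suc k) (d ∸ m) + (m + x) * β b)                 <⟨ +-mono-≤-< (C-mono k h) c ⟩
      β (d ∸ m) + (F (suc k) d + F (suc k) x)                   ∎)
      where
      open ≤-Reasoning
      open +-*-Solver
      lem : ∀ a f m x c → a + (f + (suc m + x) * c) ≡ c + (a + f + (m + x) * c)
      lem = solve 5 (λ a f m x c → a :+ (f :+ (con 1 :+ m :+ x) :* c) := c :+ (a :+ f :+ (m :+ x) :* c)) refl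

    up-x : ∀ {m x} → b ≤ suc x → ∀ i → Claim m x → Claim m (i + x)
    up-x h zero c = c
    up-x {m} {x} h (suc i) c = more-x {m} (≤-trans h (s≤s (m≤n+m x i))) (up-x {m} h i c)

    up-m : 2 ≤ b → ∀ {m x} → ∀ i → i + m < b → Claim m x → Claim (i + m) x
    up-m 2≤b zero _ c = c
    up-m 2≤b {m} (suc i) h c = more-m
      (<-≤-trans i+m<b (b≤d 2≤b))
      (m+n≤o⇒m≤o∸n b (s≤s⁻¹ (≤-trans (≤-reflexive (≡sym (+-suc b (i + m)))) (≤-trans (+-monoʳ-≤ b i+m<b) 2b≤))))
      (up-m 2≤b i i+m<b c)
      where
      i+m<b : i + m < b
      i+m<b = <-trans (n<1+n _) h

  -- A clique on d+2-b vertices together with b-1+x vertices of degree at most b has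
  -- fewer cliques than K_{d+1} and K_{x+1} sharing a vertex.
  core-bound : 2 ≤ b → suc k ≤ d → ∀ {x} → 0 < x →
    F (suc k) (d ∸ (b ∸ 1)) + ((b ∸ 1) + x) * β b < F (suc k) d + F (suc k) x
  core-bound 2≤b hd {suc x} _ with suc (suc x) ℕ.≤? b
  ... | yes h = subst (λ w → Claim w (suc x)) (m∸n+n≡m x≤)
    (up-m 2≤b (b ∸ 1 ∸ suc x) (≤-<-trans (≤-reflexive (m∸n+n≡m x≤)) b-1<b) (diagonal 2≤b hd x h))
    where
    x≤ : suc x ≤ b ∸ 1
    x≤ = ∸-monoˡ-≤ 1 h
    b-1<b : b ∸ 1 < b
    b-1<b = ≤-reflexive (m+[n∸m]≡n (<⇒≤ 2≤b))
  ... | no h = subst (Claim (b ∸ 1)) (m∸n+n≡m (∸-monoˡ-≤ 1 (m≤n⇒m≤1+n (s≤s⁻¹ (≰⇒> h)))))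
    (up-x {b ∸ 1} (≤-reflexive (≡sym (m+[n∸m]≡n (<⇒≤ 2≤b)))) (suc x ∸ (b ∸ 1))
      (subst (λ w → Claim w w) e (diagonal 2≤b hd (b ∸ 2) (≤-reflexive (m+[n∸m]≡n 2≤b)))))
    where
    e : suc (b ∸ 2) ≡ b ∸ 1
    e = ≡sym (+-∸-assoc 1 2≤b)

  -- This is `core-bound` for `x = d - (b - 1)`: then `F x` stands on both sides and cancels, and
  -- `(b - 1) + x = d`. For `b ≤ 1` the left side is zero.
  peel-bound : suc k ≤ d → d * β b < F (suc k) d
  peel-bound hd with 2 ℕ.≤? b
  ... | no h = subst (_< F (suc k) d) (≡sym (trans (cong (d *_) (k>n⇒nCk≡0 (s≤s (≤-trans (s≤s⁻¹ (≰⇒> h)) (s≤s z≤n))))) (*-zeroʳ d))) (C>0 (s≤s hd))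
  ... | yes 2≤b = +-cancelˡ-< (F (suc k) x) _ _ (subst₂ _<_ (cong (λ w → F (suc k) x + w * β b) (m+[n∸m]≡n b-1≤d)) (+-comm (F (suc k) d) _) (core-bound 2≤b hd 0<x))
    where
    x = d ∸ (b ∸ 1)
    b-1≤d : b ∸ 1 ≤ d
    b-1≤d = ≤-trans (m∸n≤m b 1) (b≤d 2≤b)
    0<x : 0 < x
    0<x = m<n⇒0<n∸m (<-≤-trans (≤-reflexive (m+[n∸m]≡n (<⇒≤ 2≤b))) (b≤d 2≤b))

-- Division with remainder and the extremal function

module _ {d : ℕ} .{{_ : NonZero d}} where

  /%-unique : ∀ {p} α → p < d → (p + α * d) / d ≡ α × (p + α * d) % d ≡ p
  /%-unique {p} α h =
    trans (+-distrib-/-∣ʳ p (divides-refl α)) (trans (cong₂ _+_ (m<n⇒m/n≡0 h) (m*n/n≡m α d)) refl) ,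
    trans ([m+kn]%n≡m%n p α d) (m<n⇒m%n≡m h)

  private
    +-split : ∀ x y → x + y ≡ x % d + y % d + (x / d + y / d) * d
    +-split x y = trans (cong₂ _+_ (m≡m%n+[m/n]*n x d) (m≡m%n+[m/n]*n y d))
      (solve 5 (λ a b c e f → (a :+ b :* f) :+ (c :+ e :* f) := a :+ c :+ (b :+ e) :* f) refl
        (x % d) (x / d) (y % d) (y / d) d)
      where open +-*-Solver

  /%-d+ : ∀ x → (d + x) / d ≡ suc (x / d) × (d + x) % d ≡ x % d
  /%-d+ x = subst (λ w → w / d ≡ suc (x / d) × w % d ≡ x % d)
    (trans (solve 3 (λ a b f → a :+ (f :+ b :* f) := f :+ (a :+ b :* f)) refl (x % d) (x / d) d)
      (cong (d +_) (≡sym (m≡m%n+[m/n]*n x d))))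
    (/%-unique (suc (x / d)) (m%n<n x d))
    where open +-*-Solver

  carry : ∀ x y →
    (x % d + y % d < d × (x + y) / d ≡ x / d + y / d × (x + y) % d ≡ x % d + y % d) ⊎
    (d ≤ x % d + y % d × (x + y) / d ≡ suc (x / d + y / d) × (x + y) % d ≡ x % d + y % d ∸ d)
  carry x y with x % d + y % d ℕ.<? d
  ... | yes h = inj₁ (h , subst (λ w → w / d ≡ x / d + y / d × w % d ≡ x % d + y % d) (≡sym (+-split x y)) (/%-unique (x / d + y / d) h))
  ... | no h = inj₂ (≮⇒≥ h , subst (λ w → w / d ≡ suc (x / d + y / d) × w % d ≡ p) (≡sym e) (/%-unique (suc (x / d + y / d)) p<d))
    where
    p = x % d + y % d ∸ d
    p<d : p < d
    p<d = +-cancelʳ-< d p d (subst (_< d + d) (≡sym (m∸n+n≡m (≮⇒≥ h))) (+-mono-< (m%n<n x d) (m%n<n y d)))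
    e : x + y ≡ p + suc (x / d + y / d) * d
    e = trans (+-split x y) (trans (cong (_+ (x / d + y / d) * d) (≡sym (m∸n+n≡m (≮⇒≥ h)))) (+-assoc p d _))

  module _ (k : ℕ) where

    -- hₛ(x + 1, c) for c = d + 1 and s = k + 2
    g : ℕ → ℕ
    g x = (x / d) * F (suc k) d + F (suc k) (x % d)

    g-small : ∀ {x} → x < d → g x ≡ F (suc k) x
    g-small h = cong₂ (λ a b → a * F (suc k) d + F (suc k) b) (m<n⇒m/n≡0 h) (m<n⇒m%n≡m h)

    g-d+ : ∀ x → g (d + x) ≡ F (suc k) d + g x
    g-d+ x = trans
      (cong₂ (λ a b → a * F (suc k) d + F (suc k) b) (proj₁ e) (proj₂ e))
      (+-assoc (F (suc k) d) _ _)
      where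
      e = /%-d+ x

    g-0 : g 0 ≡ 0
    g-0 = trans (g-small (>-nonZero⁻¹ d)) (F0 k)

    g-d : g d ≡ F (suc k) d
    g-d = trans (cong g (≡sym (+-identityʳ d))) (trans (g-d+ 0) (trans (cong (F (suc k) d +_) g-0) (+-identityʳ _)))

    module _ (k<d : k < d) where

      private
        rearrange : ∀ a b c e f → (a * c + e) + (b * c + f) ≡ (a + b) * c + (e + f)
        rearrange = solve 5 (λ a b c e f → (a :* c :+ e) :+ (b :* c :+ f) := (a :+ b) :* c :+ (e :+ f)) refl
          where open +-*-Solver

      -- Without a carry the remainders obey `F-superadditive`; with a carry, `F-overflow` accounts
      -- for the additional full clique.
      g-superadditive : ∀ x y → g x + g y ≤ g (x + y)
      g-superadditive x y with carry x y
      ... | inj₁ (h , e₁ , e₂) rewrite e₁ | e₂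
          | rearrange (x / d) (y / d) (F (suc k) d) (F (suc k) (x % d)) (F (suc k) (y % d))
          = +-monoʳ-≤ ((x / d + y / d) * F (suc k) d) (F-superadditive k (x % d) (y % d))
      ... | inj₂ (h , e₁ , e₂) rewrite e₁ | e₂
          | rearrange (x / d) (y / d) (F (suc k) d) (F (suc k) (x % d)) (F (suc k) (y % d))
          = ≤-trans (+-monoʳ-≤ ((x / d + y / d) * F (suc k) d) (<⇒≤ (F-overflow k (m%n<n x d) (m%n<n y d) h k<d)))
            (≤-reflexive (solve 3 (λ a b c → a :+ (b :+ c) := b :+ a :+ c) refl ((x / d + y / d) * F (suc k) d) (F (suc k) d) (F (suc k) (x % d + y % d ∸ d))))
        where open +-*-Solver

      g-mono : ∀ {x y} → x ≤ y → g x ≤ g y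
      g-mono {x} {y} h = ≤-trans (m≤m+n (g x) (g (y ∸ x)))
        (≤-trans (g-superadditive x (y ∸ x)) (≤-reflexive (cong g (m+[n∸m]≡n h))))

      F≡g : ∀ {x} → x ≤ d → F (suc k) x ≡ g x
      F≡g h with m≤n⇒m<n∨m≡n h
      ... | inj₁ h' = ≡sym (g-small h')
      ... | inj₂ refl = ≡sym g-d

      -- A carry is impossible because `F-overflow` is strict. Without a carry, equality passes to
      -- the remainders, where strict superadditivity excludes two positive parts as soon as their
      -- sum exceeds `k`.
      tight : ∀ {x y} → 0 < x → x < d → F (suc k) x + g y ≡ g (x + y) →
        x + y % d < d × (k < x + y % d → y % d ≡ 0)
      tight {x} {y} 0<x x<d e with carry x y
      ... | inj₁ (h , e₁ , e₂) rewrite m<n⇒m%n≡m x<d | m<n⇒m/n≡0 x<d | e₁ | e₂ = h , λ k< → eq0 k<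
        where
        e' : F (suc k) x + F (suc k) (y % d) ≡ F (suc k) (x + y % d)
        e' = +-cancelˡ-≡ ((y / d) * F (suc k) d) _ _ (trans
          (solve 3 (λ a b c → a :+ (b :+ c) := b :+ (a :+ c)) refl ((y / d) * F (suc k) d) (F (suc k) x) (F (suc k) (y % d))) e)
          where open +-*-Solver
        eq0 : k < x + y % d → y % d ≡ 0
        eq0 k< with y % d ℕ.≟ 0
        ... | yes z = z
        ... | no nz = contradiction e' (<⇒≢ (F-superadditive-strict k 0<x (n≢0⇒n>0 nz) k<))
      ... | inj₂ (h , e₁ , e₂) rewrite m<n⇒m%n≡m x<d | m<n⇒m/n≡0 x<d | e₁ | e₂ =
        contradiction e' (<⇒≢ (F-overflow k x<d (m%n<n y d) h k<d))
        where
        e' : F (suc k) x + F (suc k) (y % d) ≡ F (suc k) d + F (suc k) (x + y % d ∸ d)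
        e' = +-cancelˡ-≡ ((y / d) * F (suc k) d) _ _ (trans
          (solve 3 (λ a b c → a :+ (b :+ c) := b :+ (a :+ c)) refl ((y / d) * F (suc k) d) (F (suc k) x) (F (suc k) (y % d)))
          (trans e (solve 3 (λ a b c → (b :+ a) :+ c := a :+ (b :+ c)) refl ((y / d) * F (suc k) d) (F (suc k) d) (F (suc k) (x + y % d ∸ d)))))
          where open +-*-Solver

      module _ {X : Set} (w : X → ℕ) where

        full? : Decidable (λ x → w x ≡ d)
        full? x = w x ℕ.≟ d

        private
          full other : List X → List X
          full = filter full?
          other = filter (¬? ∘ full?)

        sum-F≤g : ∀ {xs} → All (λ x → w x ≤ d) xs → sum (map (F (suc k) ∘ w) xs) ≤ g (sum (map w xs))
        sum-F≤g [] = z≤n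
        sum-F≤g {x ∷ xs} (h ∷ hs) = ≤-trans
          (+-mono-≤ (≤-reflexive (F≡g h)) (sum-F≤g hs)) (g-superadditive (w x) _)

        sum-F≡g-tail : ∀ {x xs} → w x ≤ d → All (λ x → w x ≤ d) xs →
          sum (map (F (suc k) ∘ w) (x ∷ xs)) ≡ g (sum (map w (x ∷ xs))) → sum (map (F (suc k) ∘ w) xs) ≡ g (sum (map w xs))
        sum-F≡g-tail {x} {xs} h hs e = ≤-antisym (sum-F≤g hs) (+-cancelˡ-≤ (F (suc k) (w x)) _ _
          (≤-trans (≤-reflexive (cong (_+ g (sum (map w xs))) (F≡g h))) (≤-trans (g-superadditive (w x) _) (≤-reflexive (≡sym e)))))

        -- By induction: a full weight raises the quotient by one, a smaller weight is added to the
        -- remainder without carry by `tight`. If the remainder exceeds `k`, `tight` also empties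
        -- the remainder of the tail, so no second smaller weight can occur.
        sum-F≡g : ∀ {xs} → All (λ x → 0 < w x × w x ≤ d) xs → sum (map (F (suc k) ∘ w) xs) ≡ g (sum (map w xs)) →
          length (full xs) ≡ sum (map w xs) / d × sum (map w (other xs)) ≡ sum (map w xs) % d ×
          (k < sum (map w xs) % d → ∃ λ x → other xs ≡ x ∷ [] × w x ≡ sum (map w xs) % d)
        sum-F≡g [] e = ≡sym (m<n⇒m/n≡0 0<d) , ≡sym (m<n⇒m%n≡m 0<d) , λ h → case subst (k <_) (m<n⇒m%n≡m 0<d) h of λ ()
          where
          0<d : 0 < d
          0<d = >-nonZero⁻¹ d
        sum-F≡g {x ∷ xs} ((h₀ , h₁) ∷ hs) e with sum-F≡g hs (sum-F≡g-tail h₁ (All.map proj₂ hs) e) | w x ℕ.≟ d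
        ... | c₁ , c₂ , c₃ | yes wx = step-full
          where
          y = sum (map w xs)
          q = /%-d+ y
          r% : (w x + y) % d ≡ y % d
          r% = trans (cong (λ v → (v + y) % d) wx) (proj₂ q)
          step-full : length (full (x ∷ xs)) ≡ (w x + y) / d × sum (map w (other (x ∷ xs))) ≡ (w x + y) % d ×
            (k < (w x + y) % d → ∃ λ x₁ → other (x ∷ xs) ≡ x₁ ∷ [] × w x₁ ≡ (w x + y) % d)
          step-full rewrite filter-accept full? {xs = xs} wx | filter-reject (¬? ∘ full?) {xs = xs} (λ f → f wx) =
            trans (cong suc c₁) (≡sym (trans (cong (λ v → (v + y) / d) wx) (proj₁ q))) ,
            trans c₂ (≡sym r%) ,
            λ h → case c₃ (subst (k <_) r% h) of λ (x₁ , e₁ , e₂) → x₁ , e₁ , trans e₂ (≡sym r%)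
        ... | c₁ , c₂ , c₃ | no wx = step-other
          where
          y = sum (map w xs)
          wx<d : w x < d
          wx<d = ≤∧≢⇒< h₁ wx
          ti = tight h₀ wx<d (trans (cong (F (suc k) (w x) +_) (≡sym (sum-F≡g-tail h₁ (All.map proj₂ hs) e))) e)
          q : (w x + y) / d ≡ y / d × (w x + y) % d ≡ w x + y % d
          q with carry (w x) y
          ... | inj₁ (_ , e₁ , e₂) = trans e₁ (cong (_+ y / d) (m<n⇒m/n≡0 wx<d)) , trans e₂ (cong (_+ y % d) (m<n⇒m%n≡m wx<d))
          ... | inj₂ (h , _) = contradiction (subst (λ v → d ≤ v + y % d) (m<n⇒m%n≡m wx<d) h) (<⇒≱ (proj₁ ti))
          no-rest : y % d ≡ 0 → other xs ≡ []
          no-rest z with other xs | trans c₂ z | AllP.filter⁺ (¬? ∘ full?) hs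
          ... | [] | _ | _ = refl
          ... | x₁ ∷ _ | e | (h , _) ∷ _ = contradiction (m+n≡0⇒m≡0 (w x₁) e) (>⇒≢ h)
          step-other : length (full (x ∷ xs)) ≡ (w x + y) / d × sum (map w (other (x ∷ xs))) ≡ (w x + y) % d ×
            (k < (w x + y) % d → ∃ λ x₁ → other (x ∷ xs) ≡ x₁ ∷ [] × w x₁ ≡ (w x + y) % d)
          step-other rewrite filter-reject full? {xs = xs} wx | filter-accept (¬? ∘ full?) {xs = xs} wx =
            trans c₁ (≡sym (proj₁ q)) ,
            trans (cong (w x +_) c₂) (≡sym (proj₂ q)) ,
            λ h → let z = proj₂ ti (subst (k <_) (proj₂ q) h) in
              x , cong (x ∷_) (no-rest z) , ≡sym (trans (proj₂ q) (trans (cong (w x +_) z) (+-identityʳ _)))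

-- Walks and cycles as vertex lists

infixr 5 _◅_

-- The index lists every vertex, both ends included, so that simplicity, length and containment of a
-- path are statements about a list.
data Walk (A : Adj n) : Fin n → Fin n → List (Fin n) → Set where
  stop : ∀ {u} → Walk A u u (u ∷ [])
  _◅_  : ∀ {u w v l} → A u w ≡ true → Walk A w v l → Walk A u v (u ∷ l)

SymmetricAdj : Adj n → Set
SymmetricAdj A = ∀ u v → A u v ≡ A v u

module _ {A : Adj n} where

  start∈ : ∀ {u v l} → Walk A u v l → u ∈ˡ l
  start∈ stop = here refl
  start∈ (_ ◅ _) = here refl

  end∈ : ∀ {u v l} → Walk A u v l → v ∈ˡ l
  end∈ stop = here refl
  end∈ (_ ◅ w) = there (end∈ w)

  walk-∷ : ∀ {u v l} → Walk A u v l → ∃ λ l′ → l ≡ u ∷ l′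
  walk-∷ stop = [] , refl
  walk-∷ (_ ◅ _) = _ , refl

  walk-++ : ∀ {u v w z l l′} → Walk A u v l → A v w ≡ true → Walk A w z l′ → Walk A u z (l ++ l′)
  walk-++ stop e w′ = e ◅ w′
  walk-++ (e′ ◅ w) e w′ = e′ ◅ walk-++ w e w′

  walk-join : ∀ {u v z l l′} → Walk A u v l → Walk A v z (v ∷ l′) → Walk A u z (l ++ l′)
  walk-join stop w′ = w′
  walk-join (e ◅ w) w′ = e ◅ walk-join w w′

  walk-reverse : SymmetricAdj A → ∀ {u v l} → Walk A u v l → Walk A v u (reverse l)
  walk-reverse sy stop = stop
  walk-reverse sy {u} (_◅_ {w = w} {l = l} e p) = subst (Walk A _ u) (≡sym (unfold-reverse u l))
    (walk-++ (walk-reverse sy p) (trans (sy w u) e) stop)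

  split-at : ∀ p {u v w q} → Walk A u v (p ++ w ∷ q) →
    (p ≡ [] × u ≡ w ⊎ ∃ λ z → Walk A u z p × A z w ≡ true) × Walk A w v (w ∷ q)
  split-at [] stop = inj₁ (refl , refl) , stop
  split-at [] (e ◅ w) = inj₁ (refl , refl) , e ◅ w
  split-at (_ ∷ []) (e ◅ w) with split-at [] w
  ... | inj₁ (_ , refl) , w′ = inj₂ (_ , stop , e) , w′
  ... | inj₂ (_ , () , _) , _
  split-at (_ ∷ x ∷ p) (e ◅ w) with split-at (x ∷ p) w
  ... | inj₁ (() , _) , _
  ... | inj₂ (z , a , b) , w′ = inj₂ (z , e ◅ a , b) , w′

  prefix : ∀ p {u v w q} → Walk A u v (p ++ w ∷ q) → Walk A u w (p ++ w ∷ [])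
  prefix p W with split-at p W
  ... | inj₁ (refl , refl) , _ = stop
  ... | inj₂ (z , a , e) , _ = walk-++ a e stop

  suffix : ∀ p {u v w q} → Walk A u v (p ++ w ∷ q) → Walk A w v (w ∷ q)
  suffix p W = proj₂ (split-at p W)

-- A cycle is a closed walk u … v with distinct vertices and an edge v u.
CircOn : Adj n → Subset n → ℕ → Set
CircOn A S c = ∀ {u v l} → Walk A u v l → A v u ≡ true → Unique l → All (_∈ S) l →
  3 ≤ length l → length l ≤ c

CircOn-⊆ : {A : Adj n} {S T : Subset n} {c : ℕ} → S ⊆ T → CircOn A T c → CircOn A S c
CircOn-⊆ f h w e u a = h w e u (All.map f a)

lookup-injective : {X : Set} {l : List X} → Unique l → ∀ i j → lookup l i ≡ lookup l j → i ≡ j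
lookup-injective (_ ∷ _) zero zero _ = refl
lookup-injective {l = x ∷ l} (x∉ ∷ _) zero (suc j) e = contradiction e (All.lookup x∉ (∈-lookup j))
lookup-injective {l = x ∷ l} (x∉ ∷ _) (suc i) zero e = contradiction (≡sym e) (All.lookup x∉ (∈-lookup i))
lookup-injective (_ ∷ u) (suc i) (suc j) e = cong suc (lookup-injective u i j e)

private
  lookup-step : {A : Adj n} → ∀ {u v x l} → Walk A u v (x ∷ l) → (i : Fin (length l)) →
    A (lookup (x ∷ l) (inject₁ i)) (lookup (x ∷ l) (suc i)) ≡ true
  lookup-step (e ◅ stop) zero = e
  lookup-step (e ◅ (_ ◅ _)) zero = e
  lookup-step (_ ◅ w@(_ ◅ _)) (suc i) = lookup-step w i

  lookup-last : {A : Adj n} → ∀ {u v x l} → Walk A u v (x ∷ l) → lookup (x ∷ l) (fromℕ (length l)) ≡ v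
  lookup-last stop = refl
  lookup-last (_ ◅ stop) = refl
  lookup-last (_ ◅ w@(_ ◅ _)) = lookup-last w

  tabulate-walk : {A : Adj n} (m : ℕ) (f : Fin (suc m) → Fin n) →
    (∀ i → A (f (inject₁ i)) (f (suc i)) ≡ true) → Walk A (f zero) (f (fromℕ m)) (tabulate f)
  tabulate-walk zero f e = stop
  tabulate-walk (suc m) f e = e zero ◅ tabulate-walk m (f ∘ suc) (e ∘ suc)

circumference⇒CircOn : {A : Adj n} {c : ℕ} → CircumferenceAtMost A c → (S : Subset n) → CircOn A S c
circumference⇒CircOn h S {l = []} () e u a 3≤
circumference⇒CircOn {A = A} h S {u} {v} {x ∷ l} w e un a 3≤ with walk-∷ w
... | l , refl = h (length l) (lookup (u ∷ l))
  (3≤ , (λ {i} {j} → lookup-injective un i j) , lookup-step w , subst (λ z → A z u ≡ true) (≡sym (lookup-last w)) e)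

CircOn⇒circumference : {A : Adj n} {c : ℕ} → CircOn A ⊤ c → CircumferenceAtMost A c
CircOn⇒circumference {c = c} h m f (3≤ , inj , e , e′) = subst (_≤ c) (length-tabulate f)
  (h (tabulate-walk m f e) e′ (UniqueP.tabulate⁺ inj) (All.tabulate λ _ → ∈⊤) (subst (3 ≤_) (≡sym (length-tabulate f)) 3≤))

rotate : {A : Adj n} → ∀ {u v l x} → Walk A u v l → A v u ≡ true → Unique l → x ∈ˡ l →
  ∃ λ y → ∃ λ r → Walk A x y (x ∷ r) × A y x ≡ true × Unique (x ∷ r) ×
    length (x ∷ r) ≡ length l × (∀ {z} → z ∈ˡ x ∷ r → z ∈ˡ l) × (∀ {z} → z ∈ˡ l → z ∈ˡ x ∷ r)
rotate {A = A} {u} {v} {x = x} W e un x∈ with ∈-∃++ x∈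
... | p , q , refl with split-at p W
...   | inj₁ (refl , refl) , W′ = v , q , W′ , e , un , refl , id , id
...   | inj₂ (z , a , e′) , W′ = z , q ++ p , walk-++ W′ e a , e′ ,
  unique-++ (proj₁ (proj₂ us)) (proj₁ us) (λ i j → proj₂ (proj₂ us) j i) ,
  trans (length-++ (x ∷ q)) (trans (+-comm (length (x ∷ q)) (length p)) (≡sym (length-++ p))) ,
  (λ i → [ ∈-++⁺ʳ p , ∈-++⁺ˡ ]′ (∈-++⁻ (x ∷ q) i)) ,
  (λ i → [ ∈-++⁺ʳ (x ∷ q) , ∈-++⁺ˡ ]′ (∈-++⁻ p i))
  where
  us = unique-++⁻ p un

infix 4 _∈ˡ?_
_∈ˡ?_ : (x : Fin n) (l : List (Fin n)) → Dec (x ∈ˡ l)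
x ∈ˡ? l = Any.any? (x ≟_) l

module _ {A : Adj n} {S : Subset n} {U V : Fin n → Set} (U? : Decidable U) (V? : Decidable V)
  (disjoint : ∀ {x} → U x → V x → Empty.⊥) where

  record Link : Set where
    field
      {from to} : Fin n
      {inner}   : List (Fin n)
      walk      : Walk A from to (from ∷ inner)
      unique    : Unique (from ∷ inner)
      inS       : All (_∈ S) (from ∷ inner)
      from∈U    : U from
      to∈V      : V to
      avoidU    : ∀ {x} → x ∈ˡ inner → ¬ U x
      avoidV    : ∀ {x} → x ∈ˡ from ∷ inner → V x → x ≡ to

  private
    -- State of the scan, which runs from the far end of the given path back to its start: a simple
    -- path from the current vertex `a` up to its first vertex in `V`, without any vertex in `U`.
    Tail : Fin n → Set
    Tail a = ∃ λ w → ∃ λ l → Walk A a w l × Unique l × All (_∈ S) l × V w ×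
      (∀ {x} → x ∈ˡ l → ¬ U x) × (∀ {x} → x ∈ˡ l → V x → x ≡ w)

    trivial : ∀ {a} → a ∈ S → V a → Tail a
    trivial a∈ Va = _ , _ , stop , [] ∷ [] , a∈ ∷ [] , Va , (λ { (here refl) u → disjoint u Va }) , λ { (here e) _ → e }

    go : ∀ {a b} → PathIn A S a b → V b → Link ⊎ Tail a
    go (here a∈) Vb = inj₂ (trivial a∈ Vb)
    go {a} (step a∈ e p) Vb with go p Vb
    ... | inj₁ L = inj₁ L
    ... | inj₂ (w , l , W , un , al , Vw , nU , nV) with U? a | V? a | a ∈ˡ? l
    ...   | yes Ua | _ | _ = inj₁ record
      { walk = e ◅ W ; unique = ∉⇒All≢ (λ i → nU i Ua) ∷ un ; inS = a∈ ∷ al ; from∈U = Ua ; to∈V = Vw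
      ; avoidU = nU ; avoidV = λ { (here refl) v → contradiction v (disjoint Ua) ; (there i) v → nV i v } }
    ...   | no _ | yes Va | _ = inj₂ (trivial a∈ Va)
    ...   | no ¬U | no ¬V | no a∉ = inj₂ (w , a ∷ l , e ◅ W , ∉⇒All≢ a∉ ∷ un , a∈ ∷ al , Vw ,
      (λ { (here refl) → ¬U ; (there i) → nU i }) , λ { (here refl) v → contradiction v ¬V ; (there i) → nV i })
    -- The vertex `a` already lies on the tail; the loop between its two visits is dropped.
    ...   | no ¬U | no ¬V | yes a∈l with ∈-∃++ a∈l
    ...     | p′ , q , refl = inj₂ (w , a ∷ q , suffix p′ W , proj₁ (proj₂ (unique-++⁻ p′ un)) , AllP.++⁻ʳ p′ al , Vw ,
      (λ i → nU (∈-++⁺ʳ p′ i)) , λ i → nV (∈-++⁺ʳ p′ i))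

  -- the last exit from U before the first entry into V
  link : ∀ {a b} → PathIn A S a b → U a → V b → Link
  link p Ua Vb with go p Vb
  ... | inj₁ L = L
  ... | inj₂ (w , l , W , _ , _ , _ , nU , _) = contradiction Ua (nU (start∈ W))

-- Long cycles from a path in a nonseparable set

-- The first path is left at `z`. The clause on `e` records that the former end survives only if the
-- branching happens there; `advance` uses it to free the next vertex of the base path.
splice : {A : Adj n} → ∀ {p e P z w l} → Walk A p e P → Unique P → z ∈ˡ P →
  Walk A z w (z ∷ l) → Unique (z ∷ l) → (∀ {x} → x ∈ˡ l → x ∉ˡ P) →
  ∃ λ R → Walk A p w R × Unique R × (∀ {x} → x ∈ˡ R → (x ∈ˡ P × (x ≡ e → z ≡ e)) ⊎ x ∈ˡ l)
splice {e = e} {z = z} {l = l} W un z∈ W′ (_ ∷ un′) av with ∈-∃++ z∈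
... | p₁ , p₂ , refl = (p₁ ++ z ∷ []) ++ l , walk-join (prefix p₁ W) W′ ,
  unique-++ (unique-++ (proj₁ us) ([] ∷ []) λ { i (here refl) → proj₂ (proj₂ us) i (here refl) }) un′
    (λ i j → av j (mem i)) ,
  λ i → case ∈-++⁻ (p₁ ++ z ∷ []) i of λ where
    (inj₁ j) → inj₁ (mem j , λ { refl → last j })
    (inj₂ j) → inj₂ j
  where
  us = unique-++⁻ p₁ un
  mem : ∀ {x} → x ∈ˡ p₁ ++ z ∷ [] → x ∈ˡ p₁ ++ z ∷ p₂
  mem i with ∈-++⁻ p₁ i
  ... | inj₁ j = ∈-++⁺ˡ j
  ... | inj₂ (here refl) = ∈-++⁺ʳ p₁ (here refl)
  last : e ∈ˡ p₁ ++ z ∷ [] → z ≡ e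
  last i with ∈-++⁻ p₁ i
  ... | inj₁ j = contradiction (end∈ (suffix p₁ W)) (proj₂ (proj₂ us) j)
  ... | inj₂ (here refl) = refl

-- For a path X₀, s, …, r, B: two disjoint paths leading from s and a vertex of X₀
-- to r and a vertex of B, without further vertices in X₀ or B.
record Linkage (A : Adj n) (S : Subset n) (X₀ : List (Fin n)) (s r : Fin n) (B : List (Fin n)) : Set where
  field
    {p q b} : Fin n
    {P Q}   : List (Fin n)
    wP   : Walk A p r P
    wQ   : Walk A q b Q
    b∈B  : b ∈ˡ B
    uP   : Unique P
    uQ   : Unique Q
    disj : ∀ {x} → x ∈ˡ P → x ∉ˡ Q
    SP   : All (_∈ S) P
    SQ   : All (_∈ S) Q
    ends : (p ≡ s × q ∈ˡ X₀) ⊎ (q ≡ s × p ∈ˡ X₀)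
    PX   : ∀ {x} → x ∈ˡ P → x ∈ˡ X₀ → x ≡ p
    QX   : ∀ {x} → x ∈ˡ Q → x ∈ˡ X₀ → x ≡ q
    PB   : ∀ {x} → x ∈ˡ P → x ∉ˡ B
    QB   : ∀ {x} → x ∈ˡ Q → x ∈ˡ B → x ≡ b

TwoConnected : Adj n → Subset n → Set
TwoConnected A S = ∀ {v} → v ∈ S → ConnectedOn A (S - v)

module _ {A : Adj n} {S : Subset n} (2c : TwoConnected A S) {X₀ : List (Fin n)} {s : Fin n} where

  -- One path is the single vertex `s`; since `S - s` is connected, the other can be found there and
  -- is automatically disjoint from it.
  start-linkage : ∀ {x y B} → x ∈ˡ X₀ → y ∈ˡ B → x ∈ S → y ∈ S → s ∈ S → s ∉ˡ X₀ → s ∉ˡ B →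
    (∀ {z} → z ∈ˡ X₀ → z ∉ˡ B) → Linkage A S X₀ s s B
  start-linkage {x} {y} {B} x∈ y∈ x∈S y∈S s∈S s∉X s∉B d = record
    { wP = stop ; wQ = L.walk ; b∈B = L.to∈V ; uP = [] ∷ [] ; uQ = L.unique
    ; disj = λ { (here refl) i → x∉p-x S s (All.lookup L.inS i) }
    ; SP = s∈S ∷ [] ; SQ = All.map ∈p-x⇒∈p L.inS
    ; ends = inj₁ (refl , L.from∈U)
    ; PX = λ { (here e) _ → e }
    ; QX = λ { (here e) _ → e ; (there i) u → contradiction u (L.avoidU i) }
    ; PB = λ { (here refl) → s∉B }
    ; QB = L.avoidV }
    where
    L₀ = link {A = A} {S = S - s} {U = _∈ˡ X₀} {V = _∈ˡ B} (_∈ˡ? X₀) (_∈ˡ? B) d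
      (2c s∈S (x∈p∧x≢y⇒x∈p-y x∈S λ { refl → s∉X x∈ }) (x∈p∧x≢y⇒x∈p-y y∈S λ { refl → s∉B y∈ })) x∈ y∈
    module L = Link L₀

  -- If the second path ends elsewhere than in `r′`, the first is prolonged by the edge `r r′`. If
  -- it ends in `r′`, it becomes the path to `r′`, and a new one to `B` is sought: connectedness of
  -- `S - r′` yields a link to `B` from `X₀` or one of the paths. If the link leaves `P`, it
  -- continues a beginning of `P`. If it leaves `Q`, the rest of `Q` with `r′` is given up, and `P`
  -- can be prolonged after all.
  advance : ∀ {r r′ y B} → Linkage A S X₀ s r (r′ ∷ B) → A r r′ ≡ true → r′ ∈ S → r′ ∉ˡ B →
    y ∈ˡ B → y ∈ S → (∀ {x} → x ∈ˡ X₀ → x ∉ˡ r′ ∷ B) → Linkage A S X₀ s r′ B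
  advance {r} {r′} {y} {B} Λ e r′∈S r′∉B y∈B y∈S XB = result
    where
    open Linkage Λ

    r′∉P : r′ ∉ˡ P
    r′∉P i = PB i (here refl)

    extended : ∀ {x} → x ∈ˡ P ++ r′ ∷ [] → x ∈ˡ P ⊎ x ≡ r′
    extended i with ∈-++⁻ P i
    ... | inj₁ j = inj₁ j
    ... | inj₂ (here e) = inj₂ e

    extend-P : ∀ {q b′ Q′} → Walk A q b′ Q′ → b′ ∈ˡ B → Unique Q′ → (∀ {x} → x ∈ˡ P → x ∉ˡ Q′) → r′ ∉ˡ Q′ →
      All (_∈ S) Q′ → (p ≡ s × q ∈ˡ X₀) ⊎ (q ≡ s × p ∈ˡ X₀) → (∀ {x} → x ∈ˡ Q′ → x ∈ˡ X₀ → x ≡ q) →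
      (∀ {x} → x ∈ˡ Q′ → x ∈ˡ B → x ≡ b′) → Linkage A S X₀ s r′ B
    extend-P W b∈ u d r′∉ a en qx qb = record
      { wP = walk-++ wP e stop ; wQ = W ; b∈B = b∈
      ; uP = unique-++ uP ([] ∷ []) λ { i (here refl) → r′∉P i } ; uQ = u
      ; disj = λ i j → case extended i of λ { (inj₁ k) → d k j ; (inj₂ refl) → r′∉ j }
      ; SP = AllP.++⁺ SP (r′∈S ∷ []) ; SQ = a ; ends = en
      ; PX = λ i j → case extended i of λ { (inj₁ k) → PX k j ; (inj₂ refl) → contradiction (here refl) (XB j) }
      ; QX = qx
      ; PB = λ i j → case extended i of λ { (inj₁ k) → PB k (there j) ; (inj₂ refl) → r′∉B j }
      ; QB = qb }

    swap : (p ≡ s × q ∈ˡ X₀) ⊎ (q ≡ s × p ∈ˡ X₀) → (q ≡ s × p ∈ˡ X₀) ⊎ (p ≡ s × q ∈ˡ X₀)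
    swap = [ inj₂ , inj₁ ]′

    result : Linkage A S X₀ s r′ B
    result with b ≟ r′
    ... | no b≢r′ = extend-P wQ (case b∈B of λ { (here e) → contradiction e b≢r′ ; (there i) → i }) uQ disj
      (λ i → b≢r′ (≡sym (QB i (here refl)))) SQ ends QX (λ i j → QB i (there j))
    ... | yes refl = rest
      where
      U = λ x → x ∈ˡ X₀ ⊎ (x ∈ˡ P ⊎ x ∈ˡ Q)
      UV : ∀ {x} → U x → x ∉ˡ B
      UV (inj₁ i) j = XB i (there j)
      UV (inj₂ (inj₁ i)) j = PB i (there j)
      UV (inj₂ (inj₂ i)) j with QB i (there j)
      ... | refl = r′∉B j
      r∈P = end∈ wP
      L₀ = link {A = A} {S = S - b} {U = U} {V = _∈ˡ B}
        (λ x → (x ∈ˡ? X₀) ⊎-dec ((x ∈ˡ? P) ⊎-dec (x ∈ˡ? Q))) (_∈ˡ? B) UV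
        (2c r′∈S (x∈p∧x≢y⇒x∈p-y (All.lookup SP r∈P) λ { refl → r′∉P r∈P }) (x∈p∧x≢y⇒x∈p-y y∈S λ { refl → r′∉B y∈B }))
        (inj₂ (inj₁ r∈P)) y∈B
      module L = Link L₀
      LS : ∀ {x} → x ∈ˡ L.from ∷ L.inner → x ∈ S
      LS i = ∈p-x⇒∈p (All.lookup L.inS i)
      b∉L : b ∉ˡ L.from ∷ L.inner
      b∉L i = x∉p-x S b (All.lookup L.inS i)
      z≢b : L.from ≢ b
      z≢b eq = b∉L (here (≡sym eq))
      rest : Linkage A S X₀ s b B
      rest with L.from ∈ˡ? P | L.from ∈ˡ? Q
      ... | yes z∈P | _ = record
        { wP = wQ ; wQ = W ; b∈B = L.to∈V ; uP = uQ ; uQ = u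
        ; disj = λ i j → case mem j of λ where
            (inj₁ (k , _)) → disj k i
            (inj₂ k) → L.avoidU k (inj₂ (inj₂ i))
        ; SP = SQ
        ; SQ = All.tabulate λ j → case mem j of λ where
            (inj₁ (k , _)) → All.lookup SP k
            (inj₂ k) → LS (there k)
        ; ends = swap ends ; PX = QX
        ; QX = λ j x∈X → case mem j of λ where
            (inj₁ (k , _)) → PX k x∈X
            (inj₂ k) → contradiction (inj₁ x∈X) (L.avoidU k)
        ; PB = λ i → UV (inj₂ (inj₂ i))
        ; QB = λ j x∈B → case mem j of λ where
            (inj₁ (k , _)) → contradiction (there x∈B) (PB k)
            (inj₂ k) → L.avoidV (there k) x∈B }
        where
        sp = splice wP uP z∈P L.walk L.unique λ i j → L.avoidU i (inj₂ (inj₁ j))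
        W = proj₁ (proj₂ sp)
        u = proj₁ (proj₂ (proj₂ sp))
        mem = λ {x} → proj₂ (proj₂ (proj₂ sp)) {x}
      ... | no z∉P | yes z∈Q = extend-P W L.to∈V u
        (λ i j → case mem j of λ where
            (inj₁ (k , _)) → disj i k
            (inj₂ k) → L.avoidU k (inj₂ (inj₁ i)))
        (λ j → case mem j of λ where
            (inj₁ (k , f)) → z≢b (f refl)
            (inj₂ k) → b∉L (there k))
        (All.tabulate λ j → case mem j of λ where
            (inj₁ (k , _)) → All.lookup SQ k
            (inj₂ k) → LS (there k))
        ends
        (λ j x∈X → case mem j of λ where
            (inj₁ (k , _)) → QX k x∈X
            (inj₂ k) → contradiction (inj₁ x∈X) (L.avoidU k))
        (λ j x∈B → case mem j of λ where
            (inj₁ (k , _)) → contradiction x∈B (UV (inj₂ (inj₂ k)))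
            (inj₂ k) → L.avoidV (there k) x∈B)
        where
        sp = splice wQ uQ z∈Q L.walk L.unique λ i j → L.avoidU i (inj₂ (inj₂ j))
        W = proj₁ (proj₂ sp)
        u = proj₁ (proj₂ (proj₂ sp))
        mem = λ {x} → proj₂ (proj₂ (proj₂ sp)) {x}
      -- The link leaves `X₀` away from both paths. It replaces the path that starts in `X₀`, and
      -- the path from `s` is kept as the one leading to `r′`.
      ... | no z∉P | no z∉Q = fromX ends
        where
        z∈X : L.from ∈ˡ X₀
        z∈X = case L.from∈U of λ where
          (inj₁ i) → i
          (inj₂ (inj₁ i)) → contradiction i z∉P
          (inj₂ (inj₂ i)) → contradiction i z∉Q
        fromX : (p ≡ s × q ∈ˡ X₀) ⊎ (q ≡ s × p ∈ˡ X₀) → Linkage A S X₀ s b B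
        fromX (inj₁ (p≡s , _)) = extend-P L.walk L.to∈V L.unique
          (λ { i (here refl) → z∉P i ; i (there k) → L.avoidU k (inj₂ (inj₁ i)) })
          b∉L (All.tabulate LS) (inj₁ (p≡s , z∈X))
          (λ { (here e) _ → e ; (there k) x∈X → contradiction (inj₁ x∈X) (L.avoidU k) })
          L.avoidV
        fromX (inj₂ (q≡s , _)) = record
          { wP = wQ ; wQ = L.walk ; b∈B = L.to∈V ; uP = uQ ; uQ = L.unique
          ; disj = λ { i (here refl) → z∉Q i ; i (there k) → L.avoidU k (inj₂ (inj₂ i)) }
          ; SP = SQ ; SQ = All.tabulate LS
          ; ends = inj₁ (q≡s , z∈X) ; PX = QX
          ; QX = λ { (here e) _ → e ; (there k) x∈X → contradiction (inj₁ x∈X) (L.avoidU k) }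
          ; PB = λ i → UV (inj₂ (inj₂ i))
          ; QB = L.avoidV }

  linkage-along : ∀ M {r t y B} → Walk A r y (r ∷ M ++ t ∷ B) → Unique (r ∷ M ++ t ∷ B) →
    All (_∈ S) (r ∷ M ++ t ∷ B) → y ∈ˡ B → (∀ {x} → x ∈ˡ X₀ → x ∉ˡ M ++ t ∷ B) →
    Linkage A S X₀ s r (M ++ t ∷ B) → Linkage A S X₀ s t B
  linkage-along [] {t = t} (e ◅ W) (_ ∷ u@(t∉ ∷ _)) (_ ∷ a) y∈ d Λ with walk-∷ W
  ... | _ , refl = advance Λ e (All.head a) (λ i → All.lookup t∉ i refl) y∈ (All.lookup (All.tail a) y∈) d
  linkage-along (m ∷ M) {t = t} {B = B} (e ◅ W) (_ ∷ u@(m∉ ∷ _)) (_ ∷ a) y∈ d Λ with walk-∷ W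
  ... | _ , refl = linkage-along M W u a y∈ (λ i j → d i (there j))
    (advance Λ e (All.head a) (λ i → All.lookup m∉ i refl) y∈′ (All.lookup a (there y∈′)) d)
    where
    y∈′ = ∈-++⁺ʳ M {ys = t ∷ B} (there y∈)

first-split : {X : Set} {P : X → Set} (P? : Decidable P) {l : List X} {z : X} → z ∈ˡ l → P z →
  ∃ λ c → ∃ λ w → ∃ λ d → l ≡ c ++ w ∷ d × P w × All (¬_ ∘ P) c
first-split P? {x ∷ l} z∈ Pz with P? x
... | yes Px = [] , x , l , refl , Px , []
... | no ¬Px with z∈
...   | here refl = contradiction Pz ¬Px
...   | there i with first-split P? i Pz
...     | c , w , d , refl , Pw , a = x ∷ c , w , d , refl , Pw , ¬Px ∷ a

last-split : {X : Set} {P : X → Set} (P? : Decidable P) {l : List X} {z : X} → z ∈ˡ l → P z →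
  ∃ λ c → ∃ λ w → ∃ λ d → l ≡ c ++ w ∷ d × P w × All (¬_ ∘ P) d
last-split {P = P} P? {x ∷ l} z∈ Pz with Any.any? P? l
... | yes i with find i
...   | v , v∈ , Pv with last-split P? v∈ Pv
...     | c , w , d , refl , Pw , a = x ∷ c , w , d , refl , Pw , a
last-split P? {x ∷ l} (here refl) Pz | no ¬i = [] , x , l , refl , Pz , AllP.¬Any⇒All¬ l ¬i
last-split P? {x ∷ l} (there i) Pz | no ¬i = contradiction (lose i Pz) ¬i

module _ {A : Adj n} (sy : SymmetricAdj A) where

  -- One side of the future cycle. Other vertices of `l` may be lost: only `x` and its neighbours
  -- have to stay, because the cycle length is estimated by degrees alone.
  Sweep : (x a s : Fin n) (l : List (Fin n)) → Set
  Sweep x a s l = ∃ λ L → Walk A a s L × Unique L × (∀ {v} → v ∈ˡ L → v ∈ˡ l) × x ∈ˡ L ×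
    (∀ {v} → v ∈ˡ l → A x v ≡ true → v ∈ˡ L)

  -- Along x … a R: go back from a to x, then jump to the first neighbour of x beyond a.
  sweep : ∀ {l} p {a R x s} → l ≡ p ++ a ∷ R → Walk A x s l → Unique l → s ∈ˡ R → A x s ≡ true → Sweep x a s l
  sweep p {a} {x = x} refl W un s∈R xs with first-split (λ v → A x v Bool.≟ true) s∈R xs
  ... | c , m , d , refl , xm , none =
    L , walk-++ (walk-reverse sy W₁) xm W₂ , unique-++ (unique-reverse u₁) u₂ (λ i j → d₁₂ (reverse⁻ i) j) ,
    (λ i → case ∈-++⁻ (reverse (p ++ a ∷ [])) i of λ where
      (inj₁ j) → case ∈-++⁻ p (reverse⁻ j) of λ where
        (inj₁ k) → ∈-++⁺ˡ k
        (inj₂ (here refl)) → ∈-++⁺ʳ p (here refl)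
      (inj₂ j) → ∈-++⁺ʳ p (there (∈-++⁺ʳ c j))) ,
    ∈-++⁺ˡ (reverse⁺ (start∈ W₁)) ,
    λ i e → case ∈-++⁻ p i of λ where
      (inj₁ j) → ∈-++⁺ˡ (reverse⁺ (∈-++⁺ˡ j))
      (inj₂ (here refl)) → ∈-++⁺ˡ (reverse⁺ (∈-++⁺ʳ p (here refl)))
      (inj₂ (there j)) → case ∈-++⁻ c j of λ where
        (inj₁ k) → contradiction e (All.lookup none k)
        (inj₂ k) → ∈-++⁺ʳ (reverse (p ++ a ∷ [])) k
    where
    L = reverse (p ++ a ∷ []) ++ m ∷ d
    W₁ = prefix p W
    eq : p ++ a ∷ c ++ m ∷ d ≡ (p ++ a ∷ []) ++ c ++ m ∷ d
    eq = ≡sym (++-assoc p (a ∷ []) (c ++ m ∷ d))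
    W₂ : Walk A m _ (m ∷ d)
    W₂ = suffix (p ++ a ∷ c) (subst (Walk A x _) (≡sym (++-assoc p (a ∷ c) (m ∷ d))) W)
    us = unique-++⁻ (p ++ a ∷ []) (subst Unique eq un)
    u₁ = proj₁ us
    u₂ = proj₁ (proj₂ (unique-++⁻ c (proj₁ (proj₂ us))))
    d₁₂ : ∀ {v} → v ∈ˡ p ++ a ∷ [] → v ∉ˡ m ∷ d
    d₁₂ i j = proj₂ (proj₂ us) i (∈-++⁺ʳ c j)

  -- The cycle starts in `q`, sweeps the side of `x` to `p`, follows `P` to `t`, sweeps the side of
  -- `y` from `t` to `b` and returns along `Q`, whose first edge closes it. The two sweeps retain
  -- all neighbours of `x` and of `y`.
  close : ∀ {S X₀ s t B x y} → Linkage A S X₀ s t B →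
    Walk A x s (X₀ ++ s ∷ []) → Unique (X₀ ++ s ∷ []) → All (_∈ S) (X₀ ++ s ∷ []) → A x s ≡ true →
    Walk A t y (t ∷ B) → Unique (t ∷ B) → All (_∈ S) (t ∷ B) → A y t ≡ true →
    (∀ {v} → v ∈ˡ X₀ → v ∉ˡ t ∷ B) → s ∉ˡ B →
    ∃ λ u → ∃ λ v → ∃ λ L → Walk A u v L × A v u ≡ true × Unique L × All (_∈ S) L × x ∈ˡ L ×
      (∀ {v} → v ∈ˡ X₀ ++ s ∷ [] → A x v ≡ true → v ∈ˡ L) × (∀ {v} → v ∈ˡ t ∷ B → A y v ≡ true → v ∈ˡ L)
  close {S} {X₀} {s} {t} {B} {x} {y} Λ WX uX SX xs WY uY SY yt d s∉B = result
    where
    open Linkage Λ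

    X⁻ : ∀ {v} → v ∈ˡ X₀ ++ s ∷ [] → v ∈ˡ X₀ ⊎ v ≡ s
    X⁻ i with ∈-++⁻ X₀ i
    ... | inj₁ j = inj₁ j
    ... | inj₂ (here e) = inj₂ e

    sweepX : ∀ {a} → a ∈ˡ X₀ → Sweep x a s (X₀ ++ s ∷ [])
    sweepX i with ∈-∃++ i
    ... | p , q , refl = sweep p (++-assoc p (_ ∷ q) (s ∷ [])) WX uX (∈-++⁺ʳ q (here refl)) xs

    sideX : Sweep x q p (X₀ ++ s ∷ [])
    sideX with ends
    ... | inj₁ (refl , q∈) = sweepX q∈
    ... | inj₂ (refl , p∈) with sweepX p∈
    ...   | L , W , u , f , x∈ , h = reverse L , walk-reverse sy W , unique-reverse u , (λ i → f (reverse⁻ i)) ,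
      reverse⁺ x∈ , λ i e → reverse⁺ (h i e)

    sweepY : Sweep y b t (reverse (t ∷ B))
    sweepY with ∈-∃++ b∈B
    ... | p , q , e = sweep (reverse q)
      (trans (cong (reverse ∘ (t ∷_)) e) (trans (reverse-++ (t ∷ p) (b ∷ q))
        (trans (cong (_++ reverse (t ∷ p)) (unfold-reverse b q)) (++-assoc (reverse q) (b ∷ []) (reverse (t ∷ p))))))
      (walk-reverse sy WY) (unique-reverse uY) (reverse⁺ {xs = t ∷ p} (here refl)) yt

    sideY : ∃ λ K → Walk A t b (t ∷ K) × Unique (t ∷ K) × (∀ {v} → v ∈ˡ t ∷ K → v ∈ˡ t ∷ B) ×
      (∀ {v} → v ∈ˡ t ∷ B → A y v ≡ true → v ∈ˡ t ∷ K)
    sideY with sweepY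
    ... | L , W , u , f , _ , h with walk-∷ (walk-reverse sy W)
    ...   | K , eK = K , subst (Walk A t b) eK (walk-reverse sy W) , subst Unique eK (unique-reverse u) ,
      (λ i → reverse⁻ {xs = t ∷ B} (f (reverse⁻ {xs = L} (subst (_ ∈ˡ_) (≡sym eK) i)))) ,
      (λ i e → subst (_ ∈ˡ_) eK (reverse⁺ (h (reverse⁺ i) e)))

    join-all : ∀ {P Q} → Walk A p t P → Unique P → (∀ {v} → v ∈ˡ P → v ∉ˡ Q) → (∀ {v} → v ∈ˡ P → v ∈ˡ X₀ → v ≡ p) →
      (∀ {v} → v ∈ˡ P → v ∉ˡ B) → All (_∈ S) P → Walk A q b Q → Unique Q → All (_∈ S) Q →
      (∀ {v} → v ∈ˡ Q → v ∈ˡ X₀ → v ≡ q) → (∀ {v} → v ∈ˡ Q → v ∈ˡ B → v ≡ b) →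
      ∃ λ u → ∃ λ v → ∃ λ L → Walk A u v L × A v u ≡ true × Unique L × All (_∈ S) L × x ∈ˡ L ×
        (∀ {v} → v ∈ˡ X₀ ++ s ∷ [] → A x v ≡ true → v ∈ˡ L) × (∀ {v} → v ∈ˡ t ∷ B → A y v ≡ true → v ∈ˡ L)
    join-all wP uP disj PX PB SP stop uQ SQ QX QB = Empty.⊥-elim (q≢b ends)
      where
      q≢b : (p ≡ s × q ∈ˡ X₀) ⊎ (q ≡ s × p ∈ˡ X₀) → Empty.⊥
      q≢b (inj₁ (_ , q∈)) = d q∈ (there b∈B)
      q≢b (inj₂ (refl , _)) = s∉B b∈B
    join-all {P} {Q} wP uP disj PX PB SP (_◅_ {w = m} {l = Q′} e wQ′) uQ@(q∉ ∷ uQ′) SQ QX QB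
      with walk-∷ wP | walk-∷ (walk-reverse sy wQ′) | sideX | sideY
    ... | P′ , refl | J , eJ | LX , wX , uLX , fX , x∈ , hX | K , wY , uK , fY , hY =
      q , m , L , walk-join w₁ wJ , trans (sy m q) e , uL , SL ,
      ∈-++⁺ˡ (∈-++⁺ˡ (∈-++⁺ˡ x∈)) ,
      (λ i f → ∈-++⁺ˡ (∈-++⁺ˡ (∈-++⁺ˡ (hX i f)))) ,
      λ i f → ∈-++⁺ˡ (memY (hY i f))
      where
      L = ((LX ++ P′) ++ K) ++ J
      w₀ : Walk A q t (LX ++ P′)
      w₀ = walk-join wX wP
      w₁ : Walk A q b ((LX ++ P′) ++ K)
      w₁ = walk-join w₀ wY
      wJ : Walk A b m (b ∷ J)
      wJ = subst (Walk A b m) eJ (walk-reverse sy wQ′)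
      uJ : Unique (b ∷ J)
      uJ = subst Unique eJ (unique-reverse uQ′)
      J⊆Q′ : ∀ {v} → v ∈ˡ b ∷ J → v ∈ˡ Q′
      J⊆Q′ i = reverse⁻ (subst (_ ∈ˡ_) (≡sym eJ) i)
      memY : ∀ {v} → v ∈ˡ t ∷ K → v ∈ˡ (LX ++ P′) ++ K
      memY (here refl) = ∈-++⁺ˡ (end∈ w₀)
      memY (there i) = ∈-++⁺ʳ (LX ++ P′) i
      p∉P′ : p ∉ˡ P′
      p∉P′ = UniqueP.Unique[x∷xs]⇒x∉xs uP
      q∉Q′ : q ∉ˡ Q′
      q∉Q′ = UniqueP.Unique[x∷xs]⇒x∉xs uQ
      b∉J : b ∉ˡ J
      b∉J = UniqueP.Unique[x∷xs]⇒x∉xs uJ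
      K⊆B : ∀ {v} → v ∈ˡ K → v ∈ˡ B
      K⊆B i with fY (there i)
      ... | here refl = contradiction i (UniqueP.Unique[x∷xs]⇒x∉xs uK)
      ... | there j = j
      XP′ : ∀ {v} → v ∈ˡ LX → v ∉ˡ P′
      XP′ i j with X⁻ (fX i)
      ... | inj₁ v∈X with PX (there j) v∈X
      ...   | refl = p∉P′ j
      XP′ i j | inj₂ refl with ends
      ... | inj₁ (refl , _) = p∉P′ j
      ... | inj₂ (refl , _) = disj (there j) (here refl)
      XPB : ∀ {v} → v ∈ˡ LX ++ P′ → v ∉ˡ B
      XPB i j with ∈-++⁻ LX i
      ... | inj₂ k = PB (there k) j
      ... | inj₁ k with X⁻ (fX k)
      ...   | inj₁ v∈X = d v∈X (there j)
      ...   | inj₂ refl = s∉B j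
      XPKJ : ∀ {v} → v ∈ˡ (LX ++ P′) ++ K → v ∉ˡ J
      XPKJ i j with ∈-++⁻ (LX ++ P′) i
      ... | inj₂ k with QB (there (J⊆Q′ (there j))) (K⊆B k)
      ...   | refl = b∉J j
      XPKJ i j | inj₁ k with ∈-++⁻ LX k
      ... | inj₂ l = disj (there l) (there (J⊆Q′ (there j)))
      ... | inj₁ l with X⁻ (fX l)
      ...   | inj₁ v∈X with QX (there (J⊆Q′ (there j))) v∈X
      ...     | refl = q∉Q′ (J⊆Q′ (there j))
      XPKJ i j | inj₁ k | inj₁ l | inj₂ refl with ends
      ... | inj₁ (refl , _) = disj (here refl) (there (J⊆Q′ (there j)))
      ... | inj₂ (refl , _) = q∉Q′ (J⊆Q′ (there j))
      uL : Unique L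
      uL = unique-++ (unique-++ (unique-++ uLX (drop uP) XP′) (drop uK)
        (λ i j → XPB i (K⊆B j))) (drop uJ) XPKJ
        where
        drop : ∀ {v l} → Unique (v ∷ l) → Unique l
        drop (_ ∷ u) = u
      SL : All (_∈ S) L
      SL = AllP.++⁺ (AllP.++⁺ (AllP.++⁺ (All.tabulate λ i → All.lookup SX (fX i)) (All.tail SP))
        (All.tabulate λ i → All.lookup SY (there (K⊆B i)))) (All.tabulate λ i → All.lookup SQ (there (J⊆Q′ (there i))))

    result = join-all wP uP disj PX PB SP wQ uQ SQ QX QB

-- To be applied to the neighbours of `x` (`P`) and of `y` (`Q`) on a path from `x` to `y`. If some
-- `P` comes after a `Q`, the first such `P` and the last `Q` before it enclose a gap free of both.
-- Otherwise the `P` precede the `Q`, and only `t` can be both.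
crossing? : {X : Set} {P Q : X → Set} → Decidable P → Decidable Q → (l : List X) →
  (∃ λ a → ∃ λ u → ∃ λ m → ∃ λ w → ∃ λ e → l ≡ a ++ u ∷ m ++ w ∷ e × Q u × P w × All (¬_ ∘ P) m × All (¬_ ∘ Q) m) ⊎
  (All (¬_ ∘ Q) l ⊎ ∃ λ f → ∃ λ t → ∃ λ e → l ≡ f ++ t ∷ e × Q t × All (¬_ ∘ Q) f × All (¬_ ∘ P) e)
crossing? P? Q? [] = inj₂ (inj₁ [])
crossing? {P = P} {Q} P? Q? (h ∷ l) with Q? h
... | no ¬Qh with crossing? P? Q? l
...   | inj₁ (a , u , m , w , e , refl , r) = inj₁ (h ∷ a , u , m , w , e , refl , r)
...   | inj₂ (inj₁ none) = inj₂ (inj₁ (¬Qh ∷ none))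
...   | inj₂ (inj₂ (f , t , e , refl , Qt , nf , ne)) = inj₂ (inj₂ (h ∷ f , t , e , refl , Qt , ¬Qh ∷ nf , ne))
crossing? {P = P} {Q} P? Q? (h ∷ l) | yes Qh with Any.any? P? l
... | no none = inj₂ (inj₂ ([] , h , l , refl , Qh , [] , AllP.¬Any⇒All¬ l none))
... | yes i with find i
...   | v , v∈ , Pv with first-split P? v∈ Pv
...     | c , w , d , refl , Pw , nP with last-split Q? {h ∷ c} (here refl) Qh
...       | [] , u , m , refl , Qu , nQ = inj₁ ([] , u , m , w , d , refl , Qu , Pw , nP , nQ)
...       | _ ∷ a , u , m , refl , Qu , nQ = inj₁ (h ∷ a , u , m , w , d , cong (h ∷_) (++-assoc a (u ∷ m) (w ∷ d)) , Qu , Pw ,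
              All.tail (AllP.++⁻ʳ a nP) , nQ)

lastOf : {X : Set} → X → List X → X
lastOf x [] = x
lastOf x (y ∷ l) = lastOf y l

private
  indicator : {P : Set} → Dec P → ℕ
  indicator P? = if does P? then 1 else 0

  indicator≤1 : {P : Set} (P? : Dec P) → indicator P? ≤ 1
  indicator≤1 (yes _) = ≤-refl
  indicator≤1 (no _) = z≤n

  indicator-no : {P : Set} (P? : Dec P) → ¬ P → indicator P? ≡ 0
  indicator-no (yes p) ¬p = contradiction p ¬p
  indicator-no (no _) _ = refl

  indicator-exclusive : {P Q : Set} (P? : Dec P) (Q? : Dec Q) → (P → Q → Empty.⊥) → indicator P? + indicator Q? ≤ 1
  indicator-exclusive (yes p) (yes q) ¬pq = Empty.⊥-elim (¬pq p q)
  indicator-exclusive (yes p) (no _) _ = ≤-refl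
  indicator-exclusive (no _) Q? _ = indicator≤1 Q?

module _ {X : Set} {P : X → Set} (P? : Decidable P) where

  occurrences : List X → ℕ
  occurrences l = length (filter P? l)

  occurrences-∷ : ∀ x l → occurrences (x ∷ l) ≡ indicator (P? x) + occurrences l
  occurrences-∷ x l with P? x
  ... | yes _ = refl
  ... | no _ = refl

  occurrences-++ : ∀ l l′ → occurrences (l ++ l′) ≡ occurrences l + occurrences l′
  occurrences-++ l l′ = trans (cong length (filter-++ P? l l′)) (length-++ (filter P? l))

  occurrences-none : ∀ {l} → All (¬_ ∘ P) l → occurrences l ≡ 0
  occurrences-none a = cong length (filter-none P? a)

module _ {X : Set} {P Q : X → Set} (P? : Decidable P) (Q? : Decidable Q) where

  private
    -- Each `Q` indicator is paired with the `P` indicator of the next entry; such a pair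
    -- contributes at most one, and only the `P` of the first and the `Q` of the last entry stay
    -- unpaired.
    count-alternating : ∀ x l → (∀ a {u w e} → x ∷ l ≡ a ++ u ∷ w ∷ e → Q u → P w → Empty.⊥) →
      occurrences P? (x ∷ l) + occurrences Q? (x ∷ l) ≤ indicator (P? x) + indicator (Q? (lastOf x l)) + length l
    count-alternating x [] _ rewrite occurrences-∷ P? x [] | occurrences-∷ Q? x [] =
      ≤-reflexive (solve 2 (λ a b → (a :+ con 0) :+ (b :+ con 0) := a :+ b :+ con 0) refl (indicator (P? x)) (indicator (Q? x)))
      where open +-*-Solver
    count-alternating x (y ∷ l) gap rewrite occurrences-∷ P? x (y ∷ l) | occurrences-∷ Q? x (y ∷ l) =
      begin
        (iP x + cP) + (iQ x + cQ)                                                  ≡⟨ lem₁ (iP x) cP (iQ x) cQ ⟩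
        iP x + iQ x + (cP + cQ)                                                    ≤⟨ +-monoʳ-≤ (iP x + iQ x) (count-alternating y l λ a e → gap (x ∷ a) (cong (x ∷_) e)) ⟩
        iP x + iQ x + (iP y + iQ (lastOf y l) + length l)                          ≡⟨ lem₂ (iP x) (iQ x) (iP y) (iQ (lastOf y l)) (length l) ⟩
        iQ x + iP y + (iP x + iQ (lastOf y l) + length l)                          ≤⟨ +-monoˡ-≤ _ (indicator-exclusive (Q? x) (P? y) (gap [] refl)) ⟩
        suc (iP x + iQ (lastOf y l) + length l)                                    ≡⟨ +-suc (iP x + iQ (lastOf y l)) (length l) ⟨
        iP x + iQ (lastOf y l) + suc (length l)                                    ∎
      where
      open ≤-Reasoning
      open +-*-Solver
      iP = λ z → indicator (P? z)
      iQ = λ z → indicator (Q? z)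
      cP = occurrences P? (y ∷ l)
      cQ = occurrences Q? (y ∷ l)
      lem₁ : ∀ a b c e → (a + b) + (c + e) ≡ a + c + (b + e)
      lem₁ = solve 4 (λ a b c e → (a :+ b) :+ (c :+ e) := a :+ c :+ (b :+ e)) refl
      lem₂ : ∀ a b c e f → a + b + (c + e + f) ≡ b + c + (a + e + f)
      lem₂ = solve 5 (λ a b c e f → a :+ b :+ (c :+ e :+ f) := b :+ c :+ (a :+ e :+ f)) refl

  alternating-head : ∀ x l → ¬ P x → (∀ a {u w e} → x ∷ l ≡ a ++ u ∷ w ∷ e → Q u → P w → Empty.⊥) →
    occurrences P? (x ∷ l) + occurrences Q? (x ∷ l) ≤ suc (length l)
  alternating-head x l ¬Px gap = ≤-trans (count-alternating x l gap)
    (+-monoˡ-≤ (length l) (subst (λ z → z + _ ≤ 1) (≡sym (indicator-no (P? x) ¬Px)) (indicator≤1 (Q? (lastOf x l)))))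

  alternating-last : ∀ x l → ¬ Q (lastOf x l) → (∀ a {u w e} → x ∷ l ≡ a ++ u ∷ w ∷ e → Q u → P w → Empty.⊥) →
    occurrences P? (x ∷ l) + occurrences Q? (x ∷ l) ≤ suc (length l)
  alternating-last x l ¬Q gap = ≤-trans (count-alternating x l gap)
    (+-monoˡ-≤ (length l) (≤-trans (≤-reflexive (trans (cong (indicator (P? x) +_) (indicator-no (Q? (lastOf x l)) ¬Q)) (+-identityʳ _))) (indicator≤1 (P? x))))

walk-last : {A : Adj n} → ∀ {u v x l} → Walk A u v (x ∷ l) → lastOf x l ≡ v
walk-last stop = refl
walk-last (_ ◅ stop) = refl
walk-last (_ ◅ w@(_ ◅ _)) = walk-last w

adjacent? : (A : Adj n) (x : Fin n) → Decidable (λ v → A x v ≡ true)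
adjacent? A x v = A x v Bool.≟ true

module Posa {A : Adj n} (sy : SymmetricAdj A) (ir : ∀ v → A v v ≡ false) {S : Subset n} (2c : TwoConnected A S)
  {c : ℕ} (2≤c : 2 ≤ c) (circ : CircOn A S c) where

  private
    no-loop : ∀ {v} → A v v ≢ true
    no-loop {v} e = case trans (≡sym e) (ir v) of λ ()

    no-long-cycle : ∀ {u v L} → Walk A u v L → A v u ≡ true → Unique L → All (_∈ S) L → length L ≤ c
    no-long-cycle {L = L} w e u a with 3 ℕ.≤? length L
    ... | yes h = circ w e u a h
    ... | no h = ≤-trans (s≤s⁻¹ (≰⇒> h)) 2≤c

    -- x … u, then y … w backwards, then w x
    exchange : ∀ {x y} a {u m w e} → Walk A x y (a ++ u ∷ m ++ w ∷ e) → Unique (a ++ u ∷ m ++ w ∷ e) →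
      All (_∈ S) (a ++ u ∷ m ++ w ∷ e) → A y u ≡ true → A x w ≡ true → suc (length a) + suc (length e) ≤ c
    exchange {x} {y} a {u} {m} {w} {e} W un al yu xw = subst (_≤ c)
      (trans (length-++ (a ++ u ∷ [])) (cong₂ _+_ (trans (length-++ a) (+-comm _ 1)) (length-reverse (w ∷ e))))
      (no-long-cycle (walk-++ W₁ (trans (sy u y) yu) (walk-reverse sy W₂)) (trans (sy w x) xw)
        (unique-++ (proj₁ us) (unique-reverse u₂) λ i j → proj₂ (proj₂ us) i (∈-++⁺ʳ m (reverse⁻ j)))
        (AllP.++⁺ (AllP.++⁻ˡ (a ++ u ∷ []) al′) (All.tabulate λ i → All.lookup (AllP.++⁻ʳ m (AllP.++⁻ʳ (a ++ u ∷ []) al′)) (reverse⁻ i))))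
      where
      eq : a ++ u ∷ m ++ w ∷ e ≡ (a ++ u ∷ []) ++ m ++ w ∷ e
      eq = ≡sym (++-assoc a (u ∷ []) (m ++ w ∷ e))
      W₁ = prefix a W
      W₂ : Walk A w y (w ∷ e)
      W₂ = suffix (a ++ u ∷ m) (subst (Walk A x y) (≡sym (++-assoc a (u ∷ m) (w ∷ e))) W)
      us = unique-++⁻ (a ++ u ∷ []) (subst Unique eq un)
      u₂ = proj₁ (proj₂ (unique-++⁻ m (proj₁ (proj₂ us))))
      al′ = subst (All (_∈ S)) eq al

  -- If neighbours of `y` and `x` enclose a gap, the cycle that avoids the gap has at most `c`
  -- vertices, and the alternating count bounds the degree sum on its two segments by their lengths;
  -- here `x` and `y` are not neighbours of themselves. If all neighbours of `x` come before those
  -- of `y`, two disjoint paths across the middle close up to a cycle through `x` and all these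
  -- neighbours.
  posa : ∀ {x y l} → Walk A x y l → Unique l → All (_∈ S) l → c < length l →
    c < occurrences (adjacent? A x) l + occurrences (adjacent? A y) l →
    (∃ λ v → v ∈ˡ l × A x v ≡ true) → (∃ λ v → v ∈ˡ l × A y v ≡ true) → Empty.⊥
  posa {x} {y} {l} W un al c<l c<d (vx , vx∈ , xvx) (vy , vy∈ , yvy) with crossing? (adjacent? A x) (adjacent? A y) l
  ... | inj₁ (a , u , m , w , e , refl , yu , xw , nx , ny) = <⇒≱ c<d (begin
    oX (a ++ u ∷ m ++ w ∷ e) + oY (a ++ u ∷ m ++ w ∷ e) ≡⟨ cong₂ _+_ (split oX (occurrences-++ (adjacent? A x) ) (occurrences-none (adjacent? A x) nx)) (split oY (occurrences-++ (adjacent? A y)) (occurrences-none (adjacent? A y) ny)) ⟩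
    (oX (a ++ u ∷ []) + oX (w ∷ e)) + (oY (a ++ u ∷ []) + oY (w ∷ e)) ≡⟨ solve 4 (λ a b c e → (a :+ b) :+ (c :+ e) := (a :+ c) :+ (b :+ e)) refl (oX (a ++ u ∷ [])) (oX (w ∷ e)) (oY (a ++ u ∷ [])) (oY (w ∷ e)) ⟩
    (oX (a ++ u ∷ []) + oY (a ++ u ∷ [])) + (oX (w ∷ e) + oY (w ∷ e)) ≤⟨ +-mono-≤ left right ⟩
    suc (length a) + suc (length e) ≤⟨ exchange a W un al yu xw ⟩
    c ∎)
    where
    open ≤-Reasoning
    open +-*-Solver
    oX = occurrences (adjacent? A x)
    oY = occurrences (adjacent? A y)
    split : (o : List (Fin n) → ℕ) → (∀ l l′ → o (l ++ l′) ≡ o l + o l′) → o m ≡ 0 →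
      o (a ++ u ∷ m ++ w ∷ e) ≡ o (a ++ u ∷ []) + o (w ∷ e)
    split o o-++ z = trans (cong o (≡sym (++-assoc a (u ∷ []) (m ++ w ∷ e)))) (trans (o-++ (a ++ u ∷ []) (m ++ w ∷ e))
      (cong (o (a ++ u ∷ []) +_) (trans (o-++ m (w ∷ e)) (cong (_+ o (w ∷ e)) z))))
    -- With an empty gap, `exchange` would produce a cycle through every vertex of the path, hence
    -- through more than `c`.
    no-consecutive : ∀ a′ {u′ w′ e′} → a ++ u ∷ m ++ w ∷ e ≡ a′ ++ u′ ∷ w′ ∷ e′ → A y u′ ≡ true → A x w′ ≡ true → Empty.⊥
    no-consecutive a′ {u′} {w′} {e′} eq yu′ xw′ = <⇒≱ c<l (subst (_≤ c)
      (≡sym (trans (cong length eq) (trans (length-++ a′) (+-suc (length a′) (suc (length e′))))))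
      (exchange a′ {m = []} (subst (Walk A x y) eq W) (subst Unique eq un) (subst (All (_∈ S)) eq al) yu′ xw′))
    W₂ : Walk A w y (w ∷ e)
    W₂ = suffix (a ++ u ∷ m) (subst (Walk A x y) (≡sym (++-assoc a (u ∷ m) (w ∷ e))) W)
    right : oX (w ∷ e) + oY (w ∷ e) ≤ suc (length e)
    right = alternating-last (adjacent? A x) (adjacent? A y) w e (λ yl → no-loop (subst (λ z → A y z ≡ true) (walk-last W₂) yl))
      λ a′ eq → no-consecutive ((a ++ u ∷ m) ++ a′) (trans (≡sym (++-assoc a (u ∷ m) (w ∷ e)))
        (trans (cong ((a ++ u ∷ m) ++_) eq) (≡sym (++-assoc (a ++ u ∷ m) a′ _))))
    left : oX (a ++ u ∷ []) + oY (a ++ u ∷ []) ≤ suc (length a)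
    left with walk-∷ (prefix a W) | length-++ a {u ∷ []}
    ... | r , eq | len = subst₂ (λ z k → oX z + oY z ≤ k) (≡sym eq) (trans (≡sym (trans (≡sym len) (cong length eq))) (+-comm (length a) 1))
      (alternating-head (adjacent? A x) (adjacent? A y) x r no-loop λ a′ {u′} {w′} {e′} eq′ → no-consecutive a′
        (trans (≡sym (++-assoc a (u ∷ []) (m ++ w ∷ e))) (trans (cong (_++ m ++ w ∷ e) (trans eq eq′)) (++-assoc a′ (u′ ∷ w′ ∷ e′) (m ++ w ∷ e)))))
  ... | inj₂ (inj₁ none) = All.lookup none vy∈ yvy
  ... | inj₂ (inj₂ (f , t , B , refl , yt , nf , nB)) = by-t (adjacent? A x t)
    where
    us = unique-++⁻ f un
    WY = suffix f W
    uY = proj₁ (proj₂ us)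
    aY = AllP.++⁻ʳ f al
    y∈B : y ∈ˡ B
    y∈B with end∈ WY
    ... | here refl = contradiction yt no-loop
    ... | there i = i
    y∈S = All.lookup aY (there y∈B)
    memY : ∀ {v} → v ∈ˡ f ++ t ∷ B → A y v ≡ true → v ∈ˡ t ∷ B
    memY i yv with ∈-++⁻ f i
    ... | inj₁ j = contradiction yv (All.lookup nf j)
    ... | inj₂ j = j

    finish : ∀ X₀ s → Linkage A S X₀ s t B → Walk A x s (X₀ ++ s ∷ []) → x ∈ˡ X₀ → Unique (X₀ ++ s ∷ []) → All (_∈ S) (X₀ ++ s ∷ []) →
      A x s ≡ true → (∀ {v} → v ∈ˡ X₀ → v ∉ˡ t ∷ B) → s ∉ˡ B →
      (∀ {v} → v ∈ˡ f ++ t ∷ B → A x v ≡ true → v ∈ˡ X₀ ++ s ∷ []) → Empty.⊥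
    finish X₀ s Λ WX x∈ uX aX xs d s∉B memX with close sy Λ WX uX aX xs WY uY aY yt d s∉B
    ... | _ , _ , L , WL , e , uL , aL , x∈L , hX , hY = <⇒≱ c<d (begin
      length DX + length DY                 ≤⟨ +-monoʳ-≤ (length DX) DY≤ ⟩
      length DX + suc (length DY′)          ≡⟨ +-suc (length DX) (length DY′) ⟩
      suc (length DX + length DY′)          ≡⟨ cong suc (length-++ DX) ⟨
      length (x ∷ DX ++ DY′)                ≤⟨ unique⊆⇒length≤ uK K⊆L ⟩
      length L                              ≤⟨ no-long-cycle WL e uL aL ⟩
      c                                     ∎)
      where
      open ≤-Reasoning
      DX = filter (adjacent? A x) (f ++ t ∷ B)
      DY = filter (adjacent? A y) (f ++ t ∷ B)
      -- The vertex `t` may be a neighbour of both ends and must be counted once. The loss is made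
      -- up by `x`, which lies on the cycle and is not its own neighbour, so the degree sum remains
      -- a lower bound for the cycle length.
      DY′ = filter (λ v → ¬? (v ≟ t)) DY
      DX⁻ : ∀ {v} → v ∈ˡ DX → v ∈ˡ X₀ ++ s ∷ [] × A x v ≡ true
      DX⁻ i with ∈-filter⁻ (adjacent? A x) {xs = f ++ t ∷ B} i
      ... | j , xv = memX j xv , xv
      DY⁻ : ∀ {v} → v ∈ˡ DY → v ∈ˡ t ∷ B × A y v ≡ true
      DY⁻ i with ∈-filter⁻ (adjacent? A y) {xs = f ++ t ∷ B} i
      ... | j , yv = memY j yv , yv
      DY′⁻ : ∀ {v} → v ∈ˡ DY′ → v ∈ˡ B × A y v ≡ true
      DY′⁻ i with ∈-filter⁻ (λ v → ¬? (v ≟ t)) {xs = DY} i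
      ... | j , v≢t with DY⁻ j
      ...   | here refl , _ = contradiction refl v≢t
      ...   | there k , yv = k , yv
      DY≤ : length DY ≤ suc (length DY′)
      DY≤ = unique⊆⇒length≤ {ys = t ∷ DY′} (UniqueP.filter⁺ (adjacent? A y) un) λ {v} i → case v ≟ t of λ where
        (yes e) → here e
        (no ne) → there (∈-filter⁺ (λ v → ¬? (v ≟ t)) i ne)
      uK : Unique (x ∷ DX ++ DY′)
      uK = ∉⇒All≢ (λ i → case ∈-++⁻ DX i of λ where
          (inj₁ j) → no-loop (proj₂ (DX⁻ j))
          (inj₂ j) → d x∈ (there (proj₁ (DY′⁻ j))))
        ∷ unique-++ (UniqueP.filter⁺ (adjacent? A x) un) (UniqueP.filter⁺ (λ v → ¬? (v ≟ t)) (UniqueP.filter⁺ (adjacent? A y) un))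
          λ i j → case ∈-++⁻ X₀ (proj₁ (DX⁻ i)) of λ where
            (inj₁ k) → d k (there (proj₁ (DY′⁻ j)))
            (inj₂ (here refl)) → s∉B (proj₁ (DY′⁻ j))
      K⊆L : ∀ {v} → v ∈ˡ x ∷ DX ++ DY′ → v ∈ˡ L
      K⊆L (here refl) = x∈L
      K⊆L (there i) with ∈-++⁻ DX i
      ... | inj₁ j = hX (proj₁ (DX⁻ j)) (proj₂ (DX⁻ j))
      ... | inj₂ j = hY (there (proj₁ (DY′⁻ j))) (proj₂ (DY′⁻ j))

    x∈prefix : ∀ p {v q} → Walk A x y (p ++ v ∷ q) → A x v ≡ true → x ∈ˡ p
    x∈prefix p W xv with split-at p W
    ... | inj₁ (_ , refl) , _ = contradiction xv no-loop
    ... | inj₂ (_ , a , _) , _ = start∈ a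

    -- If `x` is adjacent to `t`, both sides meet in `t` and the initial linkage with `s = t`
    -- suffices. Otherwise `s` is the last neighbour of `x` before `t`, and the linkage is carried
    -- across the segment `M` between them.
    by-t : Dec (A x t ≡ true) → Empty.⊥
    by-t (yes xt) = finish f t
      (start-linkage 2c x∈f y∈B (All.lookup al (∈-++⁺ˡ x∈f)) y∈S (All.head aY) (λ i → proj₂ (proj₂ us) i (here refl))
        (UniqueP.Unique[x∷xs]⇒x∉xs uY) (λ i j → proj₂ (proj₂ us) i (there j)))
      (prefix f W) x∈f (proj₁ (unique-++⁻ (f ++ t ∷ []) (subst Unique eq un))) (AllP.++⁻ˡ (f ++ t ∷ []) (subst (All (_∈ S)) eq al))
      xt (proj₂ (proj₂ us)) (UniqueP.Unique[x∷xs]⇒x∉xs uY) memX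
      where
      x∈f = x∈prefix f W xt
      eq = ≡sym (++-assoc f (t ∷ []) B)
      memX : ∀ {v} → v ∈ˡ f ++ t ∷ B → A x v ≡ true → v ∈ˡ f ++ t ∷ []
      memX i xv with ∈-++⁻ f i
      ... | inj₁ j = ∈-++⁺ˡ j
      ... | inj₂ (here refl) = ∈-++⁺ʳ f (here refl)
      ... | inj₂ (there j) = contradiction xv (All.lookup nB j)
    by-t (no ¬xt) with ∈-++⁻ f vx∈
    ... | inj₂ (here refl) = ¬xt xvx
    ... | inj₂ (there j) = All.lookup nB j xvx
    ... | inj₁ j with last-split (adjacent? A x) j xvx
    ...   | X₀ , s , M , refl , xs , nM = finish X₀ s
      (linkage-along 2c M (suffix X₀ W′) (proj₁ (proj₂ us′)) (AllP.++⁻ʳ X₀ al′) y∈B (λ i k → proj₂ (proj₂ us′) i (there k))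
        (start-linkage 2c x∈X (∈-++⁺ʳ M (there y∈B)) (All.lookup al′ (∈-++⁺ˡ x∈X)) y∈S
          (All.lookup al′ (∈-++⁺ʳ X₀ (here refl))) (λ i → proj₂ (proj₂ us′) i (here refl))
          (UniqueP.Unique[x∷xs]⇒x∉xs (proj₁ (proj₂ us′))) (λ i k → proj₂ (proj₂ us′) i (there k))))
      (prefix X₀ W′) x∈X (proj₁ (unique-++⁻ (X₀ ++ s ∷ []) (subst Unique eq′ un′))) (AllP.++⁻ˡ (X₀ ++ s ∷ []) (subst (All (_∈ S)) eq′ al′))
      xs (λ i k → proj₂ (proj₂ us′) i (there (∈-++⁺ʳ M k)))
      (λ k → UniqueP.Unique[x∷xs]⇒x∉xs (proj₁ (proj₂ us′)) (∈-++⁺ʳ M (there k)))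
      memX
      where
      eq : (X₀ ++ s ∷ M) ++ t ∷ B ≡ X₀ ++ s ∷ M ++ t ∷ B
      eq = ++-assoc X₀ (s ∷ M) (t ∷ B)
      eq′ = ≡sym (++-assoc X₀ (s ∷ []) (M ++ t ∷ B))
      W′ = subst (Walk A x y) eq W
      un′ = subst Unique eq un
      al′ = subst (All (_∈ S)) eq al
      us′ = unique-++⁻ X₀ un′
      x∈X = x∈prefix X₀ W′ xs
      memX : ∀ {v} → v ∈ˡ (X₀ ++ s ∷ M) ++ t ∷ B → A x v ≡ true → v ∈ˡ X₀ ++ s ∷ []
      memX i xv with ∈-++⁻ X₀ (subst (_ ∈ˡ_) eq i)
      ... | inj₁ k = ∈-++⁺ˡ k
      ... | inj₂ (here refl) = ∈-++⁺ʳ X₀ (here refl)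
      ... | inj₂ (there k) with ∈-++⁻ M k
      ...   | inj₁ k′ = contradiction xv (All.lookup nM k′)
      ...   | inj₂ (here refl) = contradiction xv ¬xt
      ...   | inj₂ (there k′) = contradiction xv (All.lookup nB k′)

-- Edge-maximal graphs and cores

∨⁻ : ∀ {a b} → a ∨ b ≡ true → a ≡ true ⊎ b ≡ true
∨⁻ {true} _ = inj₁ refl
∨⁻ {false} e = inj₂ e

false⇒≢true : ∀ {a} → a ≡ false → a ≢ true
false⇒≢true refl ()

≢true⇒false : ∀ {a} → a ≢ true → a ≡ false
≢true⇒false = ¬-not

addEdge⁺ : (A : Adj n) {u v x y : Fin n} → A x y ≡ true → addEdge A u v x y ≡ true
addEdge⁺ A {u} {v} {x} {y} e = cong (_∨ ((does (x ≟ u) ∧ does (y ≟ v)) ∨ (does (x ≟ v) ∧ does (y ≟ u)))) e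

addEdge-new : (A : Adj n) (u v : Fin n) → addEdge A u v u v ≡ true
addEdge-new A u v rewrite dec-true (u ≟ u) refl | dec-true (v ≟ v) refl = ∨-zeroʳ (A u v)

addEdge⁻ : (A : Adj n) {u v x y : Fin n} → addEdge A u v x y ≡ true →
  A x y ≡ true ⊎ ((x ≡ u × y ≡ v) ⊎ (x ≡ v × y ≡ u))
addEdge⁻ A {u} {v} {x} {y} e with ∨⁻ {A x y} e
... | inj₁ f = inj₁ f
... | inj₂ f with ∨⁻ {does (x ≟ u) ∧ does (y ≟ v)} f
...   | inj₁ h = inj₂ (inj₁ (does⁻ (x ≟ u) (proj₁ (∧⁻ h)) , does⁻ (y ≟ v) (proj₂ (∧⁻ {does (x ≟ u)} h))))
...   | inj₂ h = inj₂ (inj₂ (does⁻ (x ≟ v) (proj₁ (∧⁻ h)) , does⁻ (y ≟ u) (proj₂ (∧⁻ {does (x ≟ v)} h))))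

_⊕⟨_,_,_⟩ : Graph n → (u v : Fin n) → u ≢ v → Graph n
G ⊕⟨ u , v , u≢v ⟩ = record
  { adj = addEdge A u v
  ; sym = λ x y → cong₂ _∨_ (Graph.sym G x y)
      (trans (∨-comm (does (x ≟ u) ∧ does (y ≟ v)) _)
        (cong₂ _∨_ (∧-comm (does (x ≟ v)) (does (y ≟ u))) (∧-comm (does (x ≟ u)) (does (y ≟ v)))))
  ; irrefl = λ x → ≢true⇒false λ e → case addEdge⁻ A e of λ where
      (inj₁ f) → false⇒≢true (Graph.irrefl G x) f
      (inj₂ (inj₁ (refl , e₂))) → u≢v e₂
      (inj₂ (inj₂ (refl , e₂))) → u≢v (≡sym e₂) }
  where
  A = Graph.adj G

EdgeMaximalOn : Adj n → Subset n → ℕ → Set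
EdgeMaximalOn A S c = ∀ {u v} → u ∈ S → v ∈ S → u ≢ v → A u v ≡ false → ¬ CircOn (addEdge A u v) S c

old-walk : (A : Adj n) → ∀ {x y u v l} → Walk (addEdge A x y) u v l → x ∉ˡ l → Walk A u v l
old-walk A stop x∉ = stop
old-walk A (e ◅ W) x∉ with addEdge⁻ A e
... | inj₁ f = f ◅ old-walk A W (x∉ ∘ there)
... | inj₂ (inj₁ (refl , _)) = contradiction (here refl) x∉
... | inj₂ (inj₂ (_ , refl)) = contradiction (there (start∈ W)) x∉

loop-trivial : {A : Adj n} → ∀ {u l} → Walk A u u l → Unique l → length l ≡ 1
loop-trivial stop _ = refl
loop-trivial (e ◅ W) (u∉ ∷ _) = contradiction refl (All.lookup u∉ (end∈ W))

-- A cycle that is too long must use the new edge. Rotated to begin in `x`, it has that edge either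
-- first or as its closing edge, and the rest is the path.
cycle⇒long-path : {A : Adj n} → SymmetricAdj A → ∀ {S c x y u v l} → CircOn A S c →
  Walk (addEdge A x y) u v l → addEdge A x y v u ≡ true → Unique l → All (_∈ S) l → 3 ≤ length l → c < length l →
  ∃ λ r → Walk A x y r × Unique r × All (_∈ S) r × c < length r
cycle⇒long-path {A = A} sy {x = x} {y} {u} {v} {l} circ W e un al 3≤ c< with x ∈ˡ? l
... | no x∉ with addEdge⁻ A e
...   | inj₁ f = contradiction (circ (old-walk A W x∉) f un al 3≤) (<⇒≱ c<)
...   | inj₂ (inj₁ (refl , _)) = contradiction (end∈ W) x∉
...   | inj₂ (inj₂ (_ , refl)) = contradiction (start∈ W) x∉
cycle⇒long-path {A = A} sy {S} {c} {x} {y} {u} {v} {l} circ W e un al 3≤ c< | yes x∈ with rotate W e un x∈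
... | .x , _ , stop , _ , _ , len , _ = contradiction (subst (3 ≤_) (≡sym len) 3≤) λ { (s≤s ()) }
... | z , r , _◅_ {w = w} e₁ W₁ , e₂ , uxr@(x∉ ∷ ur) , len , sub , _ = by-first (addEdge⁻ A e₁) (addEdge⁻ A e₂)
  where
  x∉r : x ∉ˡ r
  x∉r i = All.lookup x∉ i refl
  W₂ = old-walk A W₁ x∉r
  axr : All (_∈ S) (x ∷ r)
  axr = All.tabulate λ i → All.lookup al (sub i)
  c<xr : c < length (x ∷ r)
  c<xr = subst (c <_) (≡sym len) c<
  by-first : A x w ≡ true ⊎ ((x ≡ x × w ≡ y) ⊎ (x ≡ y × w ≡ x)) → A z x ≡ true ⊎ ((z ≡ x × x ≡ y) ⊎ (z ≡ y × x ≡ x)) →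
    ∃ λ r → Walk A x y r × Unique r × All (_∈ S) r × c < length r
  by-first (inj₂ (inj₂ (_ , refl))) _ = contradiction (start∈ W₁) x∉r
  by-first _ (inj₂ (inj₁ (refl , _))) = contradiction (end∈ W₁) x∉r
  by-first (inj₁ f₁) (inj₁ f₂) = contradiction (circ (f₁ ◅ W₂) f₂ uxr axr (subst (3 ≤_) (≡sym len) 3≤)) (<⇒≱ c<xr)
  by-first (inj₁ f₁) (inj₂ (inj₂ (refl , _))) = x ∷ r , f₁ ◅ W₂ , uxr , axr , c<xr
  by-first (inj₂ (inj₁ (_ , refl))) (inj₁ f₂) = x ∷ reverse r ,
    trans (sy x z) f₂ ◅ walk-reverse sy W₂ ,
    ∉⇒All≢ (λ i → x∉r (reverse⁻ i)) ∷ unique-reverse ur ,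
    All.head axr ∷ All.tabulate (λ i → All.lookup (All.tail axr) (reverse⁻ i)) ,
    subst (c <_) (cong suc (≡sym (length-reverse r))) c<xr
  by-first (inj₂ (inj₁ (_ , refl))) (inj₂ (inj₂ (refl , _))) =
    contradiction (subst (3 ≤_) (trans (≡sym len) (cong suc (loop-trivial W₂ ur))) 3≤) λ { (s≤s (s≤s ())) }

MinDegree : Adj n → Subset n → ℕ → Set
MinDegree A T k = ∀ {v} → v ∈ T → k ≤ ∣ nbr A T v ∣

module Kopylov (G : Graph n) {S : Subset n} (2c : TwoConnected (Graph.adj G) S)
  {c : ℕ} (2≤c : 2 ≤ c) (circ : CircOn (Graph.adj G) S c) (maximal : EdgeMaximalOn (Graph.adj G) S c)
  {T₁ T₂ : Subset n} {j k : ℕ} (T₁⊆S : T₁ ⊆ S) (T₂⊆S : T₂ ⊆ S) (δ₁ : MinDegree (Graph.adj G) T₁ j) (δ₂ : MinDegree (Graph.adj G) T₂ k)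
  (0<j : 0 < j) (0<k : 0 < k) (c<j+k : c < j + k) where

  private
    A : Adj n
    A = Graph.adj G
    sy : SymmetricAdj A
    sy = Graph.sym G

  open Posa sy (Graph.irrefl G) 2c 2≤c circ

  private
    neighbour-in-list : ∀ {T x l} → (∀ {v} → v ∈ nbr A T x → v ∈ˡ l) → ∣ nbr A T x ∣ ≤ occurrences (adjacent? A x) l
    neighbour-in-list {T} {x} {l} f = ∣∣≤length _ λ i → ∈-filter⁺ (adjacent? A x) (f i) (proj₂ (∈-nbr⁻ A T i))

    some-neighbour : ∀ {T x l i} → 0 < i → i ≤ ∣ nbr A T x ∣ → (∀ {v} → v ∈ nbr A T x → v ∈ˡ l) → ∃ λ v → v ∈ˡ l × A x v ≡ true
    some-neighbour {T} 0<i i≤ f with ∣∣>0⇒Nonempty (<-≤-trans 0<i i≤)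
    ... | v , v∈ = v , f v∈ , proj₂ (∈-nbr⁻ A T v∈)

    -- A longest such path contains all neighbours of x in T₁ and of y in T₂.
    no-long-path : ∀ m {x y l} → x ∈ T₁ → y ∈ T₂ → A x y ≢ true → Walk A x y l → Unique l → All (_∈ S) l →
      c < length l → ∣ S ∣ < length l + m → Empty.⊥
    no-long-path zero {l = l} x∈ y∈ ¬xy W un al c< h =
      <⇒≱ (subst (∣ S ∣ <_) (+-identityʳ (length l)) h) (unique⇒length≤∣∣ un al)
    no-long-path (suc m) {x} {y} {l} x∈ y∈ ¬xy W un al c< h
      with any? (λ v → (v ∈? nbr A T₁ x) ×-dec ¬? (v ∈ˡ? l))
    -- Either `v` closes the path to a cycle on more than `c` vertices, or `v` takes the place of
    -- `x`: it is again in `T₁` and not adjacent to `y`, and the path has become longer.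
    ... | yes (v , v∈ , v∉) with ∈-nbr⁻ A T₁ v∈ | A v y Bool.≟ true
    ...   | v∈T , xv | yes vy = <⇒≱ (m<n⇒m<1+n c<) (circ (trans (sy v x) xv ◅ W) (trans (sy y v) vy) (∉⇒All≢ v∉ ∷ un) (T₁⊆S v∈T ∷ al)
      (s≤s (≤-trans 2≤c (<⇒≤ c<))))
    ...   | v∈T , xv | no ¬vy = no-long-path m v∈T y∈ ¬vy (trans (sy v x) xv ◅ W) (∉⇒All≢ v∉ ∷ un) (T₁⊆S v∈T ∷ al)
      (m<n⇒m<1+n c<) (subst (∣ S ∣ <_) (+-suc (length l) m) h)
    no-long-path (suc m) {x} {y} {l} x∈ y∈ ¬xy W un al c< h | no none₁
      with any? (λ v → (v ∈? nbr A T₂ y) ×-dec ¬? (v ∈ˡ? l))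
    ... | yes (v , v∈ , v∉) = by-xv (A x v Bool.≟ true)
      where
      v∈T = proj₁ (∈-nbr⁻ A T₂ v∈)
      yv = proj₂ (∈-nbr⁻ A T₂ v∈)
      W′ = walk-reverse sy W
      un′ = ∉⇒All≢ (λ i → v∉ (reverse⁻ i)) ∷ unique-reverse un
      al′ = T₂⊆S v∈T ∷ All.tabulate (λ i → All.lookup al (reverse⁻ {xs = l} i))
      c<′ : c < suc (length (reverse l))
      c<′ = m<n⇒m<1+n (subst (c <_) (≡sym (length-reverse l)) c<)
      by-xv : Dec (A x v ≡ true) → Empty.⊥
      by-xv (yes xv) = <⇒≱ c<′ (circ (trans (sy v y) yv ◅ W′) xv un′ al′
        (s≤s (≤-trans 2≤c (≤-trans (<⇒≤ c<) (≤-reflexive (≡sym (length-reverse l)))))))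
      by-xv (no ¬xv) = no-long-path m x∈ v∈T ¬xv (walk-++ W yv stop) (unique-++ un ([] ∷ []) λ { i (here refl) → v∉ i })
        (AllP.++⁺ al (T₂⊆S v∈T ∷ [])) (subst (c <_) (≡sym len) (m<n⇒m<1+n c<))
        (subst (∣ S ∣ <_) (trans (+-suc (length l) m) (cong (_+ m) (≡sym len))) h)
        where
        len : length (l ++ v ∷ []) ≡ suc (length l)
        len = trans (length-++ l) (+-comm (length l) 1)
    ... | no none₂ = posa W un al c<
      (<-≤-trans c<j+k (+-mono-≤ (≤-trans (δ₁ x∈) (neighbour-in-list {T₁} all₁)) (≤-trans (δ₂ y∈) (neighbour-in-list {T₂} all₂))))
      (some-neighbour {T₁} 0<j (δ₁ x∈) all₁) (some-neighbour {T₂} 0<k (δ₂ y∈) all₂)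
      where
      all₁ : ∀ {v} → v ∈ nbr A T₁ x → v ∈ˡ l
      all₁ {v} i = decidable-stable (v ∈ˡ? l) λ v∉ → none₁ (v , i , v∉)
      all₂ : ∀ {v} → v ∈ nbr A T₂ y → v ∈ˡ l
      all₂ {v} i = decidable-stable (v ∈ˡ? l) λ v∉ → none₂ (v , i , v∉)

  adjacent : ∀ {x y} → x ∈ T₁ → y ∈ T₂ → x ≢ y → A x y ≡ true
  adjacent {x} {y} x∈ y∈ x≢y = decidable-stable (A x y Bool.≟ true) λ ¬xy →
    maximal (T₁⊆S x∈) (T₂⊆S y∈) x≢y (≢true⇒false ¬xy) λ W e un al 3≤ → ≮⇒≥ λ c< →
      case cycle⇒long-path sy circ W e un al 3≤ c< of λ (r , W′ , un′ , al′ , c<r) →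
        no-long-path (suc ∣ S ∣) x∈ y∈ ¬xy W′ un′ al′ c<r (m≤n+m (suc ∣ S ∣) (length r))

data Peel (A : Adj n) (k : ℕ) : Subset n → Subset n → Set where
  done   : ∀ {S} → Peel A k S S
  remove : ∀ {S T v} → v ∈ S → ∣ nbr A S v ∣ < k → Peel A k (S - v) T → Peel A k S T

nbr-⊆ : (A : Adj n) {S T : Subset n} {v : Fin n} → S ⊆ T → nbr A S v ⊆ nbr A T v
nbr-⊆ A {S} {T} f i with ∈-nbr⁻ A S i
... | a , b = ∈-nbr⁺ A T (f a) b

-- The `k`-core, kept together with an order of removal that leads to it: the order serves to count
-- cliques, `greatest` to control the vertices outside.
record Core (A : Adj n) (k : ℕ) (S : Subset n) : Set where
  field
    core     : Subset n
    core⊆    : core ⊆ S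
    degree   : MinDegree A core k
    greatest : ∀ {U} → U ⊆ S → MinDegree A U k → U ⊆ core
    peel     : Peel A k S core

-- A vertex of degree below `k` in `S` has degree below `k` in every subset, so discarding it loses
-- no subset of minimum degree `k`.
core-of : (A : Adj n) (k : ℕ) (S : Subset n) → Core A k S
core-of {n} A k S = go ∣ S ∣ S ≤-refl
  where
  go : ∀ m S → ∣ S ∣ ≤ m → Core A k S
  go m S h with any? (λ v → (v ∈? S) ×-dec (∣ nbr A S v ∣ ℕ.<? k))
  ... | no none = record { core = S ; core⊆ = id ; degree = λ {v} v∈ → ≮⇒≥ λ l → none (v , v∈ , l) ; greatest = λ f _ → f ; peel = done }
  go zero S h | yes (v , v∈ , _) = contradiction (∈⇒∣∣>0 v∈) (≤⇒≯ h)
  go (suc m) S h | yes (v , v∈ , l) = record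
    { core = R.core ; core⊆ = ∈p-x⇒∈p ∘ R.core⊆ ; degree = R.degree
    ; greatest = λ {U} f δ → R.greatest (λ {x} i → x∈p∧x≢y⇒x∈p-y (f i) λ { refl → <⇒≱ l (≤-trans (δ i) (p⊆q⇒∣p∣≤∣q∣ (nbr-⊆ A f))) }) δ
    ; peel = remove v∈ l R.peel }
    where
    module R = Core (go m (S - v) (s≤s⁻¹ (subst (_≤ suc m) (≡sym (∣p-x∣ v∈)) h)))

-- The removal is interrupted after exactly `i` vertices. On the way to the core for `suc k`, a
-- removed vertex has degree at most `k`.
take-peel : (A : Adj n) (k t : ℕ) → ∀ i {S T} → Peel A (suc k) S T → i + ∣ T ∣ ≤ ∣ S ∣ →
  ∃ λ R → R ⊆ S × ∣ R ∣ + i ≡ ∣ S ∣ × cliques A (suc (suc t)) S ≤ cliques A (suc (suc t)) R + i * (k C suc t)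
take-peel A k t zero {S} p h = S , id , +-identityʳ _ , ≤-reflexive (≡sym (+-identityʳ _))
take-peel A k t (suc i) {S} done h = contradiction (m≤n+m ∣ S ∣ i) (<⇒≱ h)
take-peel A k t (suc i) {S} {T} (remove {v = v} v∈ l p) h
  with take-peel A k t i p (s≤s⁻¹ (subst (suc i + ∣ T ∣ ≤_) (≡sym (∣p-x∣ v∈)) h))
... | R , f , e , b = R , ∈p-x⇒∈p ∘ f , trans (+-suc ∣ R ∣ i) (trans (cong suc e) (∣p-x∣ v∈)) , (begin
  cliques A (suc (suc t)) S                                          ≤⟨ cliques-delete A (suc t) S ⟩
  cliques A (suc (suc t)) (S - v) + ∣ nbr A S v ∣ C suc t            ≤⟨ +-mono-≤ b (C-mono t (s≤s⁻¹ l)) ⟩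
  cliques A (suc (suc t)) R + i * (k C suc t) + k C suc t            ≡⟨ solve 3 (λ a b c → a :+ b :+ c := a :+ (c :+ b)) refl (cliques A (suc (suc t)) R) (i * (k C suc t)) (k C suc t) ⟩
  cliques A (suc (suc t)) R + suc i * (k C suc t)                    ∎)
  where
  open ≤-Reasoning
  open +-*-Solver

first-step : {A : Adj n} {S : Subset n} {a b : Fin n} → PathIn A S a b → a ≢ b → ∃ λ w → w ∈ S × A a w ≡ true
first-step (here _) ne = contradiction refl ne
first-step (step _ e (here w∈)) _ = _ , w∈ , e
first-step (step _ e (step w∈ _ _)) _ = _ , w∈ , e

neighbour-avoiding : {A : Adj n} {S : Subset n} → TwoConnected A S → 3 ≤ ∣ S ∣ → ∀ {u v} → v ∈ S → u ∈ S → u ≢ v →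
  ∃ λ w → w ∈ S - u × A v w ≡ true
neighbour-avoiding {S = S} 2c 3≤ {u} {v} v∈ u∈ u≢v
  with ∣∣>1⇒other {p = S - u} v (s≤s⁻¹ (subst (3 ≤_) (≡sym (∣p-x∣ u∈)) 3≤))
... | z , z∈ , z≢v = first-step (2c u∈ (x∈p∧x≢y⇒x∈p-y v∈ (u≢v ∘ ≡sym)) z∈) (z≢v ∘ ≡sym)

two-neighbours : {A : Adj n} {S : Subset n} → (∀ v → A v v ≡ false) → TwoConnected A S → 3 ≤ ∣ S ∣ → MinDegree A S 2
two-neighbours {A = A} {S} ir 2c 3≤ {v} v∈ with ∣∣>1⇒other {p = S} v (≤-trans (s≤s (s≤s z≤n)) 3≤)
... | u , u∈ , u≢v with neighbour-avoiding 2c 3≤ v∈ u∈ u≢v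
...   | w₁ , w₁∈ , vw₁ with neighbour-avoiding 2c 3≤ v∈ (∈p-x⇒∈p w₁∈) (λ { refl → false⇒≢true (ir v) vw₁ })
...     | w₂ , w₂∈ , vw₂ = two⇒∣∣>1 (∈-nbr⁺ A S (∈p-x⇒∈p w₁∈) vw₁) (∈-nbr⁺ A S (∈p-x⇒∈p w₂∈) vw₂) (∈p-x⇒≢ w₂∈ ∘ ≡sym)

complete-walk : {A : Adj n} {S : Subset n} → IsComplete A S → ∀ x l → Unique (x ∷ l) → All (_∈ S) (x ∷ l) →
  Walk A x (lastOf x l) (x ∷ l)
complete-walk k x [] _ _ = stop
complete-walk k x (y ∷ l) ((x≢y ∷ _) ∷ u) (x∈ ∷ al) = k x∈ (All.head al) x≢y ◅ complete-walk k y l u al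

lastOf∈ : {X : Set} (x : X) (l : List X) → lastOf x l ∈ˡ x ∷ l
lastOf∈ x [] = here refl
lastOf∈ x (y ∷ l) = there (lastOf∈ y l)

complete⇒∣∣≤circumference : {A : Adj n} {S : Subset n} {c : ℕ} → IsComplete A S → CircOn A S c → 3 ≤ ∣ S ∣ → ∣ S ∣ ≤ c
complete⇒∣∣≤circumference {A = A} {S} {c} k circ 3≤ = subst (_≤ c) (length-elements S)
  (go (elements S) (unique-elements S) (All.tabulate ∈-elements⁻) (subst (3 ≤_) (≡sym (length-elements S)) 3≤))
  where
  go : ∀ l → Unique l → All (_∈ S) l → 3 ≤ length l → length l ≤ c
  go (x ∷ y ∷ l) u@(x∉ ∷ _) al h = circ (complete-walk k x (y ∷ l) u al)
    (k (All.lookup al (there (lastOf∈ y l))) (All.head al) (All.lookup x∉ (lastOf∈ y l) ∘ ≡sym)) u al h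
  go (_ ∷ []) _ _ (s≤s ())

-- Kopylov's bound for edge-maximal sets

module _ (q : ℕ) {d : ℕ} .{{_ : NonZero d}} (k<d : suc q < d) where

  private
    k : ℕ
    k = suc q

    s : ℕ
    s = suc (suc k)

    2≤d : 2 ≤ d
    2≤d = ≤-trans (s≤s (s≤s z≤n)) k<d

  -- Kopylov's disintegration: remove vertices of degree at most ⌊c/2⌋, c = d+1. If fewer than d vertices
  -- get removed, the rest is a clique, and everything else has even smaller degree when removed in order.
  edge-maximal-bound : (G : Graph n) (S : Subset n) → TwoConnected (Graph.adj G) S → CircOn (Graph.adj G) S (suc d) →
    EdgeMaximalOn (Graph.adj G) S (suc d) → suc d < ∣ S ∣ →
    (∀ R → 0 < ∣ R ∣ → ∣ R ∣ < ∣ S ∣ → R ⊆ S → cliques (Graph.adj G) s R ≤ g {d} k (∣ R ∣ ∸ 1)) →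
    cliques (Graph.adj G) s S < g {d} k (∣ S ∣ ∸ 1)
  edge-maximal-bound {n} G S 2c circ maximal d<S IH = by-size (d + ∣ T ∣ ℕ.≤? ∣ S ∣)
    where
    A = Graph.adj G
    2≤c : 2 ≤ suc d
    2≤c = m≤n⇒m≤1+n 2≤d
    a = suc d / 2
    2a≤ : a + a ≤ suc d
    2a≤ = ≤-trans (≤-reflexive (trans (cong (a +_) (≡sym (+-identityʳ a))) (*-comm 2 a))) (m/n*n≤m (suc d) 2)
    2a> : suc d < suc a + suc a
    2a> = subst (suc d <_) (solve 1 (λ a → con 2 :+ a :* con 2 := con 1 :+ a :+ (con 1 :+ a)) refl a)
      (subst (_< 2 + a * 2) (≡sym (m≡m%n+[m/n]*n (suc d) 2)) (+-monoˡ-< (a * 2) (m%n<n (suc d) 2)))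
      where open +-*-Solver
    module C₁ = Core (core-of A (suc a) S)
    T = C₁.core

    by-size : Dec (d + ∣ T ∣ ≤ ∣ S ∣) → cliques A s S < g {d} k (∣ S ∣ ∸ 1)
    -- Removing `d` vertices costs fewer cliques than one `K_c` contains, by `peel-bound`, and one
    -- `K_c` is what `g` gains from `d` further vertices.
    by-size (yes h) with take-peel A a k d C₁.peel h
    ... | R , R⊆S , eR , b with ∣ R ∣ in eqR
    ...   | zero = contradiction eR (<⇒≢ (<-trans (n<1+n d) d<S))
    ...   | suc r = begin-strict
      cliques A s S                      ≤⟨ b ⟩
      cliques A s R + d * (a C suc k)    ≤⟨ +-monoˡ-≤ _ (IH R (subst (0 <_) (≡sym eqR) z<s)
                                              (subst₂ _<_ (≡sym eqR) eR (m<m+n (suc r) (≤-trans (s≤s z≤n) 2≤d))) R⊆S) ⟩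
      g k (∣ R ∣ ∸ 1) + d * (a C suc k)  <⟨ +-monoʳ-< (g k (∣ R ∣ ∸ 1)) (peel-bound q d a 2a≤ k<d) ⟩
      g k (∣ R ∣ ∸ 1) + F (suc k) d      ≡⟨ cong (λ z → g k (z ∸ 1) + F (suc k) d) eqR ⟩
      g k r + F (suc k) d                ≡⟨ +-comm (g k r) _ ⟩
      F (suc k) d + g k r                ≡⟨ g-d+ k r ⟨
      g k (d + r)                        ≡⟨ cong (g k) (trans (+-comm d r) (cong (_∸ 1) eR)) ⟩
      g k (∣ S ∣ ∸ 1)                    ∎
      where open ≤-Reasoning
    by-size (no h) = final
      where
      S<d+T : ∣ S ∣ < d + ∣ T ∣
      S<d+T = ≰⇒> h
      ℓ = ∣ T ∣
      1<ℓ : 1 < ℓ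
      1<ℓ = +-cancelˡ-< d 1 ℓ (<-trans (subst (_< ∣ S ∣) (+-comm 1 d) d<S) S<d+T)
      T-clique : IsComplete A T
      T-clique u∈ v∈ = Kopylov.adjacent G 2c 2≤c circ maximal C₁.core⊆ C₁.core⊆ C₁.degree C₁.degree z<s z<s 2a> u∈ v∈
      T-degree : MinDegree A T (ℓ ∸ 1)
      T-degree {v} v∈ = ≤-trans (≤-reflexive (cong (_∸ 1) (≡sym (∣p-x∣ v∈))))
        (p⊆q⇒∣p∣≤∣q∣ {p = T - v} {q = nbr A T v} λ w∈ →
          ∈-nbr⁺ A T (∈p-x⇒∈p {p = T} w∈) (T-clique v∈ (∈p-x⇒∈p {p = T} w∈) (∈p-x⇒≢ {p = T} w∈ ∘ ≡sym)))
      a+2≤ℓ : suc (suc a) ≤ ℓ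
      a+2≤ℓ with ∣∣>0⇒Nonempty (<-trans z<s 1<ℓ)
      ... | v , v∈ = subst (suc (suc a) ≤_) (∣p-x∣ v∈) (s≤s (≤-trans (C₁.degree v∈) (p⊆q⇒∣p∣≤∣q∣ {p = nbr A T v} {q = T - v} λ w∈ →
        x∈p∧x≢y⇒x∈p-y (proj₁ (∈-nbr⁻ A T w∈)) λ { refl → false⇒≢true (Graph.irrefl G v) (proj₂ (∈-nbr⁻ A T w∈)) })))
      -- The clique `T` has inner degree `ℓ - 1`, and this `b` makes `(ℓ - 1) + (b + 1)` equal to
      -- `c + 1`, just enough for the core of degree `b + 1` to be joined to `T`.
      b = suc (suc d) ∸ ℓ
      c<ℓ+b : suc d < (ℓ ∸ 1) + suc b
      c<ℓ+b = ≤-trans (m≤n+m∸n (suc (suc d)) ℓ) (≤-reflexive (trans (cong (_+ b) (≡sym (m+[n∸m]≡n (<⇒≤ 1<ℓ)))) (≡sym (+-suc (ℓ ∸ 1) b))))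
      module C₂ = Core (core-of A (suc b) S)
      joined : ∀ {x y} → x ∈ T → y ∈ C₂.core → x ≢ y → A x y ≡ true
      joined = Kopylov.adjacent G 2c 2≤c circ maximal C₁.core⊆ C₂.core⊆ T-degree C₂.degree (m<n⇒0<n∸m 1<ℓ) z<s c<ℓ+b
      -- A vertex `y` of the second core outside `T` would be adjacent to all of `T`, and `T`
      -- together with `y` would still have minimum degree `a + 1`, against the maximality of the
      -- first core.
      C₂⊆T : C₂.core ⊆ T
      C₂⊆T {y} y∈ = decidable-stable (y ∈? T) λ y∉ →
        let U = T ∪ ⁅ y ⁆
            δ : MinDegree A U (suc a)
            δ {v} v∈ = case x∈p∪q⁻ T ⁅ y ⁆ v∈ of λ where
              (inj₁ v∈T) → ≤-trans (C₁.degree v∈T) (p⊆q⇒∣p∣≤∣q∣ (nbr-⊆ A {T} {U} (p⊆p∪q ⁅ y ⁆)))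
              (inj₂ v∈y) → subst (λ z → suc a ≤ ∣ nbr A U z ∣) (≡sym (x∈⁅y⁆⇒x≡y y v∈y))
                (≤-trans (<⇒≤ a+2≤ℓ) (p⊆q⇒∣p∣≤∣q∣ λ {w} w∈ → ∈-nbr⁺ A U (p⊆p∪q ⁅ y ⁆ w∈)
                  (trans (Graph.sym G y w) (joined w∈ y∈ λ { refl → y∉ w∈ }))))
            U⊆S : U ⊆ S
            U⊆S v∈ = case x∈p∪q⁻ T ⁅ y ⁆ v∈ of λ where
              (inj₁ v∈T) → C₁.core⊆ v∈T
              (inj₂ v∈y) → subst (_∈ S) (≡sym (x∈⁅y⁆⇒x≡y y v∈y)) (C₂.core⊆ y∈)
        in y∉ (C₁.greatest U⊆S δ (q⊆p∪q T ⁅ y ⁆ (x∈⁅x⁆ y)))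
      3≤S : 3 ≤ ∣ S ∣
      3≤S = ≤-trans (s≤s (≤-trans 2≤d (n≤1+n d))) d<S
      -- For `b < 2` the second core would be all of `S`, whose degrees are at least two. Then `S`
      -- would lie in the clique `T` and contain a cycle through more than `c` vertices.
      2≤b : 2 ≤ b
      2≤b = ≮⇒≥ λ b<2 → <⇒≱ d<S (complete⇒∣∣≤circumference
        (λ u∈ v∈ → T-clique (S⊆T b<2 u∈) (S⊆T b<2 v∈)) circ 3≤S)
        where
        S⊆T : b < 2 → S ⊆ T
        S⊆T b<2 x∈ = C₂⊆T (C₂.greatest id (λ v∈ → ≤-trans b<2 (two-neighbours (Graph.irrefl G) 2c 3≤S v∈)) x∈)
      ℓ≤d : ℓ ≤ d
      ℓ≤d = s≤s⁻¹ (s≤s⁻¹ (subst (_≤ suc (suc d)) (+-comm ℓ 2) (≤-trans (+-monoʳ-≤ ℓ 2≤b) (≤-reflexive (m+[n∸m]≡n ℓ≤)))))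
        where
        ℓ≤ : ℓ ≤ suc (suc d)
        ℓ≤ = <⇒≤ (m∸n≢0⇒n<m (>⇒≢ (<-trans z<s 2≤b)))
      2b≤ : b + b ≤ suc d
      2b≤ = ≤-trans (+-mono-≤ b≤ (≤-trans b≤ d-a≤a)) (≤-trans (≤-reflexive (m∸n+n≡m a≤d)) (n≤1+n d))
        where
        b≤ : b ≤ d ∸ a
        b≤ = ∸-monoʳ-≤ (suc (suc d)) a+2≤ℓ
        a≤d : a ≤ d
        a≤d = ≤-trans (n≤1+n a) (≤-trans (n≤1+n (suc a)) (≤-trans a+2≤ℓ ℓ≤d))
        d-a≤a : d ∸ a ≤ a
        d-a≤a = m≤n+o⇒m∸n≤o d a (s≤s⁻¹ (subst (d <_) (+-suc a a) (s≤s⁻¹ 2a>)))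
      x = ∣ S ∣ ∸ suc d
      0<x : 0 < x
      0<x = m<n⇒0<n∸m d<S
      S≡ : suc d + x ≡ ∣ S ∣
      S≡ = m+[n∸m]≡n (<⇒≤ d<S)
      ℓ+b≡ : (ℓ ∸ 1) + (b ∸ 1) ≡ d
      ℓ+b≡ = suc-injective (suc-injective (trans (≡sym (trans
        (cong₂ _+_ (≡sym (m+[n∸m]≡n (<⇒≤ 1<ℓ))) (≡sym (m+[n∸m]≡n (<⇒≤ 2≤b)))) (cong suc (+-suc (ℓ ∸ 1) (b ∸ 1)))))
        (m+[n∸m]≡n (≤-trans ℓ≤d (≤-trans (n≤1+n d) (n≤1+n (suc d)))))))
      i≡ : ∣ S ∣ ∸ ℓ ≡ (b ∸ 1) + x
      i≡ = trans (cong (_∸ ℓ) (trans (≡sym S≡) (trans (cong (λ z → suc z + x) (≡sym ℓ+b≡)) (trans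
        (cong suc (+-assoc (ℓ ∸ 1) (b ∸ 1) x)) (cong (_+ ((b ∸ 1) + x)) (m+[n∸m]≡n (<⇒≤ 1<ℓ))))))) (m+n∸m≡n ℓ ((b ∸ 1) + x))
      ℓ≤S : ℓ ≤ ∣ S ∣
      ℓ≤S = p⊆q⇒∣p∣≤∣q∣ C₁.core⊆
      -- Fewer than `d` vertices lie outside `T`. This gives `g` at `d + x` the value `F d + F x`,
      -- the right side of `core-bound`.
      x<d : x < d
      x<d = <-trans (+-cancelˡ-< (suc d) x (ℓ ∸ 1) (subst₂ _<_ (≡sym S≡)
        (trans (cong (d +_) (≡sym (m+[n∸m]≡n (<⇒≤ 1<ℓ)))) (+-suc d (ℓ ∸ 1))) S<d+T))
        (≤-trans (≤-reflexive (m+[n∸m]≡n (<⇒≤ 1<ℓ))) ℓ≤d)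
      final : cliques A s S < g {d} k (∣ S ∣ ∸ 1)
      final with take-peel A b k (∣ S ∣ ∸ ℓ) C₂.peel (≤-trans (+-monoʳ-≤ (∣ S ∣ ∸ ℓ) (p⊆q⇒∣p∣≤∣q∣ C₂⊆T)) (≤-reflexive (m∸n+n≡m ℓ≤S)))
      ... | R , R⊆S , eR , bR = begin-strict
        cliques A s S                                                ≤⟨ bR ⟩
        cliques A s R + (∣ S ∣ ∸ ℓ) * (b C suc k)                    ≤⟨ +-monoˡ-≤ _ (cliques≤binomial A s R) ⟩
        ∣ R ∣ C s + (∣ S ∣ ∸ ℓ) * (b C suc k)                        ≡⟨ cong₂ (λ y z → y C s + z * (b C suc k)) ∣R∣≡ i≡ ⟩
        F (suc k) (d ∸ (b ∸ 1)) + ((b ∸ 1) + x) * (b C suc k)        <⟨ core-bound q d b 2b≤ 2≤b k<d 0<x ⟩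
        F (suc k) d + F (suc k) x                                    ≡⟨ cong (F (suc k) d +_) (g-small k x<d) ⟨
        F (suc k) d + g k x                                          ≡⟨ g-d+ k x ⟨
        g k (d + x)                                                  ≡⟨ cong (λ z → g k (z ∸ 1)) S≡ ⟩
        g k (∣ S ∣ ∸ 1)                                              ∎
        where
        open ≤-Reasoning
        ∣R∣≡ : ∣ R ∣ ≡ suc (d ∸ (b ∸ 1))
        ∣R∣≡ = trans (+-cancelʳ-≡ (∣ S ∣ ∸ ℓ) ∣ R ∣ ℓ (trans eR (≡sym (m+[n∸m]≡n ℓ≤S))))
          (trans (≡sym (m+[n∸m]≡n (<⇒≤ 1<ℓ))) (cong suc (≡sym (trans (cong (_∸ (b ∸ 1)) (≡sym ℓ+b≡)) (m+n∸n≡m (ℓ ∸ 1) (b ∸ 1))))))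

-- Components, cut vertices and the bound for arbitrary vertex sets

path-start : {A : Adj n} {S : Subset n} {u v : Fin n} → PathIn A S u v → u ∈ S
path-start (here u∈) = u∈
path-start (step u∈ _ _) = u∈

path-++ : {A : Adj n} {S : Subset n} {u v w : Fin n} → PathIn A S u v → PathIn A S v w → PathIn A S u w
path-++ (here _) p = p
path-++ (step u∈ e q) p = step u∈ e (path-++ q p)

path-snoc : {A : Adj n} {S : Subset n} {u v w : Fin n} → PathIn A S u v → A v w ≡ true → w ∈ S → PathIn A S u w
path-snoc p e w∈ = path-++ p (step (end p) e (here w∈))
  where
  end : ∀ {u v} → PathIn _ _ u v → v ∈ _
  end (here v∈) = v∈
  end (step _ _ p) = end p

path-reverse : {A : Adj n} → SymmetricAdj A → ∀ {S : Subset n} {u v} → PathIn A S u v → PathIn A S v u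
path-reverse sy (here u∈) = here u∈
path-reverse sy {u = u} (step {w = w} u∈ e p) = path-snoc (path-reverse sy p) (trans (sy w u) e) u∈

path-mono : {A B : Adj n} {S T : Subset n} → (∀ u v → A u v ≡ true → B u v ≡ true) → S ⊆ T →
  ∀ {u v} → PathIn A S u v → PathIn B T u v
path-mono f g (here u∈) = here (g u∈)
path-mono f g (step u∈ e p) = step (g u∈) (f _ _ e) (path-mono f g p)

path-closed : {A : Adj n} {S K : Subset n} → (∀ {u w} → u ∈ K → w ∈ S → A u w ≡ true → w ∈ K) →
  ∀ {u v} → PathIn A S u v → u ∈ K → v ∈ K
path-closed cl (here _) u∈ = u∈
path-closed cl (step _ e p) u∈ = path-closed cl p (cl u∈ (path-start p) e)

-- The positive form of disconnectedness: besides refuting connectedness it supplies the part along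
-- which `S` is cut.
record Separated (A : Adj n) (S : Subset n) : Set where
  field
    part   : Subset n
    part⊆  : part ⊆ S
    {a b}  : Fin n
    a∈     : a ∈ part
    b∈     : b ∈ S
    b∉     : b ∉ part
    closed : ∀ {u w} → u ∈ part → w ∈ S → A u w ≡ true → w ∈ part

module _ (G : Graph n) where

  private
    A : Adj n
    A = Graph.adj G

  component : ∀ {S a} → a ∈ S → ∃ λ K → a ∈ K × K ⊆ S × (∀ {v} → v ∈ K → PathIn A S a v) ×
    (∀ {u w} → u ∈ K → w ∈ S → A u w ≡ true → w ∈ K)
  component {S} {a} a∈S = go ∣ S ∣ ⁅ a ⁆ (x∈⁅x⁆ a) (λ i → subst (_∈ S) (≡sym (x∈⁅y⁆⇒x≡y a i)) a∈S)
    (λ i → subst (PathIn A S a) (≡sym (x∈⁅y⁆⇒x≡y a i)) (here a∈S)) (m≤n+m ∣ S ∣ ∣ ⁅ a ⁆ ∣)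
    where
    go : ∀ m K → a ∈ K → K ⊆ S → (∀ {v} → v ∈ K → PathIn A S a v) → ∣ S ∣ ≤ ∣ K ∣ + m →
      ∃ λ K → a ∈ K × K ⊆ S × (∀ {v} → v ∈ K → PathIn A S a v) × (∀ {u w} → u ∈ K → w ∈ S → A u w ≡ true → w ∈ K)
    go m K a∈ K⊆ reach h with any? (λ w → ((w ∈? S) ×-dec ¬? (w ∈? K)) ×-dec any? (λ u → (u ∈? K) ×-dec (A u w Bool.≟ true)))
    ... | no none = K , a∈ , K⊆ , reach , λ {u} {w} u∈ w∈ e →
      decidable-stable (w ∈? K) λ w∉ → none (w , (w∈ , w∉) , u , u∈ , e)
    go zero K a∈ K⊆ reach h | yes (w , (w∈ , w∉) , _) =
      contradiction w∈ λ w∈ → w∉ (subst (w ∈_) (≡sym (⊆∧∣∣≥⇒≡ K⊆ (subst (∣ S ∣ ≤_) (+-identityʳ ∣ K ∣) h))) w∈)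
    go (suc m) K a∈ K⊆ reach h | yes (w , (w∈ , w∉) , u , u∈ , e) =
      go m (K ∪ ⁅ w ⁆) (p⊆p∪q ⁅ w ⁆ a∈)
        (λ i → case x∈p∪q⁻ K ⁅ w ⁆ i of λ where
          (inj₁ j) → K⊆ j
          (inj₂ j) → subst (_∈ S) (≡sym (x∈⁅y⁆⇒x≡y w j)) w∈)
        (λ i → case x∈p∪q⁻ K ⁅ w ⁆ i of λ where
          (inj₁ j) → reach j
          (inj₂ j) → subst (PathIn A S a) (≡sym (x∈⁅y⁆⇒x≡y w j)) (path-snoc (reach u∈) e w∈))
        (≤-trans h (≤-trans (≤-reflexive (+-suc ∣ K ∣ m)) (+-monoˡ-≤ m
          (p⊂q⇒∣p∣<∣q∣ (p⊆p∪q ⁅ w ⁆ , w , q⊆p∪q K ⁅ w ⁆ (x∈⁅x⁆ w) , w∉)))))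

  connected-or-separated : ∀ S → ConnectedOn A S ⊎ Separated A S
  connected-or-separated S with nonempty? S
  ... | no empty = inj₁ λ u∈ → contradiction (_ , u∈) empty
  ... | yes (a , a∈S) with component a∈S
  ...   | K , a∈ , K⊆ , reach , cl with any? (λ b → (b ∈? S) ×-dec ¬? (b ∈? K))
  ...     | yes (b , b∈ , b∉) = inj₂ record { part = K ; part⊆ = K⊆ ; a∈ = a∈ ; b∈ = b∈ ; b∉ = b∉ ; closed = cl }
  ...     | no none = inj₁ λ u∈ v∈ → path-++ (path-reverse (Graph.sym G) (reach (all u∈))) (reach (all v∈))
    where
    all : ∀ {x} → x ∈ S → x ∈ K
    all {x} x∈ = decidable-stable (x ∈? K) λ x∉ → none (x , x∈ , x∉)

  separated? : ∀ S → Dec (Separated A S)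
  separated? S with connected-or-separated S
  ... | inj₂ sep = yes sep
  ... | inj₁ con = no λ sep → let open Separated sep in b∉ (path-closed closed (con (part⊆ a∈) b∈) a∈)

  two-connected-or-cut : ∀ S → TwoConnected A S ⊎ ∃ λ v → v ∈ S × Separated A (S - v)
  two-connected-or-cut S with any? (λ v → (v ∈? S) ×-dec separated? (S - v))
  ... | yes cut = inj₂ cut
  ... | no none = inj₁ λ {v} v∈ → case connected-or-separated (S - v) of λ where
    (inj₁ con) → con
    (inj₂ sep) → contradiction (v , v∈ , sep) none

  -- A clique that meets `K` stays inside `S₁`; any other avoids `K`. The set `S₁` is `K` itself for
  -- a disconnected `S`, and `K` with the cut vertex otherwise.
  cliques-separate : ∀ s {S K S₁} → K ⊆ S₁ → (∀ {u w} → u ∈ K → w ∈ S → A u w ≡ true → w ∈ S₁) →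
    cliques A s S ≤ cliques A s S₁ + cliques A s (S ─ K)
  cliques-separate s {S} {K} {S₁} K⊆ cl = cliques-cover A s S S₁ (S ─ K) cover
    where
    cover : ∀ {T} → ∣ T ∣ ≡ s → IsComplete A T → T ⊆ S → T ⊆ S₁ ⊎ T ⊆ S ─ K
    cover {T} _ k f with any? (λ u → (u ∈? T) ×-dec (u ∈? K))
    ... | no none = inj₂ λ {x} x∈ → x∈p∧x∉q⇒x∈p─q (f x∈) λ x∈K → none (x , x∈ , x∈K)
    ... | yes (u , u∈T , u∈K) = inj₁ λ {w} w∈ → case u ≟ w of λ where
      (yes refl) → K⊆ u∈K
      (no ne) → cl u∈K (f w∈) (k u∈T w∈ ne)

─⁻ : {p q : Subset n} {x : Fin n} → x ∈ p ─ q → x ∉ q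
─⁻ {p = _ ∷ p} {outside ∷ q} Vec.here ()
─⁻ {p = _ ∷ p} {_ ∷ q} (Vec.there i) (Vec.there j) = ─⁻ {p = p} {q} i j

∣p─q∣+∣q∣ : {p q : Subset n} → q ⊆ p → ∣ q ∣ + ∣ p ─ q ∣ ≡ ∣ p ∣
∣p─q∣+∣q∣ {p = p} {q} f = ≤-antisym
  (∣∣+∣∣-disjoint f (p─q⊆p p q) λ i j → ─⁻ {p = p} {q} j i)
  (∣∣≤∣∣+∣∣ {p = q} {p ─ q} λ {x} i → case x ∈? q of λ where
    (yes j) → inj₁ j
    (no j) → inj₂ (x∈p∧x∉q⇒x∈p─q i j))

∣p∪x∣ : {p : Subset n} {x : Fin n} → x ∉ p → ∣ p ∪ ⁅ x ⁆ ∣ ≡ suc ∣ p ∣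
∣p∪x∣ {p = p} {x} x∉ = trans (≡sym (∣p-x∣ (q⊆p∪q p ⁅ x ⁆ (x∈⁅x⁆ x)))) (cong (suc ∘ ∣_∣) (⊆-antisym
  (λ i → case x∈p∪q⁻ p ⁅ x ⁆ (∈p-x⇒∈p {p = p ∪ ⁅ x ⁆} i) of λ where
    (inj₁ j) → j
    (inj₂ j) → contradiction (x∈⁅y⁆⇒x≡y x j) (∈p-x⇒≢ {p = p ∪ ⁅ x ⁆} i))
  λ i → x∈p∧x≢y⇒x∈p-y (p⊆p∪q ⁅ x ⁆ i) λ { refl → x∉ i }))

-- A termination measure for adding edges; ordered pairs and loops are counted as well.
nonEdges : Graph n → List (Fin n × Fin n)
nonEdges {n} G = filter (λ (u , v) → Graph.adj G u v Bool.≟ false) (cartesianProduct (allFin n) (allFin n))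

nonEdges-⊕ : (G : Graph n) {u v : Fin n} (u≢v : u ≢ v) → Graph.adj G u v ≡ false →
  length (nonEdges (G ⊕⟨ u , v , u≢v ⟩)) < length (nonEdges G)
nonEdges-⊕ {n} G {u} {v} u≢v uv = unique⊆⇒length≤ {xs = (u , v) ∷ nonEdges G′}
  (∉⇒All≢ (λ i → false⇒≢true (proj₂ (∈-filter⁻ P′? {xs = pairs} i)) (addEdge-new A u v)) ∷
    UniqueP.filter⁺ P′? (UniqueP.cartesianProduct⁺ (UniqueP.allFin⁺ n) (UniqueP.allFin⁺ n)))
  λ where
    (here refl) → ∈-filter⁺ P? (∈-cartesianProduct⁺ (∈-allFin u) (∈-allFin v)) uv
    {x , y} (there i) → ∈-filter⁺ P? (∈-cartesianProduct⁺ (∈-allFin x) (∈-allFin y))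
      (≢true⇒false λ e → false⇒≢true (proj₂ (∈-filter⁻ P′? {xs = pairs} i)) (addEdge⁺ A e))
  where
  A = Graph.adj G
  G′ = G ⊕⟨ u , v , u≢v ⟩
  pairs = cartesianProduct (allFin n) (allFin n)
  P? : Decidable (λ ((u , v) : Fin n × Fin n) → Graph.adj G u v ≡ false)
  P? (u , v) = Graph.adj G u v Bool.≟ false
  P′? : Decidable (λ ((u , v) : Fin n × Fin n) → Graph.adj G′ u v ≡ false)
  P′? (u , v) = Graph.adj G′ u v Bool.≟ false

module Bound (q : ℕ) {d : ℕ} .{{_ : NonZero d}} (k<d : suc q < d) where

  private
    k : ℕ
    k = suc q

    s : ℕ
    s = suc (suc k)

    Bounded : Graph n → Subset n → Set
    Bounded G S = cliques (Graph.adj G) s S ≤ g {d} k (∣ S ∣ ∸ 1)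

    -- Adding edges changes the graph but not `S`, so the hypothesis on smaller sets ranges over all
    -- graphs; `e` bounds the number of edges still to be added.
    StrictFrom : ℕ → Set
    StrictFrom n = ∀ e (G : Graph n) S → length (nonEdges G) ≤ e → TwoConnected (Graph.adj G) S → CircOn (Graph.adj G) S (suc d) →
      suc d < ∣ S ∣ → (∀ (G : Graph n) R → 0 < ∣ R ∣ → ∣ R ∣ < ∣ S ∣ → CircOn (Graph.adj G) R (suc d) → Bounded G R) →
      cliques (Graph.adj G) s S < g {d} k (∣ S ∣ ∸ 1)

    -- The conclusion is decidable, so one may argue by contradiction: adding an edge that keeps
    -- the circumference small would already finish the proof, hence G is edge-maximal.
    strict-from : StrictFrom n
    strict-from e G S h 2c circ d<S IH = decidable-stable (cliques (Graph.adj G) s S ℕ.<? g k (∣ S ∣ ∸ 1)) λ ¬strict →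
      ¬strict (edge-maximal-bound q k<d G S 2c circ
        (λ {u} {v} u∈ v∈ u≢v uv circ′ → ¬strict (add e h u≢v uv circ′))
        d<S λ R 0<R R<S R⊆S → IH G R 0<R R<S (CircOn-⊆ R⊆S circ))
      where
      add : ∀ e → length (nonEdges G) ≤ e → ∀ {u v} (u≢v : u ≢ v) → Graph.adj G u v ≡ false →
        CircOn (addEdge (Graph.adj G) u v) S (suc d) → cliques (Graph.adj G) s S < g k (∣ S ∣ ∸ 1)
      add zero h u≢v uv _ = contradiction (nonEdges-⊕ G u≢v uv) (≤⇒≯ (≤-trans h z≤n))
      add (suc e) h u≢v uv circ′ = ≤-<-trans (cliques-⊆ (λ x y → addEdge⁺ (Graph.adj G)) s S)
        (strict-from e (G ⊕⟨ _ , _ , u≢v ⟩) S (s≤s⁻¹ (<-≤-trans (nonEdges-⊕ G u≢v uv) h))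
          (λ x∈ y∈ z∈ → path-mono (λ x y → addEdge⁺ (Graph.adj G)) id (2c x∈ y∈ z∈)) circ′ d<S IH)

    -- The sizes add up to `∣ S ∣` for a disconnected set and to one more when a cut vertex is
    -- shared; `g-mono` absorbs the difference.
    combine : ∀ G {S S₁ S₂ : Subset n} → cliques (Graph.adj G) s S ≤ cliques (Graph.adj G) s S₁ + cliques (Graph.adj G) s S₂ →
      0 < ∣ S₁ ∣ → 0 < ∣ S₂ ∣ → ∣ S₁ ∣ + ∣ S₂ ∣ ≤ suc ∣ S ∣ → Bounded G S₁ → Bounded G S₂ → Bounded G S
    combine G {S} {S₁} {S₂} h 0<S₁ 0<S₂ size b₁ b₂ = begin
      cliques (Graph.adj G) s S                                        ≤⟨ h ⟩
      cliques (Graph.adj G) s S₁ + cliques (Graph.adj G) s S₂          ≤⟨ +-mono-≤ b₁ b₂ ⟩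
      g k (∣ S₁ ∣ ∸ 1) + g k (∣ S₂ ∣ ∸ 1)                              ≤⟨ g-superadditive k k<d (∣ S₁ ∣ ∸ 1) (∣ S₂ ∣ ∸ 1) ⟩
      g k ((∣ S₁ ∣ ∸ 1) + (∣ S₂ ∣ ∸ 1))                                ≤⟨ g-mono k k<d (s≤s⁻¹ (s≤s⁻¹ (≤-trans (≤-reflexive e) (≤-trans size S≤)))) ⟩
      g k (∣ S ∣ ∸ 1)                                                  ∎
      where
      open ≤-Reasoning
      e : suc (suc ((∣ S₁ ∣ ∸ 1) + (∣ S₂ ∣ ∸ 1))) ≡ ∣ S₁ ∣ + ∣ S₂ ∣
      e = trans (cong suc (≡sym (+-suc (∣ S₁ ∣ ∸ 1) (∣ S₂ ∣ ∸ 1)))) (cong₂ _+_ (m+[n∸m]≡n 0<S₁) (m+[n∸m]≡n 0<S₂))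
      S≤ : suc ∣ S ∣ ≤ suc (suc (∣ S ∣ ∸ 1))
      S≤ = s≤s (m≤n+m∸n ∣ S ∣ 1)

  -- By induction on the size: disconnected sets and sets with a cut vertex are split, small ones
  -- obey the binomial bound, and only nonseparable sets with more than `c` vertices require the
  -- strict estimate.
  clique-bound : ∀ m (G : Graph n) S → ∣ S ∣ ≤ m → 0 < ∣ S ∣ → CircOn (Graph.adj G) S (suc d) →
    cliques (Graph.adj G) s S ≤ g {d} k (∣ S ∣ ∸ 1)
  clique-bound-below : ∀ m (S : Subset n) → ∣ S ∣ ≤ suc m → (G : Graph n) → ∀ R → 0 < ∣ R ∣ → ∣ R ∣ < ∣ S ∣ →
    CircOn (Graph.adj G) R (suc d) → cliques (Graph.adj G) s R ≤ g {d} k (∣ R ∣ ∸ 1)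
  clique-bound-below m S h G R 0<R R<S = clique-bound m G R (s≤s⁻¹ (≤-trans R<S h)) 0<R

  clique-bound zero G S h 0<S = contradiction h (<⇒≱ 0<S)
  clique-bound (suc m) G S h 0<S circ with connected-or-separated G S
  ... | inj₂ sep = combine G (cliques-separate G s id closed) (∈⇒∣∣>0 a∈) (∈⇒∣∣>0 b∈′)
      (≤-trans (≤-reflexive size) (n≤1+n ∣ S ∣))
      (clique-bound-below m S h G part (∈⇒∣∣>0 a∈) (p⊂q⇒∣p∣<∣q∣ (part⊆ , _ , b∈ , b∉)) (CircOn-⊆ part⊆ circ))
      (clique-bound-below m S h G (S ─ part) (∈⇒∣∣>0 b∈′) (subst (∣ S ─ part ∣ <_) size (m<n+m _ (∈⇒∣∣>0 a∈))) (CircOn-⊆ (p─q⊆p S part) circ))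
    where
    open Separated sep
    b∈′ = x∈p∧x∉q⇒x∈p─q b∈ b∉
    size = ∣p─q∣+∣q∣ part⊆
  ... | inj₁ _ with two-connected-or-cut G S
  ...   | inj₂ (v , v∈ , sep) = combine G (cliques-separate G s {S} {part} {S₁} (p⊆p∪q ⁅ v ⁆) cl) (∈⇒∣∣>0 a∈₁) (∈⇒∣∣>0 b∈′)
      (≤-reflexive (trans (cong (_+ ∣ S ─ part ∣) (∣p∪x∣ v∉)) (cong suc size)))
      (clique-bound-below m S h G S₁ (∈⇒∣∣>0 a∈₁) (p⊂q⇒∣p∣<∣q∣ (S₁⊆ , _ , ∈p-x⇒∈p b∈ , b∉₁)) (CircOn-⊆ S₁⊆ circ))
      (clique-bound-below m S h G (S ─ part) (∈⇒∣∣>0 b∈′) (subst (∣ S ─ part ∣ <_) size (m<n+m _ (∈⇒∣∣>0 a∈))) (CircOn-⊆ (p─q⊆p S part) circ))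
    where
    open Separated sep
    S₁ = part ∪ ⁅ v ⁆
    a∈₁ : a ∈ S₁
    a∈₁ = p⊆p∪q ⁅ v ⁆ a∈
    part⊆S : part ⊆ S
    part⊆S i = ∈p-x⇒∈p (part⊆ i)
    b∈′ = x∈p∧x∉q⇒x∈p─q (∈p-x⇒∈p b∈) b∉
    v∉ : v ∉ part
    v∉ i = x∉p-x S v (part⊆ i)
    size = ∣p─q∣+∣q∣ part⊆S
    S₁⊆ : S₁ ⊆ S
    S₁⊆ i = case x∈p∪q⁻ part ⁅ v ⁆ i of λ where
      (inj₁ j) → part⊆S j
      (inj₂ j) → subst (_∈ S) (≡sym (x∈⁅y⁆⇒x≡y v j)) v∈
    b∉₁ : b ∉ S₁
    b∉₁ i = case x∈p∪q⁻ part ⁅ v ⁆ i of λ where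
      (inj₁ j) → b∉ j
      (inj₂ j) → ∈p-x⇒≢ b∈ (x∈⁅y⁆⇒x≡y v j)
    cl : ∀ {u w} → u ∈ part → w ∈ S → Graph.adj G u w ≡ true → w ∈ S₁
    cl {w = w} u∈ w∈ e = case w ≟ v of λ where
      (yes refl) → q⊆p∪q part ⁅ v ⁆ (x∈⁅x⁆ v)
      (no ne) → p⊆p∪q ⁅ v ⁆ (closed u∈ (x∈p∧x≢y⇒x∈p-y w∈ ne) e)
  ...   | inj₁ 2c with ∣ S ∣ ℕ.≤? suc d
  ...     | yes S≤ = ≤-trans (cliques≤binomial (Graph.adj G) s S) (≤-reflexive (trans (cong (_C s) (≡sym (m+[n∸m]≡n 0<S))) (F≡g k k<d (∸-monoˡ-≤ 1 S≤))))
  ...     | no S≰ = <⇒≤ (strict-from _ G S ≤-refl 2c circ (≰⇒> S≰) (clique-bound-below m S h))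

  block-strict : (G : Graph n) (S : Subset n) → TwoConnected (Graph.adj G) S → CircOn (Graph.adj G) S (suc d) → suc d < ∣ S ∣ →
    cliques (Graph.adj G) s S < g {d} k (∣ S ∣ ∸ 1)
  block-strict G S 2c circ d<S = strict-from _ G S ≤-refl 2c circ d<S λ G R 0<R _ → clique-bound ∣ R ∣ G R ≤-refl 0<R

-- Decomposition into blocks

record Split (A : Adj n) (S S₁ S₂ : Subset n) (v : Fin n) : Set where
  field
    S₁⊆    : S₁ ⊆ S
    S₂⊆    : S₂ ⊆ S
    cover  : ∀ {x} → x ∈ S → x ∈ S₁ ⊎ x ∈ S₂
    v∈₁    : v ∈ S₁
    v∈₂    : v ∈ S₂
    common : ∀ {x} → x ∈ S₁ → x ∈ S₂ → x ≡ v
    edge   : ∀ {u w} → u ∈ S₁ → w ∈ S₂ → A u w ≡ true → u ≡ v ⊎ w ≡ v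
    {x₁ x₂} : Fin n
    x₁∈    : x₁ ∈ S₁
    x₁≢v   : x₁ ≢ v
    x₂∈    : x₂ ∈ S₂
    x₂≢v   : x₂ ≢ v

  x₁∉ : x₁ ∉ S₂
  x₁∉ i = x₁≢v (common x₁∈ i)

  x₂∉ : x₂ ∉ S₁
  x₂∉ i = x₂≢v (common i x₂∈)

split-swap : {A : Adj n} {S S₁ S₂ : Subset n} {v : Fin n} → SymmetricAdj A → Split A S S₁ S₂ v → Split A S S₂ S₁ v
split-swap sy σ = record
  { S₁⊆ = S₂⊆ ; S₂⊆ = S₁⊆ ; cover = [ inj₂ , inj₁ ]′ ∘ cover ; v∈₁ = v∈₂ ; v∈₂ = v∈₁
  ; common = λ i j → common j i
  ; edge = λ {u} {w} i j e → [ inj₂ , inj₁ ]′ (edge j i (trans (sy w u) e))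
  ; x₁∈ = x₂∈ ; x₁≢v = x₂≢v ; x₂∈ = x₁∈ ; x₂≢v = x₁≢v }
  where open Split σ

split-size : {A : Adj n} {S S₁ S₂ : Subset n} {v : Fin n} → Split A S S₁ S₂ v → ∣ S₁ ∣ + ∣ S₂ ∣ ≡ suc ∣ S ∣
split-size {S = S} {S₁} {S₂} {v} σ = trans (cong (∣ S₁ ∣ +_) (≡sym (∣p-x∣ v∈₂))) (trans (+-suc ∣ S₁ ∣ ∣ S₂ - v ∣)
  (cong suc (≤-antisym
    (∣∣+∣∣-disjoint S₁⊆ (λ i → S₂⊆ (∈p-x⇒∈p {p = S₂} i)) λ i j → ∈p-x⇒≢ {p = S₂} j (common i (∈p-x⇒∈p {p = S₂} j)))
    (∣∣≤∣∣+∣∣ {p = S₁} {S₂ - v} λ {x} i → case cover i of λ where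
      (inj₁ j) → inj₁ j
      (inj₂ j) → case x ≟ v of λ where
        (yes refl) → inj₁ v∈₁
        (no ne) → inj₂ (x∈p∧x≢y⇒x∈p-y j ne)))))
  where open Split σ

-- A path in `S` leaves `S₁` only through `v`, so on its way to `v` it can be cut short there.
split-connected : {A : Adj n} → SymmetricAdj A → ∀ {S S₁ S₂ : Subset n} {v} → Split A S S₁ S₂ v → ConnectedOn A S → ConnectedOn A S₁
split-connected {A = A} sy {S} {S₁} {S₂} {v} σ con u∈ w∈ = path-++ (to-v (con (S₁⊆ u∈) (S₁⊆ v∈₁)) u∈)
  (path-reverse sy (to-v (con (S₁⊆ w∈) (S₁⊆ v∈₁)) w∈))
  where
  open Split σ
  to-v : ∀ {u} → PathIn A S u v → u ∈ S₁ → PathIn A S₁ u v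
  to-v (here _) u∈ = here u∈
  to-v (step _ e p) u∈ with cover (path-start p)
  ... | inj₁ w∈ = step u∈ e (to-v p w∈)
  ... | inj₂ w∈ with edge u∈ w∈ e
  ...   | inj₁ refl = here u∈
  ...   | inj₂ refl = step u∈ e (here v∈₁)

split-cliques : (A : Adj n) {S S₁ S₂ : Subset n} {v : Fin n} → Split A S S₁ S₂ v → ∀ s → cliques A s S ≤ cliques A s S₁ + cliques A s S₂
split-cliques A {S} {S₁} {S₂} σ s = cliques-cover A s S S₁ S₂ side
  where
  open Split σ
  side : ∀ {T} → ∣ T ∣ ≡ s → IsComplete A T → T ⊆ S → T ⊆ S₁ ⊎ T ⊆ S₂
  side {T} _ k f with any? (λ u → (u ∈? T) ×-dec ¬? (u ∈? S₂))
  ... | no none = inj₂ λ {x} x∈ → decidable-stable (x ∈? S₂) λ x∉ → none (x , x∈ , x∉)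
  ... | yes (u , u∈ , u∉) = inj₁ λ {w} w∈ → in-S₁ w∈ (cover (f w∈)) (u ≟ w)
    where
    u∈₁ : u ∈ S₁
    u∈₁ = [ id , (λ i → contradiction i u∉) ]′ (cover (f u∈))
    in-S₁ : ∀ {w} → w ∈ T → w ∈ S₁ ⊎ w ∈ S₂ → Dec (u ≡ w) → w ∈ S₁
    in-S₁ _ (inj₁ i) _ = i
    in-S₁ _ (inj₂ i) (yes refl) = contradiction i u∉
    in-S₁ w∈ (inj₂ i) (no ne) with edge u∈₁ i (k u∈ w∈ ne)
    ... | inj₁ refl = contradiction v∈₂ u∉
    ... | inj₂ refl = v∈₁

-- If `T` had vertices proper to both sides, a path in `T - v` would join them, although no edge
-- leads out of `S₁ - v` there. Such a path comes from 2-connectedness if `v` is in `T` and from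
-- connectedness otherwise.
nonseparable-side : {A : Adj n} → ∀ {S S₁ S₂ T : Subset n} {v} → Split A S S₁ S₂ v → T ⊆ S → ConnectedOn A T → TwoConnected A T →
  T ⊆ S₁ ⊎ T ⊆ S₂
nonseparable-side {A = A} {S} {S₁} {S₂} {T} {v} σ T⊆ con 2c
  with any? (λ x → (x ∈? T) ×-dec ¬? (x ∈? S₂)) | any? (λ y → (y ∈? T) ×-dec ¬? (y ∈? S₁))
... | no none | _ = inj₂ λ {x} x∈ → decidable-stable (x ∈? S₂) λ x∉ → none (x , x∈ , x∉)
... | _ | no none = inj₁ λ {x} x∈ → decidable-stable (x ∈? S₁) λ x∉ → none (x , x∈ , x∉)
... | yes (x , x∈ , x∉) | yes (y , y∈ , y∉) = contradiction
  (∈p-x⇒∈p {p = S₁} (path-closed closed (path (v ∈? T)) (x∈p∧x≢y⇒x∈p-y x∈₁ λ { refl → x∉ v∈₂ }))) y∉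
  where
  open Split σ
  x∈₁ : x ∈ S₁
  x∈₁ = [ id , (λ i → contradiction i x∉) ]′ (cover (T⊆ x∈))
  path : Dec (v ∈ T) → PathIn A (T - v) x y
  path (yes v∈) = 2c v∈ (x∈p∧x≢y⇒x∈p-y x∈ λ { refl → x∉ v∈₂ }) (x∈p∧x≢y⇒x∈p-y y∈ λ { refl → y∉ v∈₁ })
  path (no v∉) = subst (λ U → PathIn A U x y) (≡sym (p-x≡p v∉)) (con x∈ y∈)
  closed : ∀ {u w} → u ∈ S₁ - v → w ∈ T - v → A u w ≡ true → w ∈ S₁ - v
  closed {u} {w} u∈ w∈ e with cover (T⊆ (∈p-x⇒∈p {p = T} w∈))
  ... | inj₁ w∈₁ = x∈p∧x≢y⇒x∈p-y w∈₁ (∈p-x⇒≢ {p = T} w∈)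
  ... | inj₂ w∈₂ with edge (∈p-x⇒∈p {p = S₁} u∈) w∈₂ e
  ...   | inj₁ u≡v = contradiction u≡v (∈p-x⇒≢ {p = S₁} u∈)
  ...   | inj₂ w≡v = contradiction w≡v (∈p-x⇒≢ {p = T} w∈)

split-walk : {A : Adj n} → ∀ {S S₁ S₂ : Subset n} {v} → Split A S S₁ S₂ v → ∀ {u w l} → Walk A u w l → v ∉ˡ l → All (_∈ S) l →
  u ∈ S₁ → All (_∈ S₁) l
split-walk σ stop _ _ u∈ = u∈ ∷ []
split-walk σ (e ◅ W) v∉ (_ ∷ al) u∈ with Split.cover σ (All.lookup al (start∈ W))
... | inj₁ i = u∈ ∷ split-walk σ W (v∉ ∘ there) al i
... | inj₂ i with Split.edge σ u∈ i e
...   | inj₁ refl = contradiction (here refl) v∉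
...   | inj₂ refl = contradiction (there (start∈ W)) v∉

-- Rotated to begin in `v`, the cycle minus `v` is a path that avoids `v` and therefore stays on one
-- side.
split-cycle : {A : Adj n} → SymmetricAdj A → ∀ {S S₁ S₂ : Subset n} {v} → Split A S S₁ S₂ v → ∀ {u w l} →
  Walk A u w l → A w u ≡ true → Unique l → All (_∈ S) l → All (_∈ S₁) l ⊎ All (_∈ S₂) l
split-cycle sy {S} {S₁} {S₂} {v} σ {u} {w} {l} W e un al with v ∈ˡ? l
... | no v∉ = [ (λ i → inj₁ (split-walk σ W v∉ al i)) , (λ i → inj₂ (split-walk (split-swap sy σ) W v∉ al i)) ]′
      (Split.cover σ (All.lookup al (start∈ W)))
... | yes v∈ with rotate W e un v∈
...   | _ , _ , stop , _ , _ , _ , _ , sup = inj₁ (All.tabulate λ i → case sup i of λ { (here refl) → Split.v∈₁ σ })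
...   | _ , r , (_ ◅ W′) , _ , v∉ ∷ _ , _ , sub , sup = by-side (Split.cover σ (All.lookup al (sub (there (start∈ W′)))))
  where
  v∉r : v ∉ˡ r
  v∉r i = All.lookup v∉ i refl
  al′ : All (_∈ S) r
  al′ = All.tabulate λ i → All.lookup al (sub (there i))
  back : ∀ {U} → v ∈ U → All (_∈ U) r → All (_∈ U) l
  back v∈U a = All.tabulate λ i → case sup i of λ where
    (here refl) → v∈U
    (there j) → All.lookup a j
  by-side : _ → All (_∈ S₁) l ⊎ All (_∈ S₂) l
  by-side (inj₁ i) = inj₁ (back (Split.v∈₁ σ) (split-walk σ W′ v∉r al′ i))
  by-side (inj₂ i) = inj₂ (back (Split.v∈₂ σ) (split-walk (split-swap sy σ) W′ v∉r al′ i))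

-- Leaves carry no condition. Nonseparability is stated apart, in `Piece`, so that the tree can be
-- transported to a graph with an added edge.
data BlockTree (A : Adj n) : Subset n → List (Subset n) → Set where
  leaf : ∀ {S} → BlockTree A S (S ∷ [])
  node : ∀ {S S₁ S₂ v l₁ l₂} → Split A S S₁ S₂ v → BlockTree A S₁ l₁ → BlockTree A S₂ l₂ → BlockTree A S (l₁ ++ l₂)

record Piece (A : Adj n) (D : Subset n) : Set where
  field
    nontrivial   : 1 < ∣ D ∣
    connected    : ConnectedOn A D
    twoConnected : TwoConnected A D

  nonseparable : Nonseparable A D
  nonseparable = ∣∣>0⇒Nonempty (<-trans z<s nontrivial) , (λ {_} {_} → connected) , λ {_} → twoConnected

-- Additive over a split, whose two sides share exactly one vertex; also the argument of `g`.
weight : Subset n → ℕ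
weight D = ∣ D ∣ ∸ 1

tree-⊆ : {A : Adj n} → ∀ {S l D} → BlockTree A S l → D ∈ˡ l → D ⊆ S
tree-⊆ leaf (here refl) = id
tree-⊆ (node {l₁ = l₁} σ t₁ t₂) i with ∈-++⁻ l₁ i
... | inj₁ j = Split.S₁⊆ σ ∘ tree-⊆ t₁ j
... | inj₂ j = Split.S₂⊆ σ ∘ tree-⊆ t₂ j

-- Leaves with at least two vertices hence cannot occur on both sides of a split, nor be contained
-- in one another across it.
shared-small : {A : Adj n} → ∀ {S S₁ S₂ D : Subset n} {v} → Split A S S₁ S₂ v → D ⊆ S₁ → D ⊆ S₂ → ∣ D ∣ ≤ 1
shared-small {v = v} σ f h = ∣∣≤length (v ∷ []) λ i → here (Split.common σ (f i) (h i))

tree-unique : {A : Adj n} → ∀ {S l} → BlockTree A S l → All (λ D → 1 < ∣ D ∣) l → Unique l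
tree-unique leaf _ = [] ∷ []
tree-unique (node {l₁ = l₁} σ t₁ t₂) al = unique-++ (tree-unique t₁ (AllP.++⁻ˡ l₁ al)) (tree-unique t₂ (AllP.++⁻ʳ l₁ al))
  λ i j → <⇒≱ (All.lookup al (∈-++⁺ˡ i)) (shared-small σ (tree-⊆ t₁ i) (tree-⊆ t₂ j))

private
  pred-sum : ∀ a b {x} → 0 < a → 0 < b → a + b ≡ suc x → (a ∸ 1) + (b ∸ 1) ≡ x ∸ 1
  pred-sum (suc a) (suc b) _ _ e = cong (_∸ 1) (trans (≡sym (+-suc a b)) (suc-injective e))

tree-weight : {A : Adj n} → ∀ {S l} → BlockTree A S l → sum (map weight l) ≡ weight S
tree-weight {S = S} leaf = +-identityʳ (weight S)
tree-weight {S = S} (node {S₁ = S₁} {S₂} {l₁ = l₁} {l₂} σ t₁ t₂) = trans (cong sum (map-++ weight l₁ l₂))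
  (trans (sum-++ (map weight l₁) (map weight l₂)) (trans (cong₂ _+_ (tree-weight t₁) (tree-weight t₂))
    (pred-sum ∣ S₁ ∣ ∣ S₂ ∣ (∈⇒∣∣>0 (Split.v∈₁ σ)) (∈⇒∣∣>0 (Split.v∈₂ σ)) (split-size σ))))

tree-cliques : (A : Adj n) (s : ℕ) → ∀ {S l} → BlockTree A S l → cliques A s S ≤ sum (map (cliques A s) l)
tree-cliques A s leaf = m≤m+n _ 0
tree-cliques A s (node {S₁ = S₁} {S₂} {l₁ = l₁} {l₂} σ t₁ t₂) = ≤-trans (split-cliques A σ s)
  (≤-trans (+-mono-≤ (tree-cliques A s t₁) (tree-cliques A s t₂))
    (≤-reflexive (≡sym (trans (cong sum (map-++ (cliques A s) l₁ l₂)) (sum-++ (map (cliques A s) l₁) (map (cliques A s) l₂))))))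

tree-covers : {A : Adj n} → ∀ {S l T} → BlockTree A S l → T ⊆ S → ConnectedOn A T → TwoConnected A T → ∃ λ D → D ∈ˡ l × T ⊆ D
tree-covers {S = S} leaf T⊆ _ _ = S , here refl , T⊆
tree-covers (node {l₁ = l₁} σ t₁ t₂) T⊆ con 2c with nonseparable-side σ T⊆ con 2c
... | inj₁ f with tree-covers t₁ f con 2c
...   | D , i , h = D , ∈-++⁺ˡ i , h
tree-covers (node {l₁ = l₁} σ t₁ t₂) T⊆ con 2c | inj₂ f with tree-covers t₂ f con 2c
... | D , i , h = D , ∈-++⁺ʳ l₁ i , h

tree-antichain : {A : Adj n} → ∀ {S l D E} → BlockTree A S l → All (λ D → 1 < ∣ D ∣) l → D ∈ˡ l → E ∈ˡ l → D ⊆ E → D ≡ E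
tree-antichain leaf _ (here refl) (here refl) _ = refl
tree-antichain (node {l₁ = l₁} σ t₁ t₂) al i j f with ∈-++⁻ l₁ i | ∈-++⁻ l₁ j
... | inj₁ a | inj₁ b = tree-antichain t₁ (AllP.++⁻ˡ l₁ al) a b f
... | inj₂ a | inj₂ b = tree-antichain t₂ (AllP.++⁻ʳ l₁ al) a b f
... | inj₁ a | inj₂ b = contradiction (shared-small σ (tree-⊆ t₁ a) (tree-⊆ t₂ b ∘ f)) (<⇒≱ (All.lookup al i))
... | inj₂ a | inj₁ b = contradiction (shared-small σ (tree-⊆ t₁ b ∘ f) (tree-⊆ t₂ a)) (<⇒≱ (All.lookup al i))

-- By `split-cycle` every cycle ends up in a single leaf, which bounds its length.
tree-circumference : {A : Adj n} → SymmetricAdj A → ∀ {S l c} → BlockTree A S l → All (λ D → ∣ D ∣ ≤ c) l → CircOn A S c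
tree-circumference sy leaf (h ∷ []) W e un al _ = ≤-trans (unique⇒length≤∣∣ un al) h
tree-circumference sy (node {l₁ = l₁} σ t₁ t₂) h W e un al 3≤ with split-cycle sy σ W e un al
... | inj₁ a = tree-circumference sy t₁ (AllP.++⁻ˡ l₁ h) W e un a 3≤
... | inj₂ a = tree-circumference sy t₂ (AllP.++⁻ʳ l₁ h) W e un a 3≤

-- An edge inside one leaf never crosses a split. The hypothesis is conditional on `u` and `v` lying
-- in `S`, so that it can be handed down to both sides; a side containing both ends also contains
-- the leaf in its list, as the sides share only one vertex.
tree-addEdge : {A : Adj n} → ∀ {u v S l} → u ≢ v → BlockTree A S l → (u ∈ S → v ∈ S → ∃ λ D → D ∈ˡ l × u ∈ D × v ∈ D) →
  BlockTree (addEdge A u v) S l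
tree-addEdge _ leaf _ = leaf
tree-addEdge {A = A} {u} {v} u≢v (node {S₁ = S₁} {S₂} {z} {l₁} {l₂} σ t₁ t₂) h =
  node (record { S₁⊆ = S₁⊆ ; S₂⊆ = S₂⊆ ; cover = cover ; v∈₁ = v∈₁ ; v∈₂ = v∈₂ ; common = common ; edge = edge′
               ; x₁∈ = x₁∈ ; x₁≢v = x₁≢v ; x₂∈ = x₂∈ ; x₂≢v = x₂≢v })
    (tree-addEdge u≢v t₁ λ u∈ v∈ → case both (S₁⊆ u∈) (S₁⊆ v∈) of λ where
      (inj₁ (_ , _ , r)) → r
      (inj₂ (u∈₂ , v∈₂ , _)) → contradiction (trans (common u∈ u∈₂) (≡sym (common v∈ v∈₂))) u≢v)
    (tree-addEdge u≢v t₂ λ u∈ v∈ → case both (S₂⊆ u∈) (S₂⊆ v∈) of λ where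
      (inj₁ (u∈₁ , v∈₁ , _)) → contradiction (trans (common u∈₁ u∈) (≡sym (common v∈₁ v∈))) u≢v
      (inj₂ (_ , _ , r)) → r)
  where
  open Split σ
  both : u ∈ _ → v ∈ _ → (u ∈ S₁ × v ∈ S₁ × ∃ λ D → D ∈ˡ l₁ × u ∈ D × v ∈ D) ⊎ (u ∈ S₂ × v ∈ S₂ × ∃ λ D → D ∈ˡ l₂ × u ∈ D × v ∈ D)
  both u∈ v∈ with h u∈ v∈
  ... | D , i , a , b with ∈-++⁻ l₁ i
  ...   | inj₁ j = inj₁ (tree-⊆ t₁ j a , tree-⊆ t₁ j b , D , j , a , b)
  ...   | inj₂ j = inj₂ (tree-⊆ t₂ j a , tree-⊆ t₂ j b , D , j , a , b)
  edge′ : ∀ {x y} → x ∈ S₁ → y ∈ S₂ → addEdge A u v x y ≡ true → x ≡ z ⊎ y ≡ z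
  edge′ x∈ y∈ e with addEdge⁻ A e
  ... | inj₁ f = edge x∈ y∈ f
  ... | inj₂ (inj₁ (refl , refl)) = case both (S₁⊆ x∈) (S₂⊆ y∈) of λ where
    (inj₁ (_ , v∈ , _)) → inj₂ (common v∈ y∈)
    (inj₂ (u∈ , _ , _)) → inj₁ (common x∈ u∈)
  ... | inj₂ (inj₂ (refl , refl)) = case both (S₂⊆ y∈) (S₁⊆ x∈) of λ where
    (inj₁ (u∈ , _ , _)) → inj₂ (common u∈ y∈)
    (inj₂ (_ , v∈ , _)) → inj₁ (common x∈ v∈)

cut-split : {A : Adj n} {S : Subset n} {v : Fin n} → v ∈ S → (sep : Separated A (S - v)) →
  Split A S (Separated.part sep ∪ ⁅ v ⁆) (S ─ Separated.part sep) v
cut-split {A = A} {S} {v} v∈ sep = record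
  { S₁⊆ = λ i → [ part⊆S , (λ { refl → v∈ }) ]′ (∪⁻ i)
  ; S₂⊆ = p─q⊆p S part
  ; cover = λ {x} i → case x ∈? part of λ where
      (yes j) → inj₁ (p⊆p∪q ⁅ v ⁆ j)
      (no j) → inj₂ (x∈p∧x∉q⇒x∈p─q i j)
  ; v∈₁ = q⊆p∪q part ⁅ v ⁆ (x∈⁅x⁆ v)
  ; v∈₂ = x∈p∧x∉q⇒x∈p─q v∈ v∉
  ; common = λ i j → [ (λ k → contradiction k (─⁻ {p = S} j)) , id ]′ (∪⁻ i)
  ; edge = λ i j e → edge (∪⁻ i) j e
  ; x₁∈ = p⊆p∪q ⁅ v ⁆ a∈ ; x₁≢v = λ { refl → v∉ a∈ }
  ; x₂∈ = x∈p∧x∉q⇒x∈p─q (∈p-x⇒∈p {p = S} b∈) b∉ ; x₂≢v = ∈p-x⇒≢ {p = S} b∈ }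
  where
  open Separated sep
  part⊆S : part ⊆ S
  part⊆S i = ∈p-x⇒∈p {p = S} (part⊆ i)
  v∉ : v ∉ part
  v∉ i = x∉p-x S v (part⊆ i)
  ∪⁻ : ∀ {x} → x ∈ part ∪ ⁅ v ⁆ → x ∈ part ⊎ x ≡ v
  ∪⁻ i with x∈p∪q⁻ part ⁅ v ⁆ i
  ... | inj₁ j = inj₁ j
  ... | inj₂ j = inj₂ (x∈⁅y⁆⇒x≡y v j)
  edge : ∀ {u w} → u ∈ part ⊎ u ≡ v → w ∈ S ─ part → A u w ≡ true → u ≡ v ⊎ w ≡ v
  edge (inj₂ e) _ _ = inj₁ e
  edge {w = w} (inj₁ i) j e with w ≟ v
  ... | yes eq = inj₂ eq
  ... | no ne = contradiction (closed i (x∈p∧x≢y⇒x∈p-y (p─q⊆p S part j) ne) e) (─⁻ {p = S} j)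

block-tree : ∀ m (G : Graph n) S → ∣ S ∣ ≤ m → 1 < ∣ S ∣ → ConnectedOn (Graph.adj G) S →
  ∃ λ l → BlockTree (Graph.adj G) S l × All (Piece (Graph.adj G)) l
block-tree zero G S h h′ _ = contradiction h (<⇒≱ (<-trans z<s h′))
block-tree (suc m) G S h 1<S con with two-connected-or-cut G S
... | inj₁ 2c = S ∷ [] , leaf , record { nontrivial = 1<S ; connected = con ; twoConnected = 2c } ∷ []
... | inj₂ (v , v∈ , sep) with cut-split v∈ sep
...   | σ with block-tree m G _ (s≤s⁻¹ (≤-trans (p⊂q⇒∣p∣<∣q∣ (S₁⊆ , x₂ , S₂⊆ x₂∈ , x₂∉)) h)) (two⇒∣∣>1 x₁∈ v∈₁ x₁≢v)
               (split-connected (Graph.sym G) σ con)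
           | block-tree m G _ (s≤s⁻¹ (≤-trans (p⊂q⇒∣p∣<∣q∣ (S₂⊆ , x₁ , S₁⊆ x₁∈ , x₁∉)) h)) (two⇒∣∣>1 x₂∈ v∈₂ x₂≢v)
               (split-connected (Graph.sym G) (split-swap (Graph.sym G) σ) con)
  where open Split σ
...     | l₁ , t₁ , p₁ | l₂ , t₂ , p₂ = l₁ ++ l₂ , node σ t₁ t₂ , AllP.++⁺ p₁ p₂

-- The equality case

sum-map-≤ : {X : Set} {f h : X → ℕ} (l : List X) → (∀ {x} → x ∈ˡ l → f x ≤ h x) → sum (map f l) ≤ sum (map h l)
sum-map-≤ [] _ = z≤n
sum-map-≤ (x ∷ l) f≤h = +-mono-≤ (f≤h (here refl)) (sum-map-≤ l (f≤h ∘ there))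

sum-map-≡⇒≡ : {X : Set} {f h : X → ℕ} (l : List X) → (∀ {x} → x ∈ˡ l → f x ≤ h x) → sum (map h l) ≤ sum (map f l) →
  ∀ {x} → x ∈ˡ l → f x ≡ h x
sum-map-≡⇒≡ {f = f} {h} (x ∷ l) f≤h e i = case i of λ where
    (here refl) → ≤-antisym (f≤h (here refl)) (+-cancelʳ-≤ (sum (map f l)) (h x) (f x) (≤-trans (+-monoʳ-≤ (h x) tail≤) e))
    (there j) → sum-map-≡⇒≡ l (f≤h ∘ there) (+-cancelˡ-≤ (f x) _ _ (≤-trans (+-monoˡ-≤ _ (f≤h (here refl))) e)) j
  where
  tail≤ : sum (map f l) ≤ sum (map h l)
  tail≤ = sum-map-≤ l (f≤h ∘ there)

module Extremal (q : ℕ) {d : ℕ} .{{_ : NonZero d}} (k<d : suc q < d) (G : Graph n) (2≤n : 2 ≤ n) (con : Connected G)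
  (circ : CircumferenceAtMost (Graph.adj G) (suc d)) (extremal : g {d} (suc q) (n ∸ 1) ≤ cliques (Graph.adj G) (suc (suc (suc q))) ⊤) where

  private
    k : ℕ
    k = suc q

    A = Graph.adj G
    s : ℕ
    s = suc (suc k)
    tree = block-tree ∣ ⊤ {n} ∣ G ⊤ ≤-refl (subst (2 ≤_) (≡sym (∣⊤∣≡n n)) 2≤n) con

  blocks : List (Subset n)
  blocks = proj₁ tree

  blocks-tree : BlockTree A ⊤ blocks
  blocks-tree = proj₁ (proj₂ tree)

  private
    pieces : All (Piece A) blocks
    pieces = proj₂ (proj₂ tree)

    nontrivial : All (λ D → 1 < ∣ D ∣) blocks
    nontrivial = All.map Piece.nontrivial pieces

    total : sum (map weight blocks) ≡ n ∸ 1
    total = trans (tree-weight blocks-tree) (cong (_∸ 1) (∣⊤∣≡n n))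

    sum-g : (l : List (Subset n)) → sum (map (g {d} k ∘ weight) l) ≤ g k (sum (map weight l))
    sum-g [] = z≤n
    sum-g (D ∷ l) = ≤-trans (+-monoʳ-≤ _ (sum-g l)) (g-superadditive k k<d (weight D) (sum (map weight l)))

    cliques≤g : ∀ {D} → D ∈ˡ blocks → cliques A s D ≤ g {d} k (weight D)
    cliques≤g {D} i = Bound.clique-bound q k<d ∣ D ∣ G D ≤-refl (<-trans z<s (All.lookup nontrivial i)) (circumference⇒CircOn circ D)

    g≤cliques : g {d} k (n ∸ 1) ≤ sum (map (cliques A s) blocks)
    g≤cliques = ≤-trans extremal (tree-cliques A s blocks-tree)

    -- The number of cliques lies between `g (n - 1)` and the sum of the bounds of the blocks, which
    -- is again at most `g (n - 1)`. Hence every block attains its bound.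
    cliques≡g : ∀ {D} → D ∈ˡ blocks → cliques A s D ≡ g {d} k (weight D)
    cliques≡g = sum-map-≡⇒≡ blocks cliques≤g (≤-trans (sum-g blocks) (≤-trans (≤-reflexive (cong (g k) total)) g≤cliques))

  block-size : ∀ {D} → D ∈ˡ blocks → ∣ D ∣ ≤ suc d
  block-size {D} i = ≮⇒≥ λ d<D → <⇒≢ (Bound.block-strict q k<d G D (Piece.twoConnected (All.lookup pieces i)) (circumference⇒CircOn circ D) d<D)
    (cliques≡g i)

  private
    size≡ : ∀ {D} → D ∈ˡ blocks → suc (weight D) ≡ ∣ D ∣
    size≡ i = m+[n∸m]≡n (<⇒≤ (All.lookup nontrivial i))

    weight≤ : ∀ {D} → D ∈ˡ blocks → weight D ≤ d
    weight≤ i = ∸-monoˡ-≤ 1 (block-size i)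

    equality : sum (map (F (suc k) ∘ weight) blocks) ≡ g {d} k (sum (map weight blocks))
    equality = ≤-antisym (sum-F≤g k k<d weight (All.tabulate weight≤)) (≤-trans (≤-reflexive (cong (g k) total)) (≤-trans g≤cliques
      (sum-map-≤ blocks λ i → ≤-trans (cliques≤g i) (≤-reflexive (≡sym (F≡g k k<d (weight≤ i)))))))

    structure = sum-F≡g k k<d weight {blocks} (All.tabulate λ i → m<n⇒0<n∸m (All.lookup nontrivial i) , weight≤ i) equality

    full : List (Subset n)
    full = filter (full? k k<d weight) blocks

  block-complete : ∀ {D} → D ∈ˡ blocks → s ≤ ∣ D ∣ → IsComplete A D
  block-complete {D} i s≤ = cliques≡binomial⇒complete A s D (s≤s (s≤s z≤n)) s≤
    (trans (cliques≡g i) (trans (≡sym (F≡g k k<d (weight≤ i))) (cong (_C s) (size≡ i))))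

  -- A nonseparable set containing `D` lies inside some leaf, and leaves are pairwise incomparable.
  block-isBlock : ∀ {D} → D ∈ˡ blocks → IsBlock A D
  block-isBlock {D} i = Piece.nonseparable (All.lookup pieces i) , maximal
    where
    maximal : ∀ T → D ⊆ T → Nonseparable A T → T ≡ D
    maximal T D⊆T (_ , conT , 2cT) with tree-covers blocks-tree ⊆⊤ conT 2cT
    ... | E , j , T⊆E = ⊆-antisym (λ x∈ → subst (_ ∈_) (≡sym (tree-antichain blocks-tree nontrivial i j (T⊆E ∘ D⊆T))) (T⊆E x∈)) D⊆T

  isBlock⇒∈ : ∀ {D} → IsBlock A D → D ∈ˡ blocks
  isBlock⇒∈ {D} ((_ , conD , 2cD) , maximal) with tree-covers blocks-tree ⊆⊤ conD 2cD
  ... | E , j , D⊆E = subst (_∈ˡ blocks) (maximal E D⊆E (Piece.nonseparable (All.lookup pieces j))) j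

  fullBlock : Fin (length full) → Subset n
  fullBlock = lookup full

  private
    full⁻ : ∀ {D} → D ∈ˡ full → D ∈ˡ blocks × weight D ≡ d
    full⁻ = ∈-filter⁻ (full? k k<d weight) {xs = blocks}

  fullBlock-injective : Injective _≡_ _≡_ fullBlock
  fullBlock-injective = lookup-injective (UniqueP.filter⁺ (full? k k<d weight) (tree-unique blocks-tree nontrivial)) _ _

  fullBlock-isKBlock : ∀ i → IsKBlock A (suc d) (fullBlock i)
  fullBlock-isKBlock i with full⁻ (∈-lookup {xs = full} i)
  ... | j , w = block-isBlock j , (λ {u} → block-complete j (≤-trans (s≤s k<d) (≤-reflexive (≡sym size))) {u}) , size
    where
    size : ∣ fullBlock i ∣ ≡ suc d
    size = trans (≡sym (size≡ j)) (cong suc w)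

  isBlock∧full⇒fullBlock : ∀ {D} → IsBlock A D → weight D ≡ d → ∃ λ i → D ≡ fullBlock i
  isBlock∧full⇒fullBlock b w = _ , lookup-index (∈-filter⁺ (full? k k<d weight) (isBlock⇒∈ b) w)

  number-full : length full ≡ (n ∸ 1) / d
  number-full = trans (proj₁ structure) (cong (_/ d) total)

  -- The condition says `s ≤ p + 1`. By `sum-F≡g` exactly one block is not full and has weight `p`;
  -- as it has at least `s` vertices, attaining its bound makes it complete.
  isH : k < (n ∸ 1) % d → IsH G (length full) ((n ∸ 1) % d) (suc d)
  isH k<p with proj₂ (proj₂ structure) (subst (λ z → k < z % d) (≡sym total) k<p)
  ... | D₀ , e , w = con , fullBlock , (λ {i} {j} → fullBlock-injective {i} {j}) , fullBlock-isKBlock , inj₂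
      (≤-trans (s≤s z≤n) k<p , D₀ , (block-isBlock D₀∈ , (λ {u} → block-complete D₀∈ (≤-trans (s≤s k<p) (≤-reflexive (≡sym size))) {u}) , size) , classify)
    where
    D₀∈ : D₀ ∈ˡ blocks
    D₀∈ = proj₁ (∈-filter⁻ (¬? ∘ full? k k<d weight) {xs = blocks} (subst (D₀ ∈ˡ_) (≡sym e) (here refl)))
    size : ∣ D₀ ∣ ≡ suc ((n ∸ 1) % d)
    size = trans (≡sym (size≡ D₀∈)) (cong suc (trans w (cong (_% d) total)))
    classify : ∀ D → IsBlock A D → (∃ λ i → D ≡ fullBlock i) ⊎ D ≡ D₀
    classify D b with full? k k<d weight D
    ... | yes full = inj₁ (isBlock∧full⇒fullBlock b full)
    ... | no ¬full with subst (D ∈ˡ_) e (∈-filter⁺ (¬? ∘ full? k k<d weight) (isBlock⇒∈ b) ¬full)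
    ...   | here eq = inj₂ eq

  -- A missing edge inside a block could be added without changing the block tree or the block
  -- sizes, so the circumference would stay at most `c`, against maximality.
  isαKcRestComplete : (∀ u v → u ≢ v → A u v ≡ false → ¬ CircumferenceAtMost (addEdge A u v) (suc d)) →
    IsαKcRestComplete G (length full) (suc d)
  isαKcRestComplete maximal = con , fullBlock , (λ {i} {j} → fullBlock-injective {i} {j}) , fullBlock-isKBlock ,
    λ D b → (λ {u} → complete b {u}) , λ size → isBlock∧full⇒fullBlock b (cong (_∸ 1) size)
    where
    complete : ∀ {D} → IsBlock A D → IsComplete A D
    complete b {u} u∈ {v} v∈ u≢v = decidable-stable (A u v Bool.≟ true) λ ¬uv →
      maximal u v u≢v (≢true⇒false ¬uv) (CircOn⇒circumference
        (tree-circumference (Graph.sym (G ⊕⟨ u , v , u≢v ⟩))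
          (tree-addEdge u≢v blocks-tree λ _ _ → _ , isBlock⇒∈ b , u∈ , v∈) (All.tabulate block-size)))

theorem5 : (n c s : ℕ) (3≤n : 3 ≤ n) (3≤s : 3 ≤ s) (s≤c : s ≤ c) (3≤c : 3 ≤ c)
    (G : Graph n) → Connected G → CircumferenceAtMost (adj G) c →
    N s G ≡ hval s n c 3≤c →
    (s ≤ suc (rem n c 3≤c) → IsH G (alpha n c 3≤c) (rem n c 3≤c) c) ×
    (suc (rem n c 3≤c) < s → (L : Graph n) → IsEdgeMaximal G c L →
    IsαKcRestComplete L (alpha n c 3≤c) c)
theorem5 n (suc d@(suc (suc _))) s@(suc (suc (suc q))) 3≤n (s≤s (s≤s (s≤s _))) s≤c 3≤c@(s≤s (s≤s (s≤s _))) G con circ count≡ =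
  (λ s≤ → let open Extremal q k<d G 2≤n con circ (≤-trans extremal (N≤cliques s G)) in
    subst₂ (λ α p → IsH G α p (suc d)) number-full rem≡ (isH (subst (suc q <_) (≡sym rem≡) (s≤s⁻¹ s≤)))) ,
  -- The graph `L` has at least the `s`-cliques of `G` and obeys the same upper bound, so it is
  -- extremal as well.
  λ _ L (G⊆L , circL , maximal) →
    let open Extremal q k<d L 2≤n (λ u∈ v∈ → path-mono G⊆L id (con u∈ v∈)) circL
              (≤-trans extremal (≤-trans (N≤cliques s G) (cliques-⊆ G⊆L s ⊤))) in
    subst (λ α → IsαKcRestComplete L α (suc d)) number-full (isαKcRestComplete maximal)
  where
  k<d : suc q < d
  k<d = s≤s⁻¹ s≤c
  2≤n : 2 ≤ n
  2≤n = <⇒≤ 3≤n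
  rem≡ : (n ∸ 1) % d ≡ rem n (suc d) 3≤c
  rem≡ = m%n≡m∸m/n*n (n ∸ 1) d
  extremal : g {d} (suc q) (n ∸ 1) ≤ N s G
  extremal = ≤-reflexive (trans (cong (λ p → alpha n (suc d) 3≤c * F (suc (suc q)) d + F (suc (suc q)) p) rem≡) (≡sym count≡))
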